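{- Let $q=8m+3$ be a prime power ($m$ a positive integer) with characteristic $p$, and let $\omega$ be a primitive element of $\mathbb{F}_{q^2}$. Let $a,b$ be the integers with $q^2=a^2+2b^2$, $p\nmid a$, $a\equiv 1\pmod 4$, where the sign of $b$ is the one for which $64\,\big|(C_1^{(8,q^2)}+1)\cap C_2^{(8,q^2)}\big|=q^2+1+6q+4a+16b$. Suppose that either (a) $I=\{0,2,3\}$ and $3q=a+4b+16$, or (b) $I=\{0,2,7\}$ and $3q=a-4b+16$. Let $y$ be the unique element of $I$ whose parity differs from that of the other two elements, $J_1=\{y+2+4i \bmod (q+1): i\in\{0,\dots,m-1\}\}$, $J_2=\{y+4i \bmod (q+1): i\in\{0,\dots,m-1\}\}$, and define $E_0=\big(\bigcup_{i\in I}C_i^{(8,q^2)}\big)\cup\big(\bigcup_{i\in J_1}L_i\big)$, $E_1=\big(\bigcup_{i\in I}C_{i+2}^{(8,q^2)}\big)\cup\big(\bigcup_{i\in J_2}L_i\big)$, $E_2=\big(\bigcup_{i\in I}C_{i+1}^{(8,q^2)}\big)\cup\big(\bigcup_{i\in J_1}L_{i+1}\big)$, $E_3=\big(\bigcup_{i\in I}C_{i+3}^{(8,q^2)}\big)\cup\big(\bigcup_{i\in J_2}L_{i+1}\big)$. Let $D_0=C_0^{(4,q^2)}\cup C_1^{(4,q^2)}$ and $D_2=C_2^{(4,q^2)}\cup C_3^{(4,q^2)}$. Then in the group ring $\mathbb{Z}[(\mathbb{F}_{q^2},+)]$, $$E_0E_1^{(-1)}+E_1E_0^{(-1)}+E_2E_3^{(-1)}+E_3E_2^{(-1)}=(q-1)^2\mathbb{F}_{q^2}+2D_0-2D_2.$$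 In particular, there exists a difference family with parameters $(2q^2;q^2,q^2,q^2,q^2-1;2q^2-2)$ in $\mathbb{Z}_2\times(\mathbb{F}_{q^2},+)$.
   Context: For $N\mid q^2-1$, $C_i^{(N,q^2)}=\omega^i\langle\omega^N\rangle$ with indices mod $N$; $L_i=C_i^{(q+1,q^2)}$ with index mod $q+1$; $C+1=\{x+1:x\in C\}$. Group ring conventions: subsets of $\mathbb{F}_{q^2}$ are identified with the sum of their elements in $\mathbb{Z}[(\mathbb{F}_{q^2},+)]$; $X^{(-1)}=\sum c_x(-x)$ for $X=\sum c_x x$; $\mathbb{F}_{q^2}$ denotes the sum of all field elements. A collection $\{B_1,\dots,B_\ell\}$ of subsets of a finite abelian group $G$ with $|B_i|=k_i$ is a difference family with parameters $(|G|;k_1,\dots,k_\ell;\lambda)$ if every nonzero element of $G$ occurs exactly $\lambda$ times among the differences $x-y$, $x,y\in B_i$, $x\neq y$, $i=1,\dots,\ell$. (It is known that for $q\equiv 3 \pmod 8$ the integers $a,|b|$ above are uniquely determined, and the order-8 cyclotomic numbers of $\mathbb{F}_{q^2}$ are given by formulas in $q,a,b$; the sign convention on $b$ stated in the claim is the one in which $64|(C_1^{(8,q^2)}+1)\cap C_2^{(8,q^2)}|=q^2+1+6q+4a+16b$.) -}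

module Defs where

open import Level using (0ℓ)
open import Data.Bool using (Bool; true; false; _∧_; _∨_; _xor_; if_then_else_)
open import Data.Nat as ℕ using (ℕ; zero; suc; NonZero; _%_; _≡ᵇ_)
open import Data.Integer as ℤ using (ℤ; +_)
open import Data.List using (List; []; _∷_; length; map; foldr; upTo; filterᵇ; concatMap)
open import Data.Bool.ListAction using (any)
open import Data.List.Relation.Unary.Unique.Propositional using (Unique)
open import Data.List.Membership.Propositional using (_∈_)
open import Data.Product using (_×_; _,_; ∃)
open import Relation.Nullary using (¬_; does)
open import Relation.Binary.PropositionalEquality using (_≡_; _≢_)
open import Relation.Binary.Definitions using (DecidableEquality)
open import Algebra.Core using (Op₁; Op₂)
open import Algebra.Structures using (IsCommutativeRing)

record FiniteField : Set₁ where
  infixl 7 _*_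
  infixl 6 _+_ _-_
  field
    Carrier : Set
    _+_ _*_ : Op₂ Carrier
    -_      : Op₁ Carrier
    0# 1#   : Carrier
    isCommutativeRing : IsCommutativeRing _≡_ _+_ _*_ -_ 0# 1#
    0≢1     : 0# ≢ 1#
    inverse : ∀ x → x ≢ 0# → ∃ λ y → x * y ≡ 1#
    _≟_     : DecidableEquality Carrier
    elems   : List Carrier
    elems-unique   : Unique elems
    elems-complete : ∀ x → x ∈ elems

  _-_ : Op₂ Carrier
  x - y = x + (- y)

  order : ℕ
  order = length elems

  pow : Carrier → ℕ → Carrier
  pow ω zero    = 1#
  pow ω (suc j) = ω * pow ω j

  IsPrimitive : Carrier → Set
  IsPrimitive ω = ∀ x → x ≢ 0# → ∃ λ j → pow ω j ≡ x

module GroupRing (F : FiniteField) where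
  open FiniteField F

  GR : Set
  GR = Carrier → ℤ

  Σ[F] : (Carrier → ℤ) → ℤ
  Σ[F] f = foldr (λ x s → f x ℤ.+ s) (+ 0) elems

  countF : (Carrier → Bool) → ℕ
  countF P = length (filterᵇ P elems)

  ⟦_⟧ : (Carrier → Bool) → GR
  ⟦ S ⟧ x = if S x then + 1 else + 0

  𝔽 : GR
  𝔽 _ = + 1

  _·_ : GR → GR → GR
  (X · Y) g = Σ[F] (λ h → X h ℤ.* Y (g - h))

  _⊕_ : GR → GR → GR
  (X ⊕ Y) g = X g ℤ.+ Y g

  _⊝_ : GR → GR → GR
  (X ⊝ Y) g = X g ℤ.- Y g

  _⊙_ : ℤ → GR → GR
  (c ⊙ X) g = c ℤ.* X g

  _⁽⁻¹⁾ : GR → GR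
  (X ⁽⁻¹⁾) g = X (- g)

  infixl 7 _·_ _⊙_
  infixl 6 _⊕_ _⊝_

-- Cyclotomic classes C_i^{(N,q²)} = ω^i ⟨ω^N⟩ (indices mod N), for N ∣ q²-1.
-- x ∈ C_i^{(N)} iff x = ω^j for some 0 ≤ j < q²-1 with j ≡ i (mod N).

module Cyclotomy (F : FiniteField) (ω : FiniteField.Carrier F) where
  open FiniteField F

  Cyc : (N : ℕ) → .{{NonZero N}} → ℕ → Carrier → Bool
  Cyc N i x = any (λ j → does (pow ω j ≟ x) ∧ ((j % N) ≡ᵇ (i % N)))
                  (upTo (ℕ.pred order))

  CycUnion : (N : ℕ) → .{{NonZero N}} → List ℕ → Carrier → Bool
  CycUnion N is x = any (λ i → Cyc N i x) is

-- The unique element of a 3-element list whose parity differs from that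
-- of the other two (for other lists the value is irrelevant).

parityOutlier : List ℕ → ℕ
parityOutlier (x ∷ y ∷ z ∷ []) =
  if (x % 2) ≡ᵇ (y % 2) then z else (if (x % 2) ≡ᵇ (z % 2) then y else x)
parityOutlier _ = 0

-- Difference families in ℤ₂ × (F,+); ℤ₂ is modelled by Bool with xor as
-- addition (= subtraction), 0 = false.

module DiffFam (F : FiniteField) where
  open FiniteField F

  G : Set
  G = Bool × Carrier

  elemsG : List G
  elemsG = concatMap (λ b → map (λ x → (b , x)) elems) (false ∷ true ∷ [])

  _-G_ : G → G → G
  (b , x) -G (c , y) = (b xor c , x - y)

  _≟G_ : G → G → Bool
  (b , x) ≟G (c , y) = does (Data.Bool._≟_ b c) ∧ does (x ≟ y)

  0G : G
  0G = (false , 0#)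

  size : (G → Bool) → ℕ
  size B = length (filterᵇ B elemsG)

  diffCount : (G → Bool) → G → ℕ
  diffCount B g = length (filterᵇ (λ xy → B (Data.Product.proj₁ xy) ∧ B (Data.Product.proj₂ xy)
                                          ∧ ((Data.Product.proj₁ xy -G Data.Product.proj₂ xy) ≟G g))
                          (Data.List.cartesianProduct elemsG elemsG))

  -- {B_1,…,B_ℓ} is a difference family with parameters (|G|; k_1,…,k_ℓ; λ):
  -- |B_i| = k_i and every nonzero g occurs exactly λ times as a difference
  -- x - y (x,y ∈ B_i, x ≠ y; automatic as g ≠ 0) summed over i.
  IsDifferenceFamily : List (G → Bool) → List ℕ → ℕ → Set
  IsDifferenceFamily Bs ks λ′ =
    (map size Bs ≡ ks) ×
    (∀ g → (g ≟G 0G) ≡ false →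
       foldr (λ B s → diffCount B g ℕ.+ s) 0 Bs ≡ λ′)

module Submission where

-- Let K be the subfield of order q and call the sets ω^j K* lines, N = ω^(q+1) being a generator of K*.
-- A function f is even or odd if f (N x) = f x or f (N x) = − f x. The sum of an odd f over the coset x + K
-- is κ x * e f, where κ x is the quadratic character of the K-component δ x of x along ω; so a correlation
-- Corr f g of odd functions, averaged over K, is e f * e g up to its value at 0. The sum of an even f over
-- x + K takes one value on K and one value off K, which evaluates correlations of even functions.
--
-- For the signed octic classes η_i = C_i − C_{i+4} the Frobenius map leaves two integers e η_1 = v and
-- e η_2 = u, with q = u² + 2 v²: they replace the Jacobi sums, a + b √-2 being −(u − v √-2)².
-- The hypothesis on C_1 + 1 and C_2 says a + 4 b = 4 v² + 8 u v − q, so that in case (a) (u − v)² = 4 and in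
-- case (b) (u + v)² = 4.
--
-- Write E_i = (P_i + H_i) / 2 with P_i = E_i + E_i^(−1) even and H_i = E_i − E_i^(−1) odd. The P_i contribute
-- (q − 1)² to every coefficient of the identity, and the H_i contribute (u ∓ v)² (D_0 − D_2) / 2.
-- The difference family has the slices (E_0, complement of E_1), (E_2, complement of E_3),
-- (complement of D_0, D_0) and (D_2, D_2).

open import Defs
open import Algebra.Bundles using (CommutativeRing)
open import Data.Bool using (Bool; true; false; _∧_; _∨_; _xor_; not; if_then_else_; T)
open import Data.Bool.ListAction using (any)
open import Data.Bool.Properties using (∨-zeroʳ)
open import Data.Empty using (⊥; ⊥-elim)
open import Data.Fin as Fin using (Fin; toℕ; fromℕ)
import Data.Fin.Properties as FinP
open import Data.Integer as ℤ using (ℤ; +_) renaming (_+_ to _+ℤ_; _*_ to _*ℤ_; _-_ to _-ℤ_; -_ to -ℤ_)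
import Data.Integer.Properties as ℤP
import Data.Integer.Divisibility as ℤD using (_∣_)
open import Data.Integer.Tactic.RingSolver using (solve-∀)
open import Data.List using (List; []; _∷_; _++_; length; map; foldr; lookup; upTo; applyUpTo; filterᵇ; cartesianProduct)
open import Data.List.Membership.Propositional using (_∈_)
open import Data.List.Membership.Propositional.Properties using (∈-map⁺; ∈-map⁻; ∈-lookup; ∈-upTo⁺; ∈-upTo⁻)
open import Data.List.Membership.Propositional.Properties.WithK using (unique∧set⇒bag)
open import Data.List.Properties using (length-map; length-upTo; map-∘; map-upTo)
open import Data.List.Relation.Binary.BagAndSetEquality using (∼bag⇒↭)
open import Data.List.Relation.Binary.Permutation.Propositional as ↭ using (_↭_; ↭⇒↭ₛ)
import Data.List.Relation.Binary.Permutation.Setoid.Properties as PermS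
open import Data.List.Relation.Unary.All as All using (All; []; _∷_)
import Data.List.Relation.Unary.All.Properties as AllP
open import Data.List.Relation.Unary.AllPairs using ([]; _∷_)
open import Data.List.Relation.Unary.Any as Any using (here; there)
open import Data.List.Relation.Unary.Any.Properties using (lookup-index)
open import Data.List.Relation.Unary.Unique.Propositional using (Unique)
import Data.List.Relation.Unary.Unique.Propositional.Properties as UP
open import Data.Nat as ℕ using (ℕ; zero; suc; NonZero; _≥_; _%_; _/_; _≡ᵇ_; _!; z≤n; s≤s)
open import Data.Nat.Combinatorics using (_C_; nCn≡1; k![n∸k]!∣n!)
open import Data.Nat.Combinatorics.Specification using (nCk≡n!/k![n-k]!)
open import Data.Nat.Divisibility using (_∣_; divides; ∣1⇒≡1; ∣⇒≤; m∣m*n; m%n≡0⇒n∣m; *-cancelˡ-∣)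
open import Data.Nat.DivMod using (m%n<n; m≡m%n+[m/n]*n; [m+kn]%n≡m%n; m<n⇒m%n≡m; m/n*n≡m; m∣n⇒o%n%m≡o%m; m%n%n≡m%n; %-distribˡ-+; /-monoˡ-≤)
open import Data.Nat.Primality using (Prime; prime?; euclidsLemma; prime⇒nonTrivial; prime⇒irreducible)
import Data.Nat.Properties as ℕP
import Data.Nat.Tactic.RingSolver as ℕR
open import Data.Product using (_×_; _,_; proj₁; proj₂; ∃)
open import Data.Sum using (_⊎_; inj₁; inj₂)
open import Function using (_∘_; mk⇔)
open import Level using (0ℓ)
open import Relation.Binary.Definitions using (DecidableEquality)
open import Relation.Binary.PropositionalEquality
open import Relation.Nullary using (¬_; Dec; yes; no; does)
open import Relation.Nullary.Decidable using (dec-true; dec-false; from-yes)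

-- Characters of order 8 are present, yet all values stay in the integers. Since q ≡ 3 modulo 8,
-- both N and -1 have discrete logarithm 4 modulo 8, so twice an octic class is a quartic class
-- (even, a union of lines) plus a signed octic class (odd), and the only character needed is a
-- sign. The Frobenius map triples logarithms modulo 8 and negates the coordinate along ω, which
-- kills e η_0 and identifies e η_3 with e η_1 up to sign. The P_i behave like constants because the
-- octic part of E_i and its negative miss exactly one quartic class, which receives m of its 2 m +
-- 1 lines. Away from 0, P_i - 1 is therefore supported on that class with values 1 and -1, and
-- neither its square nor its product with P_j - 1 for another missing class depends on the choice
-- of lines. The count gives only the combination a + 4 b in terms of u and v. Case (a) speaks of
-- the same combination. Case (b) speaks of a - 4 b, so the quadratic equation q² = a² + 2 b² has to
-- be used, and its second solution must be excluded arithmetically.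

private variable
  𝔸 𝔹 : Set

-- Tables modulo 8 with closed entries are compared by evaluation, so this single term closes every
-- such comparison.
all≡ : ∀ {A : Set} {x₀ x₁ x₂ x₃ x₄ x₅ x₆ x₇ : A} →
       x₀ ≡ x₀ × x₁ ≡ x₁ × x₂ ≡ x₂ × x₃ ≡ x₃ × x₄ ≡ x₄ × x₅ ≡ x₅ × x₆ ≡ x₆ × x₇ ≡ x₇
all≡ = refl , refl , refl , refl , refl , refl , refl , refl

below8 : ∀ {ℓ} (P : ℕ → Set ℓ) → P 0 × P 1 × P 2 × P 3 × P 4 × P 5 × P 6 × P 7 → ∀ i → i ℕ.< 8 → P i
below8 P (p₀ , p₁ , p₂ , p₃ , p₄ , p₅ , p₆ , p₇) = go
  where
  go : ∀ i → i ℕ.< 8 → P i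
  go 0 _ = p₀
  go 1 _ = p₁
  go 2 _ = p₂
  go 3 _ = p₃
  go 4 _ = p₄
  go 5 _ = p₅
  go 6 _ = p₆
  go 7 _ = p₇
  go (suc (suc (suc (suc (suc (suc (suc (suc _)))))))) (s≤s (s≤s (s≤s (s≤s (s≤s (s≤s (s≤s (s≤s ()))))))))

i≡[j+i]-j : ∀ j i → i ≡ (j +ℤ i) -ℤ j
i≡[j+i]-j = solve-∀

i*jk≡j*ik : ∀ i j k → i *ℤ (j *ℤ k) ≡ j *ℤ (i *ℤ k)
i*jk≡j*ik = solve-∀

-i*-j≡i*j : ∀ i j → -ℤ i *ℤ -ℤ j ≡ i *ℤ j
-i*-j≡i*j = solve-∀

-- Integer sums over lists and initial segments

∑ : List 𝔸 → (𝔸 → ℤ) → ℤ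
∑ []       f = + 0
∑ (x ∷ xs) f = f x +ℤ ∑ xs f

∑-foldr : ∀ (xs : List 𝔸) (f : 𝔸 → ℤ) → foldr (λ x s → f x +ℤ s) (+ 0) xs ≡ ∑ xs f
∑-foldr []       f = refl
∑-foldr (x ∷ xs) f = cong (_+ℤ_ (f x)) (∑-foldr xs f)

∑-cong : ∀ (xs : List 𝔸) {f g : 𝔸 → ℤ} → (∀ x → f x ≡ g x) → ∑ xs f ≡ ∑ xs g
∑-cong []       e = refl
∑-cong (x ∷ xs) e = cong₂ _+ℤ_ (e x) (∑-cong xs e)

∑-+ : ∀ (xs : List 𝔸) (f g : 𝔸 → ℤ) → ∑ xs (λ x → f x +ℤ g x) ≡ ∑ xs f +ℤ ∑ xs g
∑-+ []       f g = refl
∑-+ (x ∷ xs) f g = trans (cong (_+ℤ_ (f x +ℤ g x)) (∑-+ xs f g)) (shuffle (f x) (g x) _ _)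
  where
  shuffle : ∀ a b c d → (a +ℤ b) +ℤ (c +ℤ d) ≡ (a +ℤ c) +ℤ (b +ℤ d)
  shuffle = solve-∀

∑-*ˡ : ∀ (xs : List 𝔸) (c : ℤ) (f : 𝔸 → ℤ) → ∑ xs (λ x → c *ℤ f x) ≡ c *ℤ ∑ xs f
∑-*ˡ []       c f = sym (ℤP.*-zeroʳ c)
∑-*ˡ (x ∷ xs) c f rewrite ∑-*ˡ xs c f = sym (ℤP.*-distribˡ-+ c (f x) (∑ xs f))

∑-neg : ∀ (xs : List 𝔸) (f : 𝔸 → ℤ) → ∑ xs (λ x → -ℤ f x) ≡ -ℤ ∑ xs f
∑-neg []       f = refl
∑-neg (x ∷ xs) f = trans (cong (_+ℤ_ (-ℤ f x)) (∑-neg xs f)) (sym (ℤP.neg-distrib-+ (f x) (∑ xs f)))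

∑-zero : ∀ (xs : List 𝔸) → ∑ xs (λ _ → + 0) ≡ + 0
∑-zero []       = refl
∑-zero (x ∷ xs) = cong (_+ℤ_ (+ 0)) (∑-zero xs)

∑-swap : ∀ (xs : List 𝔸) (ys : List 𝔹) (f : 𝔸 → 𝔹 → ℤ) →
         ∑ xs (λ x → ∑ ys (f x)) ≡ ∑ ys (λ y → ∑ xs (λ x → f x y))
∑-swap []       ys f = sym (∑-zero ys)
∑-swap (x ∷ xs) ys f rewrite ∑-swap xs ys f = sym (∑-+ ys (f x) (λ y → ∑ xs (λ z → f z y)))

∑-↭ : ∀ {xs ys : List 𝔸} (f : 𝔸 → ℤ) → xs ↭ ys → ∑ xs f ≡ ∑ ys f
∑-↭ f ↭.refl        = refl
∑-↭ f (↭.prep x p)  = cong (_+ℤ_ (f x)) (∑-↭ f p)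
∑-↭ f (↭.swap x y p) = trans (exch (f x) (f y) _) (cong (λ s → f y +ℤ (f x +ℤ s)) (∑-↭ f p))
  where
  exch : ∀ a b c → a +ℤ (b +ℤ c) ≡ b +ℤ (a +ℤ c)
  exch = solve-∀
∑-↭ f (↭.trans p r) = trans (∑-↭ f p) (∑-↭ f r)

∑-map : ∀ (xs : List 𝔸) (φ : 𝔸 → 𝔹) (f : 𝔹 → ℤ) → ∑ (map φ xs) f ≡ ∑ xs (f ∘ φ)
∑-map []       φ f = refl
∑-map (x ∷ xs) φ f = cong (_+ℤ_ (f (φ x))) (∑-map xs φ f)

∑-++ : ∀ (xs ys : List 𝔸) (f : 𝔸 → ℤ) → ∑ (xs ++ ys) f ≡ ∑ xs f +ℤ ∑ ys f
∑-++ []       ys f = sym (ℤP.+-identityˡ _)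
∑-++ (x ∷ xs) ys f rewrite ∑-++ xs ys f = sym (ℤP.+-assoc (f x) (∑ xs f) (∑ ys f))

∑-× : ∀ (xs : List 𝔸) (ys : List 𝔹) (f : 𝔸 × 𝔹 → ℤ) →
      ∑ (cartesianProduct xs ys) f ≡ ∑ xs (λ x → ∑ ys (λ y → f (x , y)))
∑-× []       ys f = refl
∑-× (x ∷ xs) ys f = trans (∑-++ (map (x ,_) ys) (cartesianProduct xs ys) f)
                          (cong₂ _+ℤ_ (∑-map ys (x ,_) f) (∑-× xs ys f))

unique-↭ : ∀ {xs ys : List 𝔸} → Unique xs → Unique ys →
           (∀ {x} → x ∈ xs → x ∈ ys) → (∀ {x} → x ∈ ys → x ∈ xs) → xs ↭ ys
unique-↭ ux uy f g = ∼bag⇒↭ (unique∧set⇒bag ux uy (mk⇔ f g))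

𝟙 : Bool → ℤ
𝟙 b = if b then + 1 else + 0

𝟙-∧ : ∀ a b → 𝟙 (a ∧ b) ≡ 𝟙 a *ℤ 𝟙 b
𝟙-∧ true  b = sym (ℤP.*-identityˡ (𝟙 b))
𝟙-∧ false b = refl

𝟙-not : ∀ a → 𝟙 (not a) ≡ + 1 -ℤ 𝟙 a
𝟙-not true  = refl
𝟙-not false = refl

length-filterᵇ : ∀ (P : 𝔸 → Bool) (xs : List 𝔸) → + length (filterᵇ P xs) ≡ ∑ xs (𝟙 ∘ P)
length-filterᵇ P []       = refl
length-filterᵇ P (x ∷ xs) with P x
... | true  = cong (_+ℤ_ (+ 1)) (length-filterᵇ P xs)
... | false = trans (length-filterᵇ P xs) (sym (ℤP.+-identityˡ _))

∑-const : ∀ (xs : List 𝔸) c → ∑ xs (λ _ → c) ≡ + length xs *ℤ c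
∑-const []       c = refl
∑-const (x ∷ xs) c rewrite ∑-const xs c = go (+ length xs) c
  where
  go : ∀ l c → c +ℤ l *ℤ c ≡ (+ 1 +ℤ l) *ℤ c
  go = solve-∀

∑< : ℕ → (ℕ → ℤ) → ℤ
∑< zero    f = + 0
∑< (suc n) f = ∑< n f +ℤ f n

∑<-cong : ∀ n {f g : ℕ → ℤ} → (∀ i → f i ≡ g i) → ∑< n f ≡ ∑< n g
∑<-cong zero    e = refl
∑<-cong (suc n) e = cong₂ _+ℤ_ (∑<-cong n e) (e n)

∑<-suc : ∀ n (f : ℕ → ℤ) → ∑< (suc n) f ≡ f 0 +ℤ ∑< n (f ∘ suc)
∑<-suc zero    f = ℤP.+-comm (+ 0) (f 0)
∑<-suc (suc n) f rewrite ∑<-suc n f = ℤP.+-assoc (f 0) _ _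

∑-applyUpTo : ∀ (g : ℕ → 𝔸) n (f : 𝔸 → ℤ) → ∑ (applyUpTo g n) f ≡ ∑< n (f ∘ g)
∑-applyUpTo g zero    f = refl
∑-applyUpTo g (suc n) f rewrite ∑<-suc n (f ∘ g) = cong (_+ℤ_ (f (g 0))) (∑-applyUpTo (g ∘ suc) n f)

∑-upTo : ∀ n (f : ℕ → ℤ) → ∑ (upTo n) f ≡ ∑< n f
∑-upTo n f = ∑-applyUpTo (λ i → i) n f

∑<-+ : ∀ a b (f : ℕ → ℤ) → ∑< (b ℕ.+ a) f ≡ ∑< a f +ℤ ∑< b (λ i → f (i ℕ.+ a))
∑<-+ a zero    f = sym (ℤP.+-identityʳ _)
∑<-+ a (suc b) f rewrite ∑<-+ a b f = ℤP.+-assoc (∑< a f) _ _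

∑<-periodic : ∀ N k (f : ℕ → ℤ) → (∀ i t → f (i ℕ.+ t ℕ.* N) ≡ f i) → ∑< (k ℕ.* N) f ≡ + k *ℤ ∑< N f
∑<-periodic N zero    f per = refl
∑<-periodic N (suc k) f per
  rewrite ∑<-+ (k ℕ.* N) N f | ∑<-periodic N k f per | ∑<-cong N (λ i → per i k) = go (+ k) (∑< N f)
  where
  go : ∀ k s → k *ℤ s +ℤ s ≡ (+ 1 +ℤ k) *ℤ s
  go = solve-∀

∑<-cong-< : ∀ n {f g : ℕ → ℤ} → (∀ i → i ℕ.< n → f i ≡ g i) → ∑< n f ≡ ∑< n g
∑<-cong-< zero    e = refl
∑<-cong-< (suc n) e = cong₂ _+ℤ_ (∑<-cong-< n (λ i i<n → e i (ℕP.m<n⇒m<1+n i<n))) (e n (ℕP.n<1+n n))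

∑<-zero : ∀ n → ∑< n (λ _ → + 0) ≡ + 0
∑<-zero zero    = refl
∑<-zero (suc n) = cong (_+ℤ + 0) (∑<-zero n)

-- Duplicate-free lists, and binomial coefficients modulo a prime

lookup-injective : ∀ {A : Set} {xs : List A} → Unique xs → ∀ i j → lookup xs i ≡ lookup xs j → i ≡ j
lookup-injective (px ∷ u) Fin.zero    Fin.zero    e = refl
lookup-injective (px ∷ u) Fin.zero    (Fin.suc j) e = ⊥-elim (All.lookup px (∈-lookup j) e)
lookup-injective (px ∷ u) (Fin.suc i) Fin.zero    e = ⊥-elim (All.lookup px (∈-lookup i) (sym e))
lookup-injective (px ∷ u) (Fin.suc i) (Fin.suc j) e = cong Fin.suc (lookup-injective u i j e)

length-⊆ : ∀ {A : Set} {xs ys : List A} → Unique xs → (∀ {x} → x ∈ xs → x ∈ ys) → length xs ℕ.≤ length ys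
length-⊆ {xs = xs} {ys} u sub = FinP.injective⇒≤ {f = λ i → Any.index (sub (∈-lookup i))} inj
  where
  inj : ∀ {i j} → Any.index (sub (∈-lookup {xs = xs} i)) ≡ Any.index (sub (∈-lookup j)) → i ≡ j
  inj {i} {j} e = lookup-injective u i j
    (trans (lookup-index (sub (∈-lookup i)))
      (trans (cong (lookup ys) e) (sym (lookup-index (sub (∈-lookup j))))))

prime∤! : ∀ {p} → Prime p → ∀ k → k ℕ.< p → ¬ (p ∣ k !)
prime∤! pp zero    k<p d = ℕP.<⇒≱ (ℕ.nonTrivial⇒n>1 _ {{prime⇒nonTrivial pp}}) (∣⇒≤ d)
prime∤! pp (suc k) k<p d with euclidsLemma (suc k) (k !) pp d
... | inj₁ e = ℕP.<⇒≱ k<p (∣⇒≤ e)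
... | inj₂ e = prime∤! pp k (ℕP.<-trans (ℕP.n<1+n k) k<p) e

-- In (p C k) k! (p - k)! = p! the prime divides the right side but neither factorial on the left.
prime∣C : ∀ {p} → Prime p → ∀ k → 0 ℕ.< k → k ℕ.< p → p ∣ (p C k)
prime∣C {p@(suc p-1)} pp k 0<k k<p = go (euclidsLemma (p C k) (k ! ℕ.* (p ℕ.∸ k) !) pp
      (subst (p ∣_) (sym split) (m∣m*n (p-1 !))))
  where
  instance _ = ℕP._!*_!≢0 k (p ℕ.∸ k)
  split : (p C k) ℕ.* (k ! ℕ.* (p ℕ.∸ k) !) ≡ p !
  split = trans (cong (ℕ._* (k ! ℕ.* (p ℕ.∸ k) !)) (nCk≡n!/k![n-k]! (ℕP.<⇒≤ k<p)))
                (m/n*n≡m (k![n∸k]!∣n! (ℕP.<⇒≤ k<p)))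
  go : (p ∣ (p C k)) ⊎ (p ∣ k ! ℕ.* (p ℕ.∸ k) !) → p ∣ (p C k)
  go (inj₁ d) = d
  go (inj₂ d) with euclidsLemma (k !) ((p ℕ.∸ k) !) pp d
  ... | inj₁ e = ⊥-elim (prime∤! pp k k<p e)
  ... | inj₂ e = ⊥-elim (prime∤! pp (p ℕ.∸ k) (ℕP.∸-monoʳ-< 0<k (ℕP.<⇒≤ k<p)) e)

-- Finite fields: substitution in sums, characteristic, Frobenius map

module FieldTheory (F : FiniteField) where
  open FiniteField F

  ΣF : (Carrier → ℤ) → ℤ
  ΣF f = ∑ elems f

  ring : CommutativeRing 0ℓ 0ℓ
  ring = record { isCommutativeRing = isCommutativeRing }
  open CommutativeRing ring public using
    ( +-assoc; +-comm; *-assoc; *-comm; +-identityˡ; +-identityʳ; *-identityˡ; *-identityʳ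
    ; -‿inverseˡ; -‿inverseʳ; zeroˡ; zeroʳ; distribˡ; distribʳ )
  open CommutativeRing ring using (semiring; commutativeSemiring; +-isCommutativeMonoid; +-abelianGroup; +-group; +-monoid)
    renaming (ring to ring′)
  open import Algebra.Properties.Ring ring′ public using (-‿distribˡ-*; -‿distribʳ-*; -0#≈0#; x[y-z]≈xy-xz)
  open import Algebra.Properties.AbelianGroup +-abelianGroup public using ()
    renaming (⁻¹-anti-homo‿- to neg-sub; ⁻¹-∙-comm to neg-+; ⁻¹-involutive to neg-neg; x∙y⁻¹≈ε⇒x≈y to sub≡0⇒≡;
              inverseʳ-unique to neg-unique)
  import Algebra.Properties.Semiring.Mult semiring as M
  import Algebra.Properties.CommutativeSemiring.Binomial commutativeSemiring as Bin
  import Algebra.Properties.Semiring.Sum semiring as S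
  import Algebra.Properties.Semiring.Exp semiring as E

  +-cancelʳ-inv : ∀ x y → (x + y) - y ≡ x
  +-cancelʳ-inv x y = trans (+-assoc x y (- y)) (trans (cong (_+_ x) (-‿inverseʳ y)) (+-identityʳ x))

  sub-add : ∀ x y → (x - y) + y ≡ x
  sub-add x y = trans (+-assoc x (- y) y) (trans (cong (_+_ x) (-‿inverseˡ y)) (+-identityʳ x))

  *-cancelˡ : ∀ x {y z} → x ≢ 0# → x * y ≡ x * z → y ≡ z
  *-cancelˡ x {y} {z} x≢0 e with inverse x x≢0
  ... | x⁻¹ , xx⁻¹ = trans (sym (un y)) (trans (cong (x⁻¹ *_) e) (un z))
    where
    un : ∀ w → x⁻¹ * (x * w) ≡ w
    un w = trans (sym (*-assoc x⁻¹ x w)) (trans (cong (_* w) (trans (*-comm x⁻¹ x) xx⁻¹)) (*-identityˡ w))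

  *-nonzero : ∀ {x y} → x ≢ 0# → y ≢ 0# → x * y ≢ 0#
  *-nonzero {x} x≢0 y≢0 e = y≢0 (*-cancelˡ x x≢0 (trans e (sym (zeroʳ x))))

  pow-+ : ∀ x i j → pow x (i ℕ.+ j) ≡ pow x i * pow x j
  pow-+ x zero    j = sym (*-identityˡ _)
  pow-+ x (suc i) j = trans (cong (x *_) (pow-+ x i j)) (sym (*-assoc x _ _))

  pow-* : ∀ x i j → pow x (i ℕ.* j) ≡ pow (pow x j) i
  pow-* x zero    j = refl
  pow-* x (suc i) j = trans (pow-+ x j (i ℕ.* j)) (cong (pow x j *_) (pow-* x i j))

  pow-1# : ∀ i → pow 1# i ≡ 1#
  pow-1# zero    = refl
  pow-1# (suc i) = trans (*-identityˡ _) (pow-1# i)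

  pow-0# : ∀ i → 0 ℕ.< i → pow 0# i ≡ 0#
  pow-0# (suc i) _ = zeroˡ _

  pow-nonzero : ∀ {x} i → x ≢ 0# → pow x i ≢ 0#
  pow-nonzero zero    x≢0 e = 0≢1 (sym e)
  pow-nonzero (suc i) x≢0   = *-nonzero x≢0 (pow-nonzero i x≢0)

  *-exchange : ∀ a b c d → (a * b) * (c * d) ≡ (a * c) * (b * d)
  *-exchange a b c d = trans (*-assoc a b _) (trans (cong (a *_) (trans (sym (*-assoc b c d))
    (trans (cong (_* d) (*-comm b c)) (*-assoc c b d)))) (sym (*-assoc a c _)))

  pow-distrib : ∀ x y i → pow (x * y) i ≡ pow x i * pow y i
  pow-distrib x y zero    = sym (*-identityˡ 1#)
  pow-distrib x y (suc i) = trans (cong ((x * y) *_) (pow-distrib x y i)) (*-exchange x y _ _)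

  elems-↭ : ∀ (φ ψ : Carrier → Carrier) → (∀ x → ψ (φ x) ≡ x) → (∀ x → φ (ψ x) ≡ x) → map φ elems ↭ elems
  elems-↭ φ ψ ψφ φψ = unique-↭
    (UP.map⁺ (λ {x} {y} e → trans (sym (ψφ x)) (trans (cong ψ e) (ψφ y))) elems-unique) elems-unique
    (λ {x} _ → elems-complete x)
    (λ {x} _ → subst (_∈ map φ elems) (φψ x) (∈-map⁺ φ (elems-complete (ψ x))))

  Σ-bij : ∀ (φ ψ : Carrier → Carrier) → (∀ x → ψ (φ x) ≡ x) → (∀ x → φ (ψ x) ≡ x) →
          ∀ f → ΣF (f ∘ φ) ≡ ΣF f
  Σ-bij φ ψ ψφ φψ f = trans (sym (∑-map elems φ f)) (∑-↭ f (elems-↭ φ ψ ψφ φψ))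

  Σ-translate : ∀ c f → ΣF (λ x → f (x + c)) ≡ ΣF f
  Σ-translate c = Σ-bij (_+ c) (_- c) (λ x → +-cancelʳ-inv x c) (λ x → sub-add x c)

  Σ-negate : ∀ f → ΣF (λ x → f (- x)) ≡ ΣF f
  Σ-negate = Σ-bij -_ -_ neg-neg neg-neg

  Σ-scale : ∀ {u} → u ≢ 0# → ∀ f → ΣF (λ x → f (u * x)) ≡ ΣF f
  Σ-scale {u} u≢0 with inverse u u≢0
  ... | v , uv = Σ-bij (u *_) (v *_) (un v u (trans (*-comm v u) uv)) (un u v uv)
    where
    un : ∀ a b → a * b ≡ 1# → ∀ x → a * (b * x) ≡ x
    un a b ab x = trans (sym (*-assoc a b x)) (trans (cong (_* x) ab) (*-identityˡ x))

  -- Translation by 1 permutes the field, so adding 1 to each element leaves the sum of all elements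
  -- unchanged.
  order×1 : order M.× 1# ≡ 0#
  order×1 = trans (sym (+-cancelʳ-inv (order M.× 1#) total))
                  (trans (cong (_- total) (trans (sym (shifted elems)) invariant)) (-‿inverseʳ total))
    where
    total = foldr _+_ 0# elems
    shifted : ∀ xs → foldr _+_ 0# (map (_+ 1#) xs) ≡ length xs M.× 1# + foldr _+_ 0# xs
    shifted []       = sym (+-identityˡ 0#)
    shifted (x ∷ xs) = trans (cong (_+_ (x + 1#)) (shifted xs)) (trans (cong (_+ (length xs M.× 1# + foldr _+_ 0# xs)) (+-comm x 1#)) (exch 1# x _ _))
      where
      exch : ∀ a b c d → (a + b) + (c + d) ≡ (a + c) + (b + d)
      exch a b c d = trans (+-assoc a b _) (trans (cong (_+_ a) (trans (sym (+-assoc b c d))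
        (trans (cong (_+ d) (+-comm b c)) (+-assoc c b d)))) (sym (+-assoc a c _)))
    invariant : foldr _+_ 0# (map (_+ 1#) elems) ≡ total
    invariant = PermS.foldr-commMonoid (setoid Carrier) +-isCommutativeMonoid
      (↭⇒↭ₛ (elems-↭ (_+ 1#) (_- 1#) (λ x → +-cancelʳ-inv x 1#) (λ x → sub-add x 1#)))

  -- The multiple p^k of 1 is the k-th power of the multiple p of 1, and there are no zero divisors.
  characteristic : ∀ p k → order ≡ p ℕ.^ k → p M.× 1# ≡ 0#
  characteristic p k e = go k (trans (cong (M._× 1#) (sym e)) order×1)
    where
    go : ∀ k → (p ℕ.^ k) M.× 1# ≡ 0# → p M.× 1# ≡ 0#
    go zero    e = ⊥-elim (0≢1 (sym (trans (sym (+-identityʳ 1#)) e)))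
    go (suc k) e with (p M.× 1#) ≟ 0#
    ... | yes z = z
    ... | no nz = go k (*-cancelˡ _ nz (trans (sym (M.×1-homo-* p (p ℕ.^ k))) (trans e (sym (zeroʳ _)))))

  multiple×≡0 : ∀ p → p M.× 1# ≡ 0# → ∀ {n} → p ∣ n → ∀ x → n M.× x ≡ 0#
  multiple×≡0 p e {n} (divides t refl) x = trans (sym (cong (n M.×_) (*-identityˡ x)))
    (trans (sym (M.×-assoc-* n 1# x)) (trans (cong (_* x) (trans (M.×1-homo-* t p)
      (trans (cong (t M.× 1# *_) e) (zeroʳ _)))) (zeroˡ x)))

  pow≡^ : ∀ x n → pow x n ≡ x E.^ n
  pow≡^ x zero    = refl
  pow≡^ x (suc n) = cong (x *_) (pow≡^ x n)

  sum-ends : ∀ n (t : Fin (2 ℕ.+ n) → Carrier) → (∀ (k : Fin n) → t (Fin.suc (Fin.inject₁ k)) ≡ 0#) →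
             S.sum t ≡ t Fin.zero + t (fromℕ (suc n))
  sum-ends n t z = cong (_+_ (t Fin.zero)) (trans (S.sum-init-last (t ∘ Fin.suc))
    (trans (cong (_+ t (fromℕ (suc n))) (trans (S.sum-cong-≗ {n} {y = λ _ → 0#} z) (S.sum-replicate-zero n))) (+-identityˡ _)))

  freshman : ∀ {p} → Prime p → p M.× 1# ≡ 0# → ∀ x y → pow (x + y) p ≡ pow x p + pow y p
  freshman {zero} pp e x y = ⊥-elim (ℕP.<⇒≱ (ℕ.nonTrivial⇒n>1 _ {{prime⇒nonTrivial pp}}) z≤n)
  freshman {p@(suc p-1)} pp e x y = trans (pow≡^ (x + y) p) (trans (Bin.theorem p x y)
    (trans (sum-ends p-1 (Bin.binomialTerm x y p) middle) (trans (cong₂ _+_ first last) (+-comm _ _))))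
    where
    first : Bin.binomialTerm x y p Fin.zero ≡ pow y p
    first = trans (+-identityʳ _) (trans (*-identityˡ _) (sym (pow≡^ y p)))
    last : Bin.binomialTerm x y p (fromℕ p) ≡ pow x p
    last rewrite FinP.toℕ-fromℕ p-1 | nCn≡1 p | ℕP.n∸n≡0 p-1 =
      trans (+-identityʳ _) (trans (*-identityʳ _) (sym (pow≡^ x p)))
    middle : ∀ k → Bin.binomialTerm x y p (Fin.suc (Fin.inject₁ k)) ≡ 0#
    middle k = multiple×≡0 p e (prime∣C pp _ (s≤s z≤n)
      (s≤s (subst (ℕ._< p-1) (sym (FinP.toℕ-inject₁ k)) (FinP.toℕ<n k)))) _

  pow-frobenius-+ : ∀ {p} → Prime p → p M.× 1# ≡ 0# → ∀ k x y →
                    pow (x + y) (p ℕ.^ k) ≡ pow x (p ℕ.^ k) + pow y (p ℕ.^ k)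
  pow-frobenius-+ pp e zero    x y = trans (*-identityʳ _) (cong₂ _+_ (sym (*-identityʳ _)) (sym (*-identityʳ _)))
  pow-frobenius-+ {p} pp e (suc k) x y =
    trans (pow-* (x + y) p (p ℕ.^ k)) (trans (cong (λ z → pow z p) (pow-frobenius-+ pp e k x y))
      (trans (freshman pp e _ _) (cong₂ _+_ (sym (pow-* x p (p ℕ.^ k))) (sym (pow-* y p (p ℕ.^ k))))))

  -- This bounds periods of ω from below: with too short a period some nonzero element would not be
  -- a power of ω.
  order≤cover : ∀ (ω : Carrier) d → (∀ x → x ≢ 0# → ∃ λ i → i ℕ.< d × pow ω i ≡ x) → order ℕ.≤ suc d
  order≤cover ω d cov = subst (order ℕ.≤_) (cong suc (trans (length-map (pow ω) (upTo d)) (length-upTo d)))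
                          (length-⊆ {ys = 0# ∷ map (pow ω) (upTo d)} elems-unique (λ {x} _ → mem x))
    where
    mem : ∀ x → x ∈ (0# ∷ map (pow ω) (upTo d))
    mem x with x ≟ 0#
    ... | yes z = here z
    ... | no nz with cov x nz
    ... | i , i<d , refl = there (∈-map⁺ (pow ω) (∈-upTo⁺ i<d))

  pow-mod : ∀ ω d .{{_ : NonZero d}} → pow ω d ≡ 1# → ∀ j → pow ω j ≡ pow ω (j % d)
  pow-mod ω d e j = trans (cong (pow ω) (m≡m%n+[m/n]*n j d)) (trans (pow-+ ω (j % d) _)
    (trans (cong (pow ω (j % d) *_) (trans (pow-* ω (j / d) d) (trans (cong (λ z → pow z (j / d)) e) (pow-1# (j / d))))) (*-identityʳ _)))

  -- Primitive elements and discrete logarithms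

  module Primitive (ω : Carrier) (prim : IsPrimitive ω) (M : ℕ) .{{_ : NonZero M}} (order≡ : order ≡ suc M) (2≤M : 2 ℕ.≤ M) where

    -- The powers of 0 are only 1 and 0, so a primitive 0 would leave a field of at most two
    -- elements.
    ω≢0 : ω ≢ 0#
    ω≢0 refl = ℕP.<⇒≱ (s≤s 2≤M) (subst (ℕ._≤ 2) order≡ (order≤cover ω 1 cov))
      where
      cov : ∀ x → x ≢ 0# → ∃ λ i → i ℕ.< 1 × pow ω i ≡ x
      cov x nz with prim x nz
      ... | zero  , e = 0 , s≤s z≤n , e
      ... | suc j , e = ⊥-elim (nz (trans (sym e) (zeroˡ _)))

    period≥ : ∀ d → 0 ℕ.< d → pow ω d ≡ 1# → M ℕ.≤ d
    period≥ d@(suc _) _ e = ℕ.s≤s⁻¹ (subst (ℕ._≤ suc d) order≡ (order≤cover ω d cov))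
      where
      cov : ∀ x → x ≢ 0# → ∃ λ i → i ℕ.< d × pow ω i ≡ x
      cov x nz with prim x nz
      ... | j , ej = j % d , m%n<n j d , trans (sym (pow-mod ω d e j)) ej

    difference : ∀ i j → i ℕ.≤ j → pow ω i ≡ pow ω j → pow ω (j ℕ.∸ i) ≡ 1#
    difference i j i≤j e = *-cancelˡ (pow ω i) (pow-nonzero i ω≢0)
      (trans (sym (pow-+ ω i _)) (trans (cong (pow ω) (ℕP.m+[n∸m]≡n i≤j)) (trans (sym e) (sym (*-identityʳ _)))))

    -- The element 0 and the powers ω^0, ..., ω^M are `order` + 1 values, so two of them coincide.
    -- Neither is 0, hence the difference of two exponents is a period at most M, and `period≥`
    -- makes it M.
    pow-M : pow ω M ≡ 1#
    pow-M = collision (FinP.pigeonhole (ℕP.n<1+n order) idx)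
      where
      val : Fin (suc order) → Carrier
      val Fin.zero    = 0#
      val (Fin.suc i) = pow ω (toℕ i)
      idx : Fin (suc order) → Fin order
      idx i = Any.index (elems-complete (val i))
      val≡ : ∀ i j → idx i ≡ idx j → val i ≡ val j
      val≡ i j e = trans (lookup-index (elems-complete (val i)))
        (trans (cong (lookup elems) e) (sym (lookup-index (elems-complete (val j)))))
      collision : (∃ λ i → ∃ λ j → (i Fin.< j) × (idx i ≡ idx j)) → pow ω M ≡ 1#
      collision (Fin.zero , Fin.suc j , _ , e) = ⊥-elim (pow-nonzero (toℕ j) ω≢0 (sym (val≡ Fin.zero (Fin.suc j) e)))
      collision (Fin.suc i , Fin.suc j , s≤s i<j , e) = subst (λ d → pow ω d ≡ 1#) d≡M pd
        where
        d = toℕ j ℕ.∸ toℕ i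
        pd = difference (toℕ i) (toℕ j) (ℕP.<⇒≤ i<j) (val≡ (Fin.suc i) (Fin.suc j) e)
        d≤M : d ℕ.≤ M
        d≤M = ℕP.≤-trans (ℕP.m∸n≤m (toℕ j) (toℕ i)) (ℕ.s≤s⁻¹ (subst (toℕ j ℕ.<_) order≡ (FinP.toℕ<n j)))
        d≡M : d ≡ M
        d≡M = ℕP.≤-antisym d≤M (period≥ d (ℕP.m<n⇒0<n∸m i<j) pd)

    pow-% : ∀ j → pow ω j ≡ pow ω (j % M)
    pow-% = pow-mod ω M pow-M

    log : ∀ x → x ≢ 0# → ∃ λ j → j ℕ.< M × pow ω j ≡ x
    log x nz with prim x nz
    ... | j , e = j % M , m%n<n j M , trans (sym (pow-% j)) e

    pow-M≡1 : ∀ {x} → x ≢ 0# → pow x M ≡ 1#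
    pow-M≡1 nz with log _ nz
    ... | j , _ , refl = trans (sym (pow-* ω M j)) (trans (cong (pow ω) (ℕP.*-comm M j))
                           (trans (pow-* ω j M) (trans (cong (λ z → pow z j) pow-M) (pow-1# j))))

    inj-≤ : ∀ i j → i ℕ.≤ j → j ℕ.< M → pow ω i ≡ pow ω j → i ≡ j
    inj-≤ i j i≤j j<M e with j ℕ.∸ i in eq
    ... | zero  = ℕP.≤-antisym i≤j (ℕP.m∸n≡0⇒m≤n eq)
    ... | suc d = ⊥-elim (ℕP.<⇒≱ j<M (ℕP.≤-trans
                    (subst (M ℕ.≤_) (sym eq) (period≥ (suc d) (s≤s z≤n) (subst (λ z → pow ω z ≡ 1#) eq (difference i j i≤j e))))
                    (ℕP.m∸n≤m j i)))

    pow-inj : ∀ i j → i ℕ.< M → j ℕ.< M → pow ω i ≡ pow ω j → i ≡ j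
    pow-inj i j i<M j<M e with ℕP.≤-total i j
    ... | inj₁ i≤j = inj-≤ i j i≤j j<M e
    ... | inj₂ j≤i = sym (inj-≤ j i j≤i i<M (sym e))

    pow-inj-% : ∀ i j → pow ω i ≡ pow ω j → i % M ≡ j % M
    pow-inj-% i j e = pow-inj _ _ (m%n<n i M) (m%n<n j M) (trans (sym (pow-% i)) (trans e (pow-% j)))

    Σ-pow : ∀ f → ΣF f ≡ f 0# +ℤ ∑< M (f ∘ pow ω)
    Σ-pow f = trans (∑-↭ f (unique-↭ elems-unique u (λ {x} _ → mem x) (λ {x} _ → elems-complete x)))
                (cong (_+ℤ_ (f 0#)) (trans (∑-map (upTo M) (pow ω) f) (∑-upTo M (f ∘ pow ω))))
      where
      u : Unique (0# ∷ map (pow ω) (upTo M))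
      u = AllP.map⁺ (AllP.applyUpTo⁺₂ _ M (λ i e → pow-nonzero i ω≢0 (sym e)))
        ∷ powers-unique
        where
        powers-unique : Unique (map (pow ω) (upTo M))
        powers-unique = subst Unique (sym (map-upTo (pow ω) M)) (UP.applyUpTo⁺₁ (pow ω) M
          (λ {i} {j} i<j j<M e → ℕP.<⇒≢ i<j (pow-inj i j (ℕP.<-trans i<j j<M) j<M e)))
      mem : ∀ x → x ∈ (0# ∷ map (pow ω) (upTo M))
      mem x with x ≟ 0#
      ... | yes z = here z
      ... | no nz with log x nz
      ... | i , i<M , refl = there (∈-map⁺ (pow ω) (∈-upTo⁺ i<M))

does-⇔ : ∀ {A B : Set} (a? : Dec A) (b? : Dec B) → (A → B) → (B → A) → does a? ≡ does b?
does-⇔ (yes a) b? f g = sym (dec-true b? (f a))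
does-⇔ (no ¬a) b? f g = sym (dec-false b? (¬a ∘ g))

i≡-i⇒i≡0 : ∀ (i : ℤ) → i ≡ -ℤ i → i ≡ + 0
i≡-i⇒i≡0 (+ zero)    _ = refl
i≡-i⇒i≡0 (+ suc _)   ()
i≡-i⇒i≡0 (ℤ.-[1+ _ ]) ()

any-true : ∀ {A : Set} (P : A → Bool) {x xs} → x ∈ xs → P x ≡ true → any P xs ≡ true
any-true P {xs = y ∷ ys} (here refl) e = cong (_∨ any P ys) e
any-true P {xs = y ∷ ys} (there x∈) e = trans (cong (P y ∨_) (any-true P x∈ e)) (∨-zeroʳ (P y))

any-false : ∀ {A : Set} (P : A → Bool) xs → (∀ x → x ∈ xs → P x ≡ false) → any P xs ≡ false
any-false P []       e = refl
any-false P (x ∷ xs) e = trans (cong (_∨ any P xs) (e x (here refl))) (any-false P xs (λ y y∈ → e y (there y∈)))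

-- Powers of 3 and squares at distance 8

prime-3 : Prime 3
prime-3 = from-yes (prime? 3)

prime∣^⇒≡ : ∀ {p l} → Prime p → Prime l → ∀ k → l ∣ p ℕ.^ k → l ≡ p
prime∣^⇒≡ pp pl zero d with ∣1⇒≡1 d
... | refl = ⊥-elim (ℕP.<-irrefl refl (ℕ.nonTrivial⇒n>1 1 {{prime⇒nonTrivial pl}}))
prime∣^⇒≡ {p} pp pl (suc k) d with euclidsLemma p (p ℕ.^ k) pl d
... | inj₂ d′ = prime∣^⇒≡ pp pl k d′
... | inj₁ d′ with prime⇒irreducible pp d′
... | inj₂ e = e
... | inj₁ refl = ⊥-elim (ℕP.<-irrefl refl (ℕ.nonTrivial⇒n>1 1 {{prime⇒nonTrivial pl}}))

parity : ∀ k → ∃ λ l → k ≡ l ℕ.+ l ⊎ k ≡ suc (l ℕ.+ l)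
parity zero = 0 , inj₁ refl
parity (suc k) with parity k
... | l , inj₁ refl = l , inj₂ refl
... | l , inj₂ refl = suc l , inj₁ (cong suc (sym (ℕP.+-suc l l)))

9^l≡1[8] : ∀ l → ∃ λ t → 3 ℕ.^ (l ℕ.+ l) ≡ 1 ℕ.+ t ℕ.* 8
9^l≡1[8] zero = 0 , refl
9^l≡1[8] (suc l) with 9^l≡1[8] l
... | t , e = 1 ℕ.+ 9 ℕ.* t , trans (cong (λ z → 3 ℕ.^ suc z) (ℕP.+-suc l l)) (trans (cong (λ z → 3 ℕ.* (3 ℕ.* z)) e) (arith t))
  where
  arith : ∀ t → 3 ℕ.* (3 ℕ.* (1 ℕ.+ t ℕ.* 8)) ≡ 1 ℕ.+ (1 ℕ.+ 9 ℕ.* t) ℕ.* 8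
  arith = ℕR.solve-∀

-- The next square after z² is at distance 2 z + 1, which exceeds 8 once z ≥ 4; for z ≤ 4 the sum z²
-- + 8 stays below 25.
no-squares-at-distance-8 : ∀ X z → z ℕ.* z ℕ.+ 8 ≡ X ℕ.* X → X ℕ.< 5
no-squares-at-distance-8 X z e = ℕP.≰⇒> λ 5≤X → ℕP.<-irrefl e (go 5≤X)
  where
  z<X : z ℕ.< X
  z<X = ℕP.≰⇒> λ X≤z → ℕP.<⇒≱ (ℕP.m<m+n (z ℕ.* z) {8} (s≤s z≤n)) (subst (ℕ._≤ z ℕ.* z) (sym e) (ℕP.*-mono-≤ X≤z X≤z))
  go : 5 ℕ.≤ X → z ℕ.* z ℕ.+ 8 ℕ.< X ℕ.* X
  go 5≤X = small (ℕP.≤-total 4 z)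
    where
    open ℕP.≤-Reasoning
    arith : ∀ z → suc z ℕ.* suc z ≡ z ℕ.* z ℕ.+ suc (z ℕ.+ z)
    arith = ℕR.solve-∀
    small : (4 ℕ.≤ z) ⊎ (z ℕ.≤ 4) → z ℕ.* z ℕ.+ 8 ℕ.< X ℕ.* X
    small (inj₁ 4≤z) = begin-strict
      z ℕ.* z ℕ.+ 8                <⟨ ℕP.+-monoʳ-< (z ℕ.* z) (s≤s (ℕP.+-mono-≤ 4≤z 4≤z)) ⟩
      z ℕ.* z ℕ.+ suc (z ℕ.+ z) ≡⟨ sym (arith z) ⟩
      suc z ℕ.* suc z              ≤⟨ ℕP.*-mono-≤ z<X z<X ⟩
      X ℕ.* X  ∎
    small (inj₂ z≤4) = begin-strict
      z ℕ.* z ℕ.+ 8  ≤⟨ ℕP.+-monoˡ-≤ 8 (ℕP.*-mono-≤ z≤4 z≤4) ⟩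
      24             <⟨ ℕP.n<1+n 24 ⟩
      5 ℕ.* 5        ≤⟨ ℕP.*-mono-≤ 5≤X 5≤X ⟩
      X ℕ.* X  ∎

-- The line and the ellipse in case (b) have a second common point, where 3 q = z² + 8 with q an odd power of 3: two squares at distance 8.
no-spurious-root : ∀ m q p k → 1 ℕ.≤ m → q ≡ 8 ℕ.* m ℕ.+ 3 → Prime p → q ≡ p ℕ.^ k → 3 ∣ q →
                   ∀ z → ¬ (3 ℕ.* q ≡ z ℕ.* z ℕ.+ 8)
no-spurious-root m q p k 1≤m q≡ pp q≡p^k 3∣q z e = go (parity k)
  where
  q≡3^k : q ≡ 3 ℕ.^ k
  q≡3^k = trans q≡p^k (cong (ℕ._^ k) (sym (prime∣^⇒≡ pp prime-3 k (subst (3 ∣_) q≡p^k 3∣q))))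
  q%8 : q % 8 ≡ 3
  q%8 = trans (cong (_% 8) (trans q≡ (arith m))) ([m+kn]%n≡m%n 3 m 8)
    where
    arith : ∀ m → 8 ℕ.* m ℕ.+ 3 ≡ 3 ℕ.+ m ℕ.* 8
    arith = ℕR.solve-∀
  go : (∃ λ l → k ≡ l ℕ.+ l ⊎ k ≡ suc (l ℕ.+ l)) → ⊥
  -- An even exponent would make q a power of 9, hence 1 modulo 8, against q ≡ 3.
  go (l , inj₁ refl) with trans (sym q%8) (trans (cong (_% 8) (trans q≡3^k (proj₂ (9^l≡1[8] l)))) ([m+kn]%n≡m%n 1 (proj₁ (9^l≡1[8] l)) 8))
  ... | ()
  -- For k = 2 l + 1 the number 3 q is the square of X = 3^(l + 1). Then X < 5 bounds 3 q by 16,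
  -- while m ≥ 1 gives q ≥ 11.
  go (l , inj₂ refl) = ℕP.<⇒≱ (no-squares-at-distance-8 X z X²) (ℕP.≮⇒≥ λ X<5 → ℕP.<⇒≱ 24<3q (small X<5))
    where
    X = 3 ℕ.^ suc l
    3q : 3 ℕ.* q ≡ X ℕ.* X
    3q = trans (cong (3 ℕ.*_) q≡3^k) (trans (cong (λ z → 3 ℕ.* (3 ℕ.* z)) (ℕP.^-distribˡ-+-* 3 l l)) (arith (3 ℕ.^ l)))
      where
      arith : ∀ x → 3 ℕ.* (3 ℕ.* (x ℕ.* x)) ≡ (3 ℕ.* x) ℕ.* (3 ℕ.* x)
      arith = ℕR.solve-∀
    X² : z ℕ.* z ℕ.+ 8 ≡ X ℕ.* X
    X² = trans (sym e) 3q
    24<3q : 24 ℕ.< 3 ℕ.* q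
    24<3q = ℕP.≤-trans (ℕP.m≤m+n 25 8) (ℕP.*-monoʳ-≤ 3 (subst (11 ℕ.≤_) (sym q≡) (ℕP.+-monoˡ-≤ 3 (ℕP.*-monoʳ-≤ 8 1≤m))))
    small : X ℕ.< 5 → 3 ℕ.* q ℕ.≤ 24
    small (s≤s X≤4) = ℕP.≤-trans (ℕP.≤-reflexive 3q) (ℕP.≤-trans (ℕP.*-mono-≤ X≤4 X≤4) (ℕP.m≤m+n 16 8))

-- From the equations for a and b to (u ∓ v)² = 4

square≡ : ∀ (x c : ℤ) → x *ℤ x ≡ c *ℤ c → x ≡ c ⊎ x ≡ -ℤ c
square≡ x c e with ℤP.i*j≡0⇒i≡0∨j≡0 (x -ℤ c) {x +ℤ c} (trans (f1 x c) (trans (cong (_-ℤ (c *ℤ c)) e) (ℤP.+-inverseʳ (c *ℤ c))))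
  where
  f1 : ∀ x c → (x -ℤ c) *ℤ (x +ℤ c) ≡ x *ℤ x -ℤ c *ℤ c
  f1 = solve-∀
... | inj₁ z = inj₁ (ℤP.i-j≡0⇒i≡j x c z)
... | inj₂ z = inj₂ (trans (f2 x c) (trans (cong (_-ℤ c) z) (ℤP.+-identityˡ (-ℤ c))))
  where
  f2 : ∀ x c → x ≡ (x +ℤ c) -ℤ c
  f2 = solve-∀

∣i∣² : ∀ i → + (ℤ.∣ i ∣ ℕ.* ℤ.∣ i ∣) ≡ i *ℤ i
∣i∣² (+ n)        = ℤP.pos-* n n
∣i∣² (ℤ.-[1+ n ]) = refl

module Arithmetic (m q p k : ℕ) (1≤m : 1 ℕ.≤ m) (q≡ : q ≡ 8 ℕ.* m ℕ.+ 3) (pp : Prime p) (q≡p^k : q ≡ p ℕ.^ k)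
  (u v a b : ℤ) (norm : + q ≡ u *ℤ u +ℤ + 2 *ℤ (v *ℤ v)) (link : a +ℤ + 4 *ℤ b ≡ + 4 *ℤ (v *ℤ v) +ℤ + 8 *ℤ (u *ℤ v) -ℤ + q) where

  -- The hypothesis and `link` concern the same combination a + 4 b. Eliminating it leaves a
  -- quadratic form in u and v that is a perfect square once q is replaced by its norm form.
  case-a : + (3 ℕ.* q) ≡ a +ℤ + 4 *ℤ b +ℤ + 16 → (u -ℤ v) *ℤ (u -ℤ v) ≡ + 4
  case-a e = ℤP.*-cancelˡ-≡ (+ 4) _ _ (begin
    + 4 *ℤ ((u -ℤ v) *ℤ (u -ℤ v)) ≡⟨ f1 u v ⟩
    + 4 *ℤ (u *ℤ u +ℤ + 2 *ℤ (v *ℤ v)) -ℤ + 4 *ℤ (v *ℤ v) -ℤ + 8 *ℤ (u *ℤ v) ≡⟨ cong (λ z → + 4 *ℤ z -ℤ + 4 *ℤ (v *ℤ v) -ℤ + 8 *ℤ (u *ℤ v)) (sym norm) ⟩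
    + 4 *ℤ + q -ℤ + 4 *ℤ (v *ℤ v) -ℤ + 8 *ℤ (u *ℤ v) ≡⟨ f2 (+ q) u v ⟩
    + 3 *ℤ + q -ℤ (+ 4 *ℤ (v *ℤ v) +ℤ + 8 *ℤ (u *ℤ v) -ℤ + q) ≡⟨ cong₂ _-ℤ_ (trans (sym (ℤP.pos-* 3 q)) e) (sym link) ⟩
    (a +ℤ + 4 *ℤ b +ℤ + 16) -ℤ (a +ℤ + 4 *ℤ b) ≡⟨ f3 (a +ℤ + 4 *ℤ b) ⟩
    + 16  ∎)
    where
    open ≡-Reasoning
    f1 : ∀ u v → + 4 *ℤ ((u -ℤ v) *ℤ (u -ℤ v)) ≡ + 4 *ℤ (u *ℤ u +ℤ + 2 *ℤ (v *ℤ v)) -ℤ + 4 *ℤ (v *ℤ v) -ℤ + 8 *ℤ (u *ℤ v)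
    f1 = solve-∀
    f2 : ∀ q u v → + 4 *ℤ q -ℤ + 4 *ℤ (v *ℤ v) -ℤ + 8 *ℤ (u *ℤ v) ≡ + 3 *ℤ q -ℤ (+ 4 *ℤ (v *ℤ v) +ℤ + 8 *ℤ (u *ℤ v) -ℤ q)
    f2 = solve-∀
    f3 : ∀ x → (x +ℤ + 16) -ℤ x ≡ + 16
    f3 = solve-∀

  -- Here s is a sign. Putting u = 6 s - 5 v into the norm form makes q divisible by 3, and
  -- completing the square gives 3 q = (9 v - 10 s)² + 8.
  spurious : ∀ s → s *ℤ s ≡ + 1 → u +ℤ + 5 *ℤ v ≡ + 6 *ℤ s → ⊥
  spurious s s² e = no-spurious-root m q p k 1≤m q≡ pp q≡p^k 3∣q ℤ.∣ z ∣ (ℤP.+-injective 3q)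
    where
    open ≡-Reasoning
    z y : ℤ
    z = + 9 *ℤ v -ℤ + 10 *ℤ s
    y = + 12 *ℤ (s *ℤ s) -ℤ + 20 *ℤ (s *ℤ v) +ℤ + 9 *ℤ (v *ℤ v)
    f0 : ∀ u v → u ≡ (u +ℤ + 5 *ℤ v) -ℤ + 5 *ℤ v
    f0 = solve-∀
    f1 : ∀ s v → (+ 6 *ℤ s -ℤ + 5 *ℤ v) *ℤ (+ 6 *ℤ s -ℤ + 5 *ℤ v) +ℤ + 2 *ℤ (v *ℤ v) ≡ (+ 12 *ℤ (s *ℤ s) -ℤ + 20 *ℤ (s *ℤ v) +ℤ + 9 *ℤ (v *ℤ v)) *ℤ + 3
    f1 = solve-∀
    f2 : ∀ s v → + 3 *ℤ ((+ 12 *ℤ (s *ℤ s) -ℤ + 20 *ℤ (s *ℤ v) +ℤ + 9 *ℤ (v *ℤ v)) *ℤ + 3) ≡ (+ 9 *ℤ v -ℤ + 10 *ℤ s) *ℤ (+ 9 *ℤ v -ℤ + 10 *ℤ s) +ℤ + 8 *ℤ (s *ℤ s)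
    f2 = solve-∀
    q≡3y : + q ≡ y *ℤ + 3
    q≡3y = trans norm (trans (cong (λ u → u *ℤ u +ℤ + 2 *ℤ (v *ℤ v)) (trans (f0 u v) (cong (_-ℤ (+ 5 *ℤ v)) e))) (f1 s v))
    3∣q : 3 ∣ q
    3∣q = divides ℤ.∣ y ∣ (trans (cong ℤ.∣_∣ q≡3y) (ℤP.abs-* y (+ 3)))
    3q : + (3 ℕ.* q) ≡ + (ℤ.∣ z ∣ ℕ.* ℤ.∣ z ∣ ℕ.+ 8)
    3q = begin
      + (3 ℕ.* q) ≡⟨ ℤP.pos-* 3 q ⟩
      + 3 *ℤ + q ≡⟨ cong (+ 3 *ℤ_) q≡3y ⟩
      + 3 *ℤ (y *ℤ + 3) ≡⟨ f2 s v ⟩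
      z *ℤ z +ℤ + 8 *ℤ (s *ℤ s) ≡⟨ cong₂ (λ x w → x +ℤ + 8 *ℤ w) (sym (∣i∣² z)) s² ⟩
      + (ℤ.∣ z ∣ ℕ.* ℤ.∣ z ∣) +ℤ + 8 ∎

  -- The hypothesis and `link` form a linear system for a and b, solved by `a≡` and `2b≡`. Inserting
  -- the solution into q² = a² + 2 b² gives an equation of degree four in u and v, which happens to
  -- factor.
  case-b : + (q ℕ.* q) ≡ a *ℤ a +ℤ + 2 *ℤ (b *ℤ b) → + (3 ℕ.* q) ≡ a -ℤ + 4 *ℤ b +ℤ + 16 → (u +ℤ v) *ℤ (u +ℤ v) ≡ + 4
  case-b quad e = go (ℤP.i*j≡0⇒i≡0∨j≡0 ((u +ℤ v) *ℤ (u +ℤ v) -ℤ + 4) factored)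
    where
    open ≡-Reasoning
    Q = u *ℤ u +ℤ + 2 *ℤ (v *ℤ v)
    3Q : + 3 *ℤ Q ≡ a -ℤ + 4 *ℤ b +ℤ + 16
    3Q = trans (cong (+ 3 *ℤ_) (sym norm)) (trans (sym (ℤP.pos-* 3 q)) e)
    link′ : a +ℤ + 4 *ℤ b ≡ + 4 *ℤ (v *ℤ v) +ℤ + 8 *ℤ (u *ℤ v) -ℤ Q
    link′ = trans link (cong (λ z → + 4 *ℤ (v *ℤ v) +ℤ + 8 *ℤ (u *ℤ v) -ℤ z) norm)
    g1 : ∀ a b → + 2 *ℤ a ≡ (a -ℤ + 4 *ℤ b +ℤ + 16) +ℤ (a +ℤ + 4 *ℤ b) -ℤ + 16
    g1 = solve-∀
    g2 : ∀ u v → + 3 *ℤ (u *ℤ u +ℤ + 2 *ℤ (v *ℤ v)) +ℤ (+ 4 *ℤ (v *ℤ v) +ℤ + 8 *ℤ (u *ℤ v) -ℤ (u *ℤ u +ℤ + 2 *ℤ (v *ℤ v))) -ℤ + 16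
                 ≡ + 2 *ℤ ((u +ℤ + 2 *ℤ v) *ℤ (u +ℤ + 2 *ℤ v) -ℤ + 8)
    g2 = solve-∀
    a≡ : a ≡ (u +ℤ + 2 *ℤ v) *ℤ (u +ℤ + 2 *ℤ v) -ℤ + 8
    a≡ = ℤP.*-cancelˡ-≡ (+ 2) _ _ (trans (g1 a b) (trans (cong₂ (λ x y → x +ℤ y -ℤ + 16) (sym 3Q) link′) (g2 u v)))
    g3 : ∀ a b → + 4 *ℤ (+ 2 *ℤ b) ≡ (a +ℤ + 4 *ℤ b) -ℤ (a -ℤ + 4 *ℤ b +ℤ + 16) +ℤ + 16
    g3 = solve-∀
    g4 : ∀ u v → (+ 4 *ℤ (v *ℤ v) +ℤ + 8 *ℤ (u *ℤ v) -ℤ (u *ℤ u +ℤ + 2 *ℤ (v *ℤ v))) -ℤ + 3 *ℤ (u *ℤ u +ℤ + 2 *ℤ (v *ℤ v)) +ℤ + 16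
                 ≡ + 4 *ℤ (+ 4 -ℤ (u -ℤ v) *ℤ (u -ℤ v))
    g4 = solve-∀
    2b≡ : + 2 *ℤ b ≡ + 4 -ℤ (u -ℤ v) *ℤ (u -ℤ v)
    2b≡ = ℤP.*-cancelˡ-≡ (+ 4) _ _ (trans (g3 a b) (trans (cong₂ (λ x y → x -ℤ y +ℤ + 16) link′ (sym 3Q)) (g4 u v)))
    -- The right side is 2 a² + (2 b)² - 2 q² after substitution of the values for a, 2 b and q.
    g5 : ∀ u v → ((u +ℤ v) *ℤ (u +ℤ v) -ℤ + 4) *ℤ ((u +ℤ + 5 *ℤ v) *ℤ (u +ℤ + 5 *ℤ v) -ℤ + 36)
       ≡ + 2 *ℤ (((u +ℤ + 2 *ℤ v) *ℤ (u +ℤ + 2 *ℤ v) -ℤ + 8) *ℤ ((u +ℤ + 2 *ℤ v) *ℤ (u +ℤ + 2 *ℤ v) -ℤ + 8))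
         +ℤ (+ 4 -ℤ (u -ℤ v) *ℤ (u -ℤ v)) *ℤ (+ 4 -ℤ (u -ℤ v) *ℤ (u -ℤ v))
         -ℤ + 2 *ℤ ((u *ℤ u +ℤ + 2 *ℤ (v *ℤ v)) *ℤ (u *ℤ u +ℤ + 2 *ℤ (v *ℤ v)))
    g5 = solve-∀
    g6 : ∀ a b → + 2 *ℤ (a *ℤ a) +ℤ (+ 2 *ℤ b) *ℤ (+ 2 *ℤ b) ≡ + 2 *ℤ (a *ℤ a +ℤ + 2 *ℤ (b *ℤ b))
    g6 = solve-∀
    factored : ((u +ℤ v) *ℤ (u +ℤ v) -ℤ + 4) *ℤ ((u +ℤ + 5 *ℤ v) *ℤ (u +ℤ + 5 *ℤ v) -ℤ + 36) ≡ + 0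
    factored = trans (g5 u v) (trans (cong (_-ℤ (+ 2 *ℤ (Q *ℤ Q)))
        (trans (cong₂ (λ x y → + 2 *ℤ (x *ℤ x) +ℤ y *ℤ y) (sym a≡) (sym 2b≡)) (trans (g6 a b) (cong (+ 2 *ℤ_) (trans (sym quad) (trans
            (ℤP.pos-* q q) (cong₂ _*ℤ_ norm norm)))))))
      (ℤP.+-inverseʳ (+ 2 *ℤ (Q *ℤ Q))))
    go : ((u +ℤ v) *ℤ (u +ℤ v) -ℤ + 4 ≡ + 0) ⊎ ((u +ℤ + 5 *ℤ v) *ℤ (u +ℤ + 5 *ℤ v) -ℤ + 36 ≡ + 0) → (u +ℤ v) *ℤ (u +ℤ v) ≡ + 4
    go (inj₁ z) = ℤP.i-j≡0⇒i≡j _ _ z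
    go (inj₂ z) = ⊥-elim (sign (square≡ (u +ℤ + 5 *ℤ v) (+ 6) (ℤP.i-j≡0⇒i≡j _ _ z)))
      where
      sign : u +ℤ + 5 *ℤ v ≡ + 6 ⊎ u +ℤ + 5 *ℤ v ≡ -ℤ + 6 → ⊥
      sign (inj₁ e) = spurious (+ 1) refl e
      sign (inj₂ e) = spurious (-ℤ + 1) refl e

-- Counting residues, and coefficient tables modulo 8

any-cong : ∀ {A : Set} {P Q : A → Bool} → (∀ x → P x ≡ Q x) → ∀ xs → any P xs ≡ any Q xs
any-cong e []       = refl
any-cong e (x ∷ xs) = cong₂ _∨_ (e x) (any-cong e xs)

any-map : ∀ {A B : Set} (P : B → Bool) (g : A → B) xs → any (P ∘ g) xs ≡ any P (map g xs)
any-map P g []       = refl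
any-map P g (x ∷ xs) = cong (P (g x) ∨_) (any-map P g xs)

≡ᵇ-true : ∀ {i j} → (i ≡ᵇ j) ≡ true → i ≡ j
≡ᵇ-true {i} {j} e = ℕP.≡ᵇ⇒≡ i j (subst T (sym e) _)

≢⇒≡ᵇ-false : ∀ {i j} → i ≢ j → (i ≡ᵇ j) ≡ false
≢⇒≡ᵇ-false {i} {j} ne with i ≡ᵇ j in eq
... | true  = ⊥-elim (ne (≡ᵇ-true eq))
... | false = refl

≡ᵇ-refl : ∀ i → (i ≡ᵇ i) ≡ true
≡ᵇ-refl zero    = refl
≡ᵇ-refl (suc i) = ≡ᵇ-refl i

𝟙-idem : ∀ b → 𝟙 b *ℤ 𝟙 b ≡ 𝟙 b
𝟙-idem true  = refl
𝟙-idem false = refl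

∑<-+′ : ∀ n (f g : ℕ → ℤ) → ∑< n (λ j → f j +ℤ g j) ≡ ∑< n f +ℤ ∑< n g
∑<-+′ zero    f g = refl
∑<-+′ (suc n) f g = trans (cong (_+ℤ (f n +ℤ g n)) (∑<-+′ n f g)) (shuffle (∑< n f) (∑< n g) (f n) (g n))
  where
  shuffle : ∀ a b c d → (a +ℤ b) +ℤ (c +ℤ d) ≡ (a +ℤ c) +ℤ (b +ℤ d)
  shuffle = solve-∀

∑<-single : ∀ n d → d ℕ.< n → ∑< n (λ j → 𝟙 (j ≡ᵇ d)) ≡ + 1
∑<-single (suc n) d d<n = go (d ℕ.≟ n)
  where
  go : Dec (d ≡ n) → ∑< n (λ j → 𝟙 (j ≡ᵇ d)) +ℤ 𝟙 (n ≡ᵇ d) ≡ + 1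
  go (yes refl) = cong₂ _+ℤ_ (trans (∑<-cong-< n (λ j j<n → cong 𝟙 (≢⇒≡ᵇ-false (ℕP.<⇒≢ j<n)))) (∑<-zero n)) (cong 𝟙 (≡ᵇ-refl n))
  go (no d≢n)   = cong₂ _+ℤ_ (∑<-single n d (ℕP.≤∧≢⇒< (ℕ.s≤s⁻¹ d<n) d≢n)) (cong 𝟙 (≢⇒≡ᵇ-false (d≢n ∘ sym)))

∑<-members : ∀ n ds → Unique ds → All (ℕ._< n) ds → ∑< n (λ j → 𝟙 (any (j ≡ᵇ_) ds)) ≡ + length ds
∑<-members n []       _        _          = ∑<-zero n
∑<-members n (d ∷ ds) (d∉ ∷ u) (d<n ∷ <n) = trans (∑<-cong n split)
  (trans (∑<-+′ n (λ j → 𝟙 (j ≡ᵇ d)) (λ j → 𝟙 (any (j ≡ᵇ_) ds))) (cong₂ _+ℤ_ (∑<-single n d d<n) (∑<-members n ds u <n)))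
  where
  split : ∀ j → 𝟙 ((j ≡ᵇ d) ∨ any (j ≡ᵇ_) ds) ≡ 𝟙 (j ≡ᵇ d) +ℤ 𝟙 (any (j ≡ᵇ_) ds)
  split j = go (j ≡ᵇ d) refl
    where
    go : ∀ b → (j ≡ᵇ d) ≡ b → 𝟙 (b ∨ any (j ≡ᵇ_) ds) ≡ 𝟙 b +ℤ 𝟙 (any (j ≡ᵇ_) ds)
    go false e = sym (ℤP.+-identityˡ _)
    go true  e = sym (cong (λ b → + 1 +ℤ 𝟙 b) (any-false (j ≡ᵇ_) ds
      (λ x x∈ → ≢⇒≡ᵇ-false {j} {x} (λ j≡x → All.lookup d∉ x∈ (trans (sym (≡ᵇ-true {j} {d} e)) j≡x)))))

-- Two terms differ by 4 (j - i), which is positive and less than 4 n = D. The quotients by D are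
-- subtracted instead of the terms, as a / D ≤ b / D keeps the subtraction exact.
progression-injective : ∀ D n .{{_ : NonZero D}} → D ≡ 4 ℕ.* n → ∀ c {i j} → i ℕ.< j → j ℕ.< n →
                        (c ℕ.+ 4 ℕ.* i) % D ≢ (c ℕ.+ 4 ℕ.* j) % D
progression-injective D n D≡ c {i} {j} i<j j<n e = ℕP.<⇒≱ d<D (∣⇒≤ {{ℕ.>-nonZero 0<d}} D∣d)
  where
  d = 4 ℕ.* (j ℕ.∸ i)
  a = c ℕ.+ 4 ℕ.* i
  b = c ℕ.+ 4 ℕ.* j
  0<d : 0 ℕ.< d
  0<d = ℕP.*-monoʳ-< 4 (ℕP.m<n⇒0<n∸m i<j)
  d<D : d ℕ.< D
  d<D = subst (d ℕ.<_) (sym D≡) (ℕP.*-monoʳ-< 4 (ℕP.≤-<-trans (ℕP.m∸n≤m j i) j<n))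
  b≡a+d : b ≡ a ℕ.+ d
  b≡a+d = trans (cong (λ z → c ℕ.+ 4 ℕ.* z) (sym (ℕP.m+[n∸m]≡n (ℕP.<⇒≤ i<j))))
            (trans (cong (c ℕ.+_) (ℕP.*-distribˡ-+ 4 i (j ℕ.∸ i))) (sym (ℕP.+-assoc c _ _)))
  D∣d : D ∣ d
  D∣d = divides (b / D ℕ.∸ a / D) (ℕP.+-cancelˡ-≡ (a ℕ.+ (a / D) ℕ.* D) _ _ (ℕP.+-cancelˡ-≡ (a % D) _ _ (begin
    a % D ℕ.+ (a ℕ.+ a / D ℕ.* D ℕ.+ d) ≡⟨ s1 (a % D) a (a / D ℕ.* D) d ⟩
    (a ℕ.+ d) ℕ.+ (a % D ℕ.+ a / D ℕ.* D) ≡⟨ cong₂ ℕ._+_ (trans (sym b≡a+d) (m≡m%n+[m/n]*n b D)) (sym (m≡m%n+[m/n]*n a D)) ⟩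
    (b % D ℕ.+ b / D ℕ.* D) ℕ.+ a ≡⟨ cong₂ (λ x y → (x ℕ.+ y ℕ.* D) ℕ.+ a) (sym e) (sym (ℕP.m+[n∸m]≡n a/D≤b/D)) ⟩
    (a % D ℕ.+ (a / D ℕ.+ (b / D ℕ.∸ a / D)) ℕ.* D) ℕ.+ a ≡⟨ s2 (a % D) (a / D) (b / D ℕ.∸ a / D) D a ⟩
    a % D ℕ.+ (a ℕ.+ a / D ℕ.* D ℕ.+ (b / D ℕ.∸ a / D) ℕ.* D) ∎)))
    where
    open ≡-Reasoning
    a/D≤b/D : a / D ℕ.≤ b / D
    a/D≤b/D = /-monoˡ-≤ D (ℕP.+-monoʳ-≤ c (ℕP.*-monoʳ-≤ 4 (ℕP.<⇒≤ i<j)))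
    s1 : ∀ r a x d → r ℕ.+ (a ℕ.+ x ℕ.+ d) ≡ (a ℕ.+ d) ℕ.+ (r ℕ.+ x)
    s1 = ℕR.solve-∀
    s2 : ∀ r x y D a → (r ℕ.+ (x ℕ.+ y) ℕ.* D) ℕ.+ a ≡ r ℕ.+ (a ℕ.+ x ℕ.* D ℕ.+ y ℕ.* D)
    s2 = ℕR.solve-∀

odd-values : (ℕ → ℤ) → ℕ → ℤ
odd-values a j = a j -ℤ a (4 ℕ.+ j)

-- Half of the inner product over all eight residues: for two odd tables the entries at j and 4 + j
-- have the same product.
dot : (ℕ → ℤ) → (ℕ → ℤ) → ℤ
dot w w′ = w 0 *ℤ w′ 0 +ℤ w 1 *ℤ w′ 1 +ℤ w 2 *ℤ w′ 2 +ℤ w 3 *ℤ w′ 3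

Coefficients : Set
Coefficients = ℤ × ℤ × ℤ × ℤ

infixl 6 _⊞_
_⊞_ : Coefficients → Coefficients → Coefficients
(a , b , c , d) ⊞ (a′ , b′ , c′ , d′) = a +ℤ a′ , b +ℤ b′ , c +ℤ c′ , d +ℤ d′

-- The coefficients of u², u v, v² and − n in ev w * ev w′ − n * dot w w′.
coefs : (ℕ → ℤ) → (ℕ → ℤ) → Coefficients
coefs w w′ = w 2 *ℤ w′ 2 , (w 1 -ℤ w 3) *ℤ w′ 2 +ℤ w 2 *ℤ (w′ 1 -ℤ w′ 3) , (w 1 -ℤ w 3) *ℤ (w′ 1 -ℤ w′ 3) , dot w w′

signD : ℕ → ℤ
signD j = 𝟙 (any (λ i → (j % 4) ≡ᵇ (i % 4)) (0 ∷ 1 ∷ [])) -ℤ 𝟙 (any (λ i → (j % 4) ≡ᵇ (i % 4)) (2 ∷ 3 ∷ []))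

-- Translating the argument by ω^s shifts the table of x ↦ f x − f (−x) by s.
shifted : (ℕ → ℤ) → ℕ → ℕ → ℤ
shifted a s j = odd-values a (s ℕ.+ j)

-- In terms of u, v and n, `cross` says that the odd parts contribute ± (u² - 2 σ u v + v²) with the
-- sign of D_0 - D_2 and no multiple of n. By `auto` the four autocorrelations of the odd parts add
-- up to 3 (u² + 2 v²) - 12 n in every class. The sign σ is 1 in case (a) and -1 in case (b).
record Pattern (a₀ a₁ a₂ a₃ : ℕ → ℤ) (σ : ℤ) : Set where
  field
    cross : ∀ s → s ℕ.< 8 → coefs (shifted a₀ s) (shifted a₁ s) ⊞ coefs (shifted a₂ s) (shifted a₃ s)
                            ≡ (signD s , signD s *ℤ (-ℤ + 2 *ℤ σ) , signD s , + 0)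
    auto  : ∀ s → s ℕ.< 8 → coefs (shifted a₀ s) (shifted a₀ s) ⊞ coefs (shifted a₁ s) (shifted a₁ s)
                              ⊞ coefs (shifted a₂ s) (shifted a₂ s) ⊞ coefs (shifted a₃ s) (shifted a₃ s)
                            ≡ (+ 3 , + 0 , + 6 , + 12)

∑-delta : ∀ {A : Set} (_≟_ : DecidableEquality A) {xs : List A} → Unique xs → ∀ {a} → a ∈ xs → (k : A → ℤ) →
          ∑ xs (λ x → k x *ℤ 𝟙 (does (x ≟ a))) ≡ k a
∑-delta _≟_ {x ∷ xs} (x∉ ∷ u) {a} (here refl) k = trans
  (cong₂ _+ℤ_ (trans (cong (λ b → k x *ℤ 𝟙 b) (dec-true (x ≟ x) refl)) (ℤP.*-identityʳ (k x))) (vanish xs x∉)) (ℤP.+-identityʳ (k x))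
  where
  vanish : ∀ ys → All (x ≢_) ys → ∑ ys (λ y → k y *ℤ 𝟙 (does (y ≟ x))) ≡ + 0
  vanish []       _          = refl
  vanish (y ∷ ys) (ne ∷ nes) = cong₂ _+ℤ_ (trans (cong (λ b → k y *ℤ 𝟙 b) (dec-false (y ≟ x) (ne ∘ sym))) (ℤP.*-zeroʳ (k y))) (vanish ys nes)
∑-delta _≟_ {x ∷ xs} (x∉ ∷ u) {a} (there a∈) k = trans
  (cong₂ _+ℤ_ (trans (cong (λ b → k x *ℤ 𝟙 b) (dec-false (x ≟ a) (All.lookup x∉ a∈))) (ℤP.*-zeroʳ (k x))) (∑-delta _≟_ u a∈ k)) (ℤP.+-identityˡ (k a))

%-+1 : ∀ a D .{{_ : NonZero D}} → (a % D ℕ.+ 1) % D ≡ (a ℕ.+ 1) % D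
%-+1 a D = trans (%-distribˡ-+ (a % D) 1 D) (trans (cong (λ z → (z ℕ.+ 1 % D) % D) (m%n%n≡m%n a D)) (sym (%-distribˡ-+ a 1 D)))

v-union : List ℕ → ℕ → ℤ
v-union is j = 𝟙 (any (λ i → (j % 8) ≡ᵇ (i % 8)) is)

patternA : Pattern (v-union (0 ∷ 2 ∷ 3 ∷ [])) (v-union (2 ∷ 4 ∷ 5 ∷ [])) (v-union (1 ∷ 3 ∷ 4 ∷ [])) (v-union (3 ∷ 5 ∷ 6 ∷ [])) (+ 1)
patternA = record { cross = below8 _ all≡ ; auto = below8 _ all≡ }

patternB : Pattern (v-union (0 ∷ 2 ∷ 7 ∷ [])) (v-union (2 ∷ 4 ∷ 9 ∷ [])) (v-union (1 ∷ 3 ∷ 8 ∷ [])) (v-union (3 ∷ 5 ∷ 10 ∷ [])) (-ℤ + 1)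
patternB = record { cross = below8 _ all≡ ; auto = below8 _ all≡ }

-- The field of order q² over its subfield K

module Construction
  (m r p k : ℕ) (r≡ : r ≡ 8 ℕ.* m ℕ.+ 2) (r≥2 : 2 ℕ.≤ r) (pp : Prime p) (q≡p^k : suc r ≡ p ℕ.^ k)
  (F : FiniteField) (order≡ : FiniteField.order F ≡ suc r ℕ.* suc r)
  (ω : FiniteField.Carrier F) (prim : FiniteField.IsPrimitive F ω) where

  open FiniteField F
  open FieldTheory F public

  -- `M` is q² - 1, written so that `suc M` and `suc r * suc r` reduce to the same term; `order≡`
  -- then serves both forms.
  q M : ℕ
  q = suc r
  M = r ℕ.+ r ℕ.* q

  r>0 : 0 ℕ.< r
  r>0 = ℕP.≤-trans (s≤s z≤n) r≥2

  r<M : r ℕ.< M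
  r<M = ℕP.m<m+n r (ℕP.*-mono-≤ {1} {r} {1} {q} r>0 (s≤s z≤n))

  instance
    r-nonZero : NonZero r
    r-nonZero = ℕ.>-nonZero r>0
    M-nonZero : NonZero M
    M-nonZero = ℕ.>-nonZero (ℕP.≤-trans (s≤s z≤n) r<M)

  open Primitive ω prim M order≡ (ℕP.≤-trans r≥2 (ℕP.<⇒≤ r<M)) public

  pow≡1⇒∣ : ∀ d → pow ω d ≡ 1# → M ∣ d
  pow≡1⇒∣ d e = m%n≡0⇒n∣m d M (trans (pow-inj-% d 0 e) (m<n⇒m%n≡m-0))
    where
    m<n⇒m%n≡m-0 : 0 % M ≡ 0
    m<n⇒m%n≡m-0 = m<n⇒m%n≡m (ℕP.≤-trans (s≤s z≤n) r<M)

  M≡r*[q+1] : M ≡ r ℕ.* suc q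
  M≡r*[q+1] = sym (ℕP.*-suc r q)

  φ : Carrier → Carrier
  φ x = pow x q

  φ-+ : ∀ x y → φ (x + y) ≡ φ x + φ y
  φ-+ x y = subst (λ n → pow (x + y) n ≡ pow x n + pow y n) (sym q≡p^k)
    (pow-frobenius-+ pp (characteristic p (k ℕ.+ k) (trans order≡ (trans (cong₂ ℕ._*_ q≡p^k q≡p^k) (sym (ℕP.^-distribˡ-+-* p k k))))) k x y)

  φ-* : ∀ x y → φ (x * y) ≡ φ x * φ y
  φ-* x y = pow-distrib x y q

  φ-0 : φ 0# ≡ 0#
  φ-0 = pow-0# q (s≤s z≤n)

  φ-1 : φ 1# ≡ 1#
  φ-1 = pow-1# q

  φ-neg : ∀ x → φ (- x) ≡ - φ x
  φ-neg x = neg-unique (φ x) (φ (- x)) (trans (sym (φ-+ x (- x))) (trans (cong φ (-‿inverseʳ x)) φ-0))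

  φ-sub : ∀ x y → φ (x - y) ≡ φ x - φ y
  φ-sub x y = trans (φ-+ x (- y)) (cong (_+_ (φ x)) (φ-neg y))

  φ-involutive : ∀ x → φ (φ x) ≡ x
  φ-involutive x = go (x ≟ 0#)
    where
    go : Dec (x ≡ 0#) → φ (φ x) ≡ x
    go (yes z) = trans (cong (φ ∘ φ) z) (trans (cong φ φ-0) (trans φ-0 (sym z)))
    go (no nz) = trans (sym (pow-* x q q)) (trans (cong (x *_) (pow-M≡1 nz)) (*-identityʳ x))

  N : Carrier
  N = pow ω (suc q)

  N≢0 : N ≢ 0#
  N≢0 = pow-nonzero (suc q) ω≢0

  φ-N : φ N ≡ N
  φ-N = trans (sym (pow-* ω q (suc q))) (trans (cong (pow ω) (arith r))
          (trans (pow-+ ω (suc q) M) (trans (cong (N *_) pow-M) (*-identityʳ N))))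
    where
    arith : ∀ r → suc r ℕ.* suc (suc r) ≡ suc (suc r) ℕ.+ (r ℕ.+ r ℕ.* suc r)
    arith = ℕR.solve-∀

  InK : Carrier → Set
  InK x = φ x ≡ x

  K : Carrier → ℤ
  K x = 𝟙 (does (φ x ≟ x))

  K≡1 : ∀ {x} → InK x → K x ≡ + 1
  K≡1 {x} e = cong 𝟙 (dec-true (φ x ≟ x) e)

  K≡0 : ∀ {x} → ¬ InK x → K x ≡ + 0
  K≡0 {x} e = cong 𝟙 (dec-false (φ x ≟ x) e)

  InK-+ : ∀ {x y} → InK x → InK y → InK (x + y)
  InK-+ {x} {y} a b = trans (φ-+ x y) (cong₂ _+_ a b)

  InK-neg : ∀ {x} → InK x → InK (- x)
  InK-neg {x} a = trans (φ-neg x) (cong -_ a)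

  K-translate : ∀ {c} → InK c → ∀ x → K (x - c) ≡ K x
  K-translate {c} c∈K x = cong 𝟙 (does-⇔ (φ (x - c) ≟ (x - c)) (φ x ≟ x)
    (λ e → subst InK (sub-add x c) (InK-+ e c∈K)) (λ e → InK-+ e (InK-neg c∈K)))

  K-neg : ∀ x → K (- x) ≡ K x
  K-neg x = cong 𝟙 (does-⇔ (φ (- x) ≟ (- x)) (φ x ≟ x)
    (λ e → subst InK (neg-neg x) (InK-neg e)) InK-neg)

  K-N : ∀ x → K (N * x) ≡ K x
  K-N x = cong 𝟙 (does-⇔ (φ (N * x) ≟ (N * x)) (φ x ≟ x)
    (λ e → *-cancelˡ N N≢0 (trans (sym φ-Nx) e)) (λ e → trans φ-Nx (cong (N *_) e)))
    where
    φ-Nx : φ (N * x) ≡ N * φ x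
    φ-Nx = trans (φ-* N x) (cong (_* φ x) φ-N)

  -- If φ fixes ω^j then ω^(r j) = 1, so r (q + 1) divides r j.
  InK-pow : ∀ j → InK (pow ω j) → suc q ∣ j
  InK-pow j e = *-cancelˡ-∣ r (subst (_∣ r ℕ.* j) M≡r*[q+1] (pow≡1⇒∣ (r ℕ.* j)
    (*-cancelˡ (pow ω j) (pow-nonzero j ω≢0)
      (trans (sym (pow-+ ω j (r ℕ.* j))) (trans (pow-* ω q j) (trans e (sym (*-identityʳ _))))))))

  pow-N : ∀ t → pow ω (t ℕ.* suc q) ≡ pow N t
  pow-N t = pow-* ω t (suc q)

  K-log : ∀ x → InK x → x ≢ 0# → ∃ λ t → x ≡ pow N t
  K-log x x∈K x≢0 = go (log x x≢0)
    where
    go : (∃ λ j → j ℕ.< M × pow ω j ≡ x) → ∃ λ t → x ≡ pow N t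
    go (j , _ , e) = power (InK-pow j (subst InK (sym e) x∈K))
      where
      power : suc q ∣ j → ∃ λ t → x ≡ pow N t
      power (divides t j≡) = t , trans (sym e) (trans (cong (pow ω) j≡) (pow-N t))

  ΣK : (Carrier → ℤ) → ℤ
  ΣK g = ΣF (λ c → K c *ℤ g c)

  Even Odd : (Carrier → ℤ) → Set
  Even f = ∀ x → f (N * x) ≡ f x
  Odd  f = ∀ x → f (N * x) ≡ -ℤ f x

  Even-pow : ∀ {f} → Even f → ∀ t x → f (pow N t * x) ≡ f x
  Even-pow {f} ev zero    x = cong f (*-identityˡ x)
  Even-pow {f} ev (suc t) x = trans (cong f (*-assoc N (pow N t) x)) (trans (ev _) (Even-pow ev t x))

  -- The M exponents form r blocks of length q + 1. In each block only the multiple of q + 1 gives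
  -- an element of K, and there h takes the value `h 1#`.
  ΣK-even : ∀ h → Even h → ΣK h ≡ h 0# +ℤ + r *ℤ h 1#
  ΣK-even h ev = begin
    ΣK h ≡⟨ Σ-pow _ ⟩
    K 0# *ℤ h 0# +ℤ ∑< M f ≡⟨ cong₂ _+ℤ_ (trans (cong (_*ℤ h 0#) (K≡1 φ-0)) (ℤP.*-identityˡ _)) rest ⟩
    h 0# +ℤ + r *ℤ h 1#  ∎
    where
    open ≡-Reasoning
    f : ℕ → ℤ
    f j = K (pow ω j) *ℤ h (pow ω j)
    split : ∀ i t → pow ω (i ℕ.+ t ℕ.* suc q) ≡ pow N t * pow ω i
    split i t = trans (pow-+ ω i (t ℕ.* suc q)) (trans (cong (pow ω i *_) (pow-N t)) (*-comm _ _))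
    per : ∀ i t → f (i ℕ.+ t ℕ.* suc q) ≡ f i
    per i t = cong₂ _*ℤ_ (trans (cong K (split i t)) (Even-pow {K} K-N t _)) (trans (cong h (split i t)) (Even-pow {h} ev t _))
    nil : ∀ i → i ℕ.< q → f (suc i) ≡ + 0
    nil i i<q = cong (_*ℤ h (pow ω (suc i))) (K≡0 (λ e → ℕP.<⇒≱ (s≤s i<q) (∣⇒≤ (InK-pow (suc i) e))))
    rest : ∑< M f ≡ + r *ℤ h 1#
    rest = begin
      ∑< M f ≡⟨ cong (λ M → ∑< M f) M≡r*[q+1] ⟩
      ∑< (r ℕ.* suc q) f ≡⟨ ∑<-periodic (suc q) r f per ⟩
      + r *ℤ ∑< (suc q) f ≡⟨ cong (+ r *ℤ_) (∑<-suc q f) ⟩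
      + r *ℤ (f 0 +ℤ ∑< q (f ∘ suc)) ≡⟨ cong (λ s → + r *ℤ (f 0 +ℤ s)) (trans (∑<-cong-< q nil) (∑<-zero q)) ⟩
      + r *ℤ (f 0 +ℤ + 0) ≡⟨ cong (+ r *ℤ_) (trans (ℤP.+-identityʳ _) (trans (cong (_*ℤ h 1#) (K≡1 φ-1)) (ℤP.*-identityˡ _))) ⟩
      + r *ℤ h 1#  ∎

  Σ-K : ΣF K ≡ + q
  Σ-K = trans (∑-cong elems (λ c → sym (ℤP.*-identityʳ (K c))))
          (trans (ΣK-even (λ _ → + 1) (λ _ → refl)) (cong (_+ℤ_ (+ 1)) (ℤP.*-identityʳ (+ r))))

  ΣK-cong : ∀ {f g} → (∀ c → InK c → f c ≡ g c) → ΣK f ≡ ΣK g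
  ΣK-cong {f} {g} e = ∑-cong elems pt
    where
    pt : ∀ c → K c *ℤ f c ≡ K c *ℤ g c
    pt c = go (φ c ≟ c)
      where
      go : (d : Dec (InK c)) → 𝟙 (does d) *ℤ f c ≡ 𝟙 (does d) *ℤ g c
      go (yes c∈K) = cong (+ 1 *ℤ_) (e c c∈K)
      go (no _)    = refl

  Σ-const : ∀ c → ΣF (λ _ → c) ≡ + q *ℤ + q *ℤ c
  Σ-const c = trans (∑-const elems c) (cong (_*ℤ c) (trans (cong +_ order≡) (ℤP.pos-* q q)))

  -- Sums over cosets of the subfield K

  π : (Carrier → ℤ) → Carrier → ℤ
  π f x = ΣK (λ c → f (x + c))

  π-translate : ∀ f {c} → InK c → ∀ x → π f (x + c) ≡ π f x
  π-translate f {c} c∈K x = trans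
    (∑-cong elems (λ d → cong₂ _*ℤ_ (cong K (sym (+-cancelʳ-inv d c))) (cong f (trans (+-assoc x c d) (cong (_+_ x) (+-comm c d))))))
    (trans (Σ-translate c (λ d → K (d - c) *ℤ f (x + d)))
      (∑-cong elems (λ d → cong (_*ℤ f (x + d)) (K-translate c∈K d))))

  π-N : ∀ f x → π f (N * x) ≡ π (f ∘ (N *_)) x
  π-N f x = trans (sym (Σ-scale N≢0 (λ c → K c *ℤ f (N * x + c))))
    (∑-cong elems (λ c → cong₂ _*ℤ_ (K-N c) (cong f (sym (distribˡ N x c)))))

  π-cong : ∀ {f g} → (∀ x → f x ≡ g x) → ∀ x → π f x ≡ π g x
  π-cong e x = ∑-cong elems (λ c → cong (K c *ℤ_) (e (x + c)))

  π-+ : ∀ f g x → π (λ y → f y +ℤ g y) x ≡ π f x +ℤ π g x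
  π-+ f g x = trans (∑-cong elems (λ c → ℤP.*-distribˡ-+ (K c) (f (x + c)) (g (x + c)))) (∑-+ elems _ _)

  π-*ˡ : ∀ s f x → π (λ y → s *ℤ f y) x ≡ s *ℤ π f x
  π-*ˡ s f x = trans (∑-cong elems (λ c → i*jk≡j*ik (K c) s (f (x + c)))) (∑-*ˡ elems s _)

  π-neg : ∀ f x → π (λ y → -ℤ f y) x ≡ -ℤ π f x
  π-neg f x = trans (∑-cong elems (λ c → sym (ℤP.neg-distribʳ-* (K c) (f (x + c))))) (∑-neg elems _)

  π-odd : ∀ {f} → Odd f → Odd (π f)
  π-odd {f} od x = trans (π-N f x) (trans (π-cong od x) (π-neg f x))

  π-even : ∀ {f} → Even f → Even (π f)
  π-even {f} ev x = trans (π-N f x) (π-cong ev x)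

  y₀ : Carrier
  y₀ = ω - φ ω

  y₀≢0 : y₀ ≢ 0#
  y₀≢0 e = ℕP.<⇒≱ r<M (period≥ r r>0 (*-cancelˡ ω ω≢0 (trans (sym (sub≡0⇒≡ _ _ e)) (sym (*-identityʳ ω)))))

  y₀⁻¹ : Carrier
  y₀⁻¹ = proj₁ (inverse y₀ y₀≢0)

  δ : Carrier → Carrier
  δ x = (x - φ x) * y₀⁻¹

  δ*y₀ : ∀ x → δ x * y₀ ≡ x - φ x
  δ*y₀ x = trans (*-assoc _ y₀⁻¹ y₀) (trans (cong ((x - φ x) *_) (trans (*-comm y₀⁻¹ y₀) (proj₂ (inverse y₀ y₀≢0)))) (*-identityʳ _))

  φ-antisym : ∀ x → φ (x - φ x) ≡ - (x - φ x)
  φ-antisym x = trans (φ-sub x (φ x)) (trans (cong (_-_ (φ x)) (φ-involutive x)) (sym (neg-sub x (φ x))))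

  -- φ negates both x - φ x and `y₀`, so it fixes their quotient.
  δ-InK : ∀ x → InK (δ x)
  δ-InK x = *-cancelˡ y₀ y₀≢0 (begin
    y₀ * φ (δ x) ≡⟨ *-comm y₀ _ ⟩
    φ (δ x) * y₀ ≡⟨ sym (neg-neg _) ⟩
    - (- (φ (δ x) * y₀)) ≡⟨ cong -_ (-‿distribʳ-* _ _) ⟩
    - (φ (δ x) * - y₀) ≡⟨ cong (λ z → - (φ (δ x) * z)) (sym (φ-antisym ω)) ⟩
    - (φ (δ x) * φ y₀) ≡⟨ cong -_ (sym (φ-* (δ x) y₀)) ⟩
    - φ (δ x * y₀) ≡⟨ cong (λ z → - φ z) (δ*y₀ x) ⟩
    - φ (x - φ x) ≡⟨ cong -_ (φ-antisym x) ⟩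
    - (- (x - φ x)) ≡⟨ neg-neg _ ⟩
    x - φ x ≡⟨ sym (δ*y₀ x) ⟩
    δ x * y₀ ≡⟨ *-comm _ y₀ ⟩
    y₀ * δ x  ∎)
    where open ≡-Reasoning

  δ-translate : ∀ {c} → InK c → ∀ x → δ (x + c) ≡ δ x
  δ-translate {c} c∈K x = cong (_* y₀⁻¹) (begin
    (x + c) - φ (x + c) ≡⟨ cong (_-_ (x + c)) (trans (φ-+ x c) (cong (_+_ (φ x)) c∈K)) ⟩
    (x + c) - (φ x + c) ≡⟨ cong (_+_ (x + c)) (trans (cong -_ (+-comm (φ x) c)) (sym (neg-+ c (φ x)))) ⟩
    (x + c) + (- c + - φ x) ≡⟨ sym (+-assoc (x + c) (- c) (- φ x)) ⟩
    ((x + c) - c) - φ x ≡⟨ cong (_- φ x) (+-cancelʳ-inv x c) ⟩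
    x - φ x  ∎)
    where
    open ≡-Reasoning

  δ-ω : δ ω ≡ 1#
  δ-ω = proj₂ (inverse y₀ y₀≢0)

  δ-φ : ∀ x → δ (φ x) ≡ - δ x
  δ-φ x = trans (cong (_* y₀⁻¹) (trans (cong (_-_ (φ x)) (φ-involutive x)) (sym (neg-sub x (φ x))))) (sym (-‿distribˡ-* _ _))

  δ≡0⇒InK : ∀ x → δ x ≡ 0# → InK x
  δ≡0⇒InK x e = sym (sub≡0⇒≡ _ _ (trans (sym (δ*y₀ x)) (trans (cong (_* y₀) e) (zeroˡ y₀))))

  InK⇒δ≡0 : ∀ x → InK x → δ x ≡ 0#
  InK⇒δ≡0 x e = trans (cong (_* y₀⁻¹) (trans (cong (_-_ x) e) (-‿inverseʳ x))) (zeroˡ _)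

  decompose : ∀ x → ∃ λ c → InK c × x ≡ δ x * ω + c
  decompose x = x - δ x * ω , c∈K , sym (trans (+-comm _ _) (sub-add x _))
    where
    open ≡-Reasoning
    swap-sub : ∀ {a b c d} → a - b ≡ c - d → b - d ≡ a - c
    swap-sub {a} {b} {c} {d} e = begin
      b - d ≡⟨ cong (_- d) (sym (trans (cong (_+_ b) (trans (+-comm c (- c)) (-‿inverseˡ c))) (+-identityʳ b))) ⟩
      b + (c - c) - d ≡⟨ trans (+-assoc b (c - c) (- d)) (cong (_+_ b) (trans (+-assoc c (- c) (- d)) (trans (cong (_+_ c) (+-comm (- c)
          (- d))) (sym (+-assoc c (- d) (- c)))))) ⟩
      b + ((c - d) - c) ≡⟨ cong (λ z → b + (z - c)) (sym e) ⟩
      b + ((a - b) - c) ≡⟨ sym (+-assoc b (a - b) (- c)) ⟩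
      (b + (a - b)) - c ≡⟨ cong (_- c) (trans (+-comm b (a - b)) (sub-add a b)) ⟩
      a - c  ∎
    c∈K : InK (x - δ x * ω)
    c∈K = trans (φ-sub x (δ x * ω)) (trans (cong (λ z → φ x - z) (trans (φ-* (δ x) ω) (cong (_* φ ω) (δ-InK x))))
      (swap-sub {x} {φ x} {δ x * ω} {δ x * φ ω} (trans (sym (δ*y₀ x)) (x[y-z]≈xy-xz (δ x) ω (φ ω)))))

  -- Off K the coordinate δ x is a power of N, so x + K is obtained from ω + K by t multiplications
  -- with N. Even and odd functions are thus known on all cosets from their sums over K and ω + K.
  data Position (x : Carrier) : Set where
    inside  : InK x → δ x ≡ 0# → Position x
    outside : ∀ t c → ¬ InK x → InK c → δ x ≡ pow N t → x ≡ pow N t * ω + c → Position x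

  position : ∀ x → Position x
  position x = go (δ x ≟ 0#)
    where
    away : δ x ≢ 0# → (∃ λ t → δ x ≡ pow N t) → (∃ λ c → InK c × x ≡ δ x * ω + c) → Position x
    away nz (t , dt) (c , c∈K , ex) = outside t c (nz ∘ InK⇒δ≡0 x) c∈K dt (trans ex (cong (λ z → z * ω + c) dt))
    go : Dec (δ x ≡ 0#) → Position x
    go (yes z) = inside (δ≡0⇒InK x z) z
    go (no nz) = away nz (K-log (δ x) (δ-InK x) nz) (decompose x)

  π-inside : ∀ f {x} → InK x → π f x ≡ π f 0#
  π-inside f {x} x∈K = trans (cong (π f) (sym (+-identityˡ x))) (π-translate f x∈K 0#)

  π-outside : ∀ f {x} t {c} → InK c → x ≡ pow N t * ω + c → π f x ≡ π f (pow N t * ω)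
  π-outside f t c∈K ex = trans (cong (π f) ex) (π-translate f c∈K _)

  -- For indicator functions this is the coefficient at x of the group ring product of the first set
  -- with the reflection of the second.
  Corr : (Carrier → ℤ) → (Carrier → ℤ) → Carrier → ℤ
  Corr f g x = ΣF (λ h → f h *ℤ g (h - x))

  Corr-cong : ∀ {f f′ g g′} → (∀ x → f x ≡ f′ x) → (∀ x → g x ≡ g′ x) → ∀ x → Corr f g x ≡ Corr f′ g′ x
  Corr-cong ef eg x = ∑-cong elems (λ h → cong₂ _*ℤ_ (ef h) (eg (h - x)))

  Corr-scale : ∀ {u} → u ≢ 0# → ∀ f g x → Corr f g (u * x) ≡ Corr (f ∘ (u *_)) (g ∘ (u *_)) x
  Corr-scale {u} u≢0 f g x = trans (sym (Σ-scale u≢0 (λ h → f h *ℤ g (h - u * x))))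
    (∑-cong elems (λ h → cong (λ z → f (u * h) *ℤ g z) (sym (x[y-z]≈xy-xz u h x))))

  Corr-0 : ∀ f g → Corr f g 0# ≡ ΣF (λ h → f h *ℤ g h)
  Corr-0 f g = ∑-cong elems (λ h → cong (λ z → f h *ℤ g z) (trans (cong (_+_ h) -0#≈0#) (+-identityʳ h)))

  Corr-even : ∀ {f g} → Even f → Even g → Even (Corr f g)
  Corr-even {f} {g} ef eg x = trans (Corr-scale N≢0 f g x) (Corr-cong ef eg x)

  Corr-odd : ∀ {f g} → Odd f → Odd g → Even (Corr f g)
  Corr-odd {f} {g} of og x = trans (Corr-scale N≢0 f g x)
    (trans (Corr-cong of og x) (∑-cong elems (λ h → -i*-j≡i*j (f h) (g (h - x)))))

  -- Exchanging the sums turns the average over shifts c in K into a coset sum of g; the sign of c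
  -- is absorbed by K = -K.
  ΣK-Corr : ∀ f g → ΣK (Corr f g) ≡ ΣF (λ h → f h *ℤ π g h)
  ΣK-Corr f g = begin
    ΣF (λ c → K c *ℤ ΣF (λ h → f h *ℤ g (h - c))) ≡⟨ ∑-cong elems (λ c → sym (∑-*ˡ elems (K c) _)) ⟩
    ΣF (λ c → ΣF (λ h → K c *ℤ (f h *ℤ g (h - c)))) ≡⟨ ∑-swap elems elems _ ⟩
    ΣF (λ h → ΣF (λ c → K c *ℤ (f h *ℤ g (h - c)))) ≡⟨ ∑-cong elems inner ⟩
    ΣF (λ h → f h *ℤ π g h)  ∎
    where
    open ≡-Reasoning
    inner : ∀ h → ΣF (λ c → K c *ℤ (f h *ℤ g (h - c))) ≡ f h *ℤ π g h
    inner h = trans (∑-cong elems (λ c → i*jk≡j*ik (K c) (f h) (g (h - c)))) (trans (∑-*ˡ elems (f h) _)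
      (cong (f h *ℤ_) (trans (sym (Σ-negate (λ c → K c *ℤ g (h - c))))
        (∑-cong elems (λ c → cong₂ _*ℤ_ (K-neg c) (cong (λ z → g (h + z)) (neg-neg c)))))))

  module OddFunctions (η : Carrier → ℤ) (η-odd : Odd η) (η-0 : η 0# ≡ + 0) (η-1 : η 1# ≡ + 1) where

    -- Along the powers of N the values of `η` alternate between 1 and -1, so `η` restricted to K is
    -- its quadratic character, whatever its values elsewhere.
    κ : Carrier → ℤ
    κ x = η (δ x)

    κ-translate : ∀ {c} → InK c → ∀ x → κ (x + c) ≡ κ x
    κ-translate c∈K x = cong η (δ-translate c∈K x)

    e : (Carrier → ℤ) → ℤ
    e f = π f ω

    -- Both sides are constant on cosets of K, change sign under N and agree at ω. On K itself both
    -- vanish, since N fixes 0.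
    π≡κe : ∀ {f} → Odd f → ∀ x → π f x ≡ κ x *ℤ e f
    π≡κe {f} od x = go (position x)
      where
      πf0 : π f 0# ≡ + 0
      πf0 = i≡-i⇒i≡0 _ (trans (cong (π f) (sym (zeroʳ N))) (π-odd od 0#))
      powers : ∀ t → π f (pow N t * ω) ≡ η (pow N t) *ℤ e f
      powers zero    = trans (cong (π f) (*-identityˡ ω)) (sym (trans (cong (_*ℤ e f) η-1) (ℤP.*-identityˡ _)))
      powers (suc t) = trans (cong (π f) (*-assoc N (pow N t) ω)) (trans (π-odd od _)
        (trans (cong -ℤ_ (powers t)) (trans (ℤP.neg-distribˡ-* (η (pow N t)) (e f)) (cong (_*ℤ e f) (sym (η-odd (pow N t)))))))
      go : Position x → π f x ≡ κ x *ℤ e f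
      go (inside x∈K z) = trans (π-inside f x∈K) (trans πf0 (sym (cong (_*ℤ e f) (trans (cong η z) η-0))))
      go (outside t c _ c∈K dt ex) = trans (π-outside f t c∈K ex) (trans (powers t) (cong (λ z → η z *ℤ e f) (sym dt)))

    κ² : ∀ x → κ x *ℤ κ x ≡ + 1 -ℤ K x
    κ² x = go (position x)
      where
      neg*neg : ∀ a → -ℤ a *ℤ -ℤ a ≡ a *ℤ a
      neg*neg = solve-∀
      powers : ∀ t → η (pow N t) *ℤ η (pow N t) ≡ + 1
      powers zero    = cong (λ w → w *ℤ w) η-1
      powers (suc t) = trans (cong (λ w → w *ℤ w) (η-odd (pow N t))) (trans (neg*neg (η (pow N t))) (powers t))
      go : Position x → κ x *ℤ κ x ≡ + 1 -ℤ K x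
      go (inside x∈K z) = trans (cong (λ w → η w *ℤ η w) z) (trans (cong (λ w → w *ℤ w) η-0) (cong (_-ℤ_ (+ 1)) (sym (K≡1 x∈K))))
      go (outside t c x∉K _ dt _) = trans (cong (λ w → η w *ℤ η w) dt) (trans (powers t) (cong (_-ℤ_ (+ 1)) (sym (K≡0 x∉K))))

    -- Summing the translates by all c in K multiplies the left side by q. As κ is constant on
    -- cosets, f is replaced by its coset sums κ * e f, and κ² totals q² - q = q r.
    Σ-κ : ∀ {f} → Odd f → ΣF (λ w → f w *ℤ κ w) ≡ + r *ℤ e f
    Σ-κ {f} od = ℤP.*-cancelˡ-≡ (+ q) _ _ (begin
      + q *ℤ S ≡⟨ cong (_*ℤ S) (sym Σ-K) ⟩
      ΣF K *ℤ S ≡⟨ ℤP.*-comm _ S ⟩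
      S *ℤ ΣF K ≡⟨ sym (∑-*ˡ elems S K) ⟩
      ΣF (λ c → S *ℤ K c) ≡⟨ ∑-cong elems (λ c → trans (ℤP.*-comm S (K c)) (trans (cong (K c *ℤ_) (sym (Σ-translate c _))) (sym (∑-*ˡ elems (K c) _)))) ⟩
      ΣF (λ c → ΣF (λ w → K c *ℤ (f (w + c) *ℤ κ (w + c)))) ≡⟨ ∑-swap elems elems _ ⟩
      ΣF (λ w → ΣK (λ c → f (w + c) *ℤ κ (w + c))) ≡⟨ ∑-cong elems coset ⟩
      ΣF (λ w → e f *ℤ (+ 1 -ℤ K w)) ≡⟨ ∑-*ˡ elems (e f) _ ⟩
      e f *ℤ ΣF (λ w → + 1 -ℤ K w) ≡⟨ cong (e f *ℤ_) count ⟩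
      e f *ℤ (+ q *ℤ + q *ℤ + 1 -ℤ + q) ≡⟨ final (e f) (+ r) ⟩
      + q *ℤ (+ r *ℤ e f)  ∎)
      where
      open ≡-Reasoning
      S = ΣF (λ w → f w *ℤ κ w)
      final : ∀ e r → e *ℤ ((+ 1 +ℤ r) *ℤ (+ 1 +ℤ r) *ℤ + 1 -ℤ (+ 1 +ℤ r)) ≡ (+ 1 +ℤ r) *ℤ (r *ℤ e)
      final = solve-∀
      rearr : ∀ k e → (k *ℤ k) *ℤ e ≡ e *ℤ (k *ℤ k)
      rearr = solve-∀
      exch : ∀ a b k → a *ℤ (b *ℤ k) ≡ k *ℤ (a *ℤ b)
      exch = solve-∀
      coset : ∀ w → ΣK (λ c → f (w + c) *ℤ κ (w + c)) ≡ e f *ℤ (+ 1 -ℤ K w)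
      coset w = begin
        ΣK (λ c → f (w + c) *ℤ κ (w + c)) ≡⟨ ΣK-cong (λ c c∈K → cong (f (w + c) *ℤ_) (κ-translate c∈K w)) ⟩
        ΣK (λ c → f (w + c) *ℤ κ w) ≡⟨ trans (∑-cong elems (λ c → exch (K c) (f (w + c)) (κ w))) (∑-*ˡ elems (κ w) _) ⟩
        κ w *ℤ π f w ≡⟨ cong (κ w *ℤ_) (π≡κe od w) ⟩
        κ w *ℤ (κ w *ℤ e f) ≡⟨ sym (ℤP.*-assoc (κ w) (κ w) (e f)) ⟩
        (κ w *ℤ κ w) *ℤ e f ≡⟨ rearr (κ w) (e f) ⟩
        e f *ℤ (κ w *ℤ κ w) ≡⟨ cong (e f *ℤ_) (κ² w) ⟩
        e f *ℤ (+ 1 -ℤ K w)  ∎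
      count : ΣF (λ w → + 1 -ℤ K w) ≡ + q *ℤ + q *ℤ + 1 -ℤ + q
      count = trans (∑-+ elems (λ _ → + 1) (λ w → -ℤ K w)) (cong₂ _+ℤ_ (Σ-const (+ 1))
        (trans (∑-neg elems K) (cong -ℤ_ Σ-K)))

    -- N changes the sign of both factors, so the correlation is even and its sum over K is the
    -- value at 0 plus r times the value at 1. The same sum is evaluated by `ΣK-Corr` and `Σ-κ`.
    Corr-odd-1 : ∀ {f g} → Odd f → Odd g → ΣF (λ h → f h *ℤ g h) +ℤ + r *ℤ Corr f g 1# ≡ + r *ℤ (e f *ℤ e g)
    Corr-odd-1 {f} {g} of og = begin
      ΣF (λ h → f h *ℤ g h) +ℤ + r *ℤ Corr f g 1# ≡⟨ cong (_+ℤ (+ r *ℤ Corr f g 1#)) (sym (Corr-0 f g)) ⟩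
      Corr f g 0# +ℤ + r *ℤ Corr f g 1# ≡⟨ sym (ΣK-even (Corr f g) (Corr-odd of og)) ⟩
      ΣK (Corr f g) ≡⟨ ΣK-Corr f g ⟩
      ΣF (λ h → f h *ℤ π g h) ≡⟨ ∑-cong elems (λ h → trans (cong (f h *ℤ_) (π≡κe og h)) (exch (f h) (κ h) (e g))) ⟩
      ΣF (λ h → e g *ℤ (f h *ℤ κ h)) ≡⟨ ∑-*ˡ elems (e g) _ ⟩
      e g *ℤ ΣF (λ h → f h *ℤ κ h) ≡⟨ cong (e g *ℤ_) (Σ-κ of) ⟩
      e g *ℤ (+ r *ℤ e f) ≡⟨ final (e g) (+ r) (e f) ⟩
      + r *ℤ (e f *ℤ e g)  ∎
      where
      open ≡-Reasoning
      exch : ∀ a b c → a *ℤ (b *ℤ c) ≡ c *ℤ (a *ℤ b)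
      exch = solve-∀
      final : ∀ a r b → a *ℤ (r *ℤ b) ≡ r *ℤ (b *ℤ a)
      final = solve-∀

  π-Even : ∀ {g} → Even g → g 0# ≡ + 0 → ∀ x → π g x ≡ π g ω +ℤ K x *ℤ (+ r *ℤ g 1# -ℤ π g ω)
  π-Even {g} ev g0 x = go (position x)
    where
    fin : ∀ b a → a ≡ b +ℤ + 1 *ℤ (a -ℤ b)
    fin = solve-∀
    πg0 : π g 0# ≡ + r *ℤ g 1#
    πg0 = trans (∑-cong elems (λ c → cong (λ z → K c *ℤ g z) (+-identityˡ c)))
            (trans (ΣK-even g ev) (trans (cong (_+ℤ (+ r *ℤ g 1#)) g0) (ℤP.+-identityˡ _)))
    at : ∀ {k} → K x ≡ k → π g ω +ℤ k *ℤ (+ r *ℤ g 1# -ℤ π g ω) ≡ π g ω +ℤ K x *ℤ (+ r *ℤ g 1# -ℤ π g ω)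
    at e = cong (λ k → π g ω +ℤ k *ℤ (+ r *ℤ g 1# -ℤ π g ω)) (sym e)
    go : Position x → π g x ≡ π g ω +ℤ K x *ℤ (+ r *ℤ g 1# -ℤ π g ω)
    go (inside x∈K _) = trans (π-inside g x∈K) (trans πg0 (trans (fin (π g ω) _) (at (K≡1 x∈K))))
    go (outside t c x∉K c∈K _ ex) = trans (π-outside g t c∈K ex) (trans (Even-pow {π g} (π-even ev) t ω)
      (trans (sym (ℤP.+-identityʳ _)) (at (K≡0 x∉K))))

  Σ-π : ∀ g → ΣF (π g) ≡ + q *ℤ ΣF g
  Σ-π g = begin
    ΣF (λ x → ΣF (λ c → K c *ℤ g (x + c))) ≡⟨ ∑-swap elems elems _ ⟩
    ΣF (λ c → ΣF (λ x → K c *ℤ g (x + c))) ≡⟨ ∑-cong elems (λ c → trans (∑-*ˡ elems (K c) _) (trans (cong (K c *ℤ_) (Σ-translate c g)) (ℤP.*-comm (K c) _))) ⟩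
    ΣF (λ c → ΣF g *ℤ K c) ≡⟨ ∑-*ˡ elems (ΣF g) K ⟩
    ΣF g *ℤ ΣF K ≡⟨ trans (cong (ΣF g *ℤ_) Σ-K) (ℤP.*-comm (ΣF g) (+ q)) ⟩
    + q *ℤ ΣF g  ∎
    where open ≡-Reasoning

  -- B adds up one value of g for each of the q + 1 lines. A coset of K other than K itself meets
  -- every line except K exactly once, whence B - `g 1#`. The proof reads this off the total of all
  -- coset sums.
  π-ω-Even : ∀ {g} → Even g → g 0# ≡ + 0 → ∀ B → ΣF g ≡ + r *ℤ B → π g ω ≡ B -ℤ g 1#
  π-ω-Even {g} ev g0 B eB = ℤP.*-cancelˡ-≡ (+ r) _ _ (ℤP.*-cancelˡ-≡ (+ q) _ _ (begin
      + q *ℤ (+ r *ℤ β) ≡⟨ f1 (+ r) β (g 1#) ⟩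
      (+ q *ℤ + q *ℤ β +ℤ (+ r *ℤ g 1# -ℤ β) *ℤ + q) -ℤ + q *ℤ (+ r *ℤ g 1#) ≡⟨ cong (_-ℤ (+ q *ℤ (+ r *ℤ g 1#))) (trans (sym total) (trans (Σ-π g) (cong (+ q *ℤ_) eB))) ⟩
      + q *ℤ (+ r *ℤ B) -ℤ + q *ℤ (+ r *ℤ g 1#) ≡⟨ f2 (+ q) (+ r) B (g 1#) ⟩
      + q *ℤ (+ r *ℤ (B -ℤ g 1#))  ∎))
    where
    open ≡-Reasoning
    β = π g ω
    f1 : ∀ r β g → (+ 1 +ℤ r) *ℤ (r *ℤ β) ≡ ((+ 1 +ℤ r) *ℤ (+ 1 +ℤ r) *ℤ β +ℤ (r *ℤ g -ℤ β) *ℤ (+ 1 +ℤ r)) -ℤ (+ 1 +ℤ r) *ℤ (r *ℤ g)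
    f1 = solve-∀
    f2 : ∀ q r B g → q *ℤ (r *ℤ B) -ℤ q *ℤ (r *ℤ g) ≡ q *ℤ (r *ℤ (B -ℤ g))
    f2 = solve-∀
    total : ΣF (π g) ≡ + q *ℤ + q *ℤ β +ℤ (+ r *ℤ g 1# -ℤ β) *ℤ + q
    total = trans (∑-cong elems (λ x → trans (π-Even ev g0 x) (cong (β +ℤ_) (ℤP.*-comm (K x) _))))
      (trans (∑-+ elems (λ _ → β) (λ x → (+ r *ℤ g 1# -ℤ β) *ℤ K x))
        (cong₂ _+ℤ_ (Σ-const β) (trans (∑-*ˡ elems (+ r *ℤ g 1# -ℤ β) K) (cong ((+ r *ℤ g 1# -ℤ β) *ℤ_) Σ-K))))

  -- The coset sums of g are one constant plus a multiple of the indicator of K, so pairing them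
  -- with f needs only the sums of f over the field and over K.
  Corr-even-1 : ∀ {f g} → Even f → Even g → f 0# ≡ + 0 → g 0# ≡ + 0 →
    ∀ A B → ΣF f ≡ + r *ℤ A → ΣF g ≡ + r *ℤ B →
    ΣF (λ h → f h *ℤ g h) +ℤ + r *ℤ Corr f g 1# ≡ + r *ℤ ((B -ℤ g 1#) *ℤ A +ℤ (+ q *ℤ g 1# -ℤ B) *ℤ f 1#)
  Corr-even-1 {f} {g} ef eg f0 g0 A B eA eB = begin
    ΣF (λ h → f h *ℤ g h) +ℤ + r *ℤ Corr f g 1# ≡⟨ cong (_+ℤ (+ r *ℤ Corr f g 1#)) (sym (Corr-0 f g)) ⟩
    Corr f g 0# +ℤ + r *ℤ Corr f g 1# ≡⟨ sym (ΣK-even (Corr f g) (Corr-even ef eg)) ⟩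
    ΣK (Corr f g) ≡⟨ ΣK-Corr f g ⟩
    ΣF (λ h → f h *ℤ π g h) ≡⟨ ∑-cong elems (λ h → trans (cong (f h *ℤ_) (π-Even eg g0 h)) (exch (f h) β (K h) γ)) ⟩
    ΣF (λ h → β *ℤ f h +ℤ γ *ℤ (K h *ℤ f h)) ≡⟨ trans (∑-+ elems _ _) (cong₂ _+ℤ_ (∑-*ˡ elems β f) (∑-*ˡ elems γ _)) ⟩
    β *ℤ ΣF f +ℤ γ *ℤ ΣK f ≡⟨ cong₂ (λ a b → β *ℤ a +ℤ γ *ℤ b) eA (trans (ΣK-even f ef) (trans (cong (_+ℤ (+ r *ℤ f 1#)) f0) (ℤP.+-identityˡ _))) ⟩
    β *ℤ (+ r *ℤ A) +ℤ γ *ℤ (+ r *ℤ f 1#) ≡⟨ cong (λ b → b *ℤ (+ r *ℤ A) +ℤ (+ r *ℤ g 1# -ℤ b) *ℤ (+ r *ℤ f 1#)) (π-ω-Even eg g0 B eB) ⟩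
    (B -ℤ g 1#) *ℤ (+ r *ℤ A) +ℤ (+ r *ℤ g 1# -ℤ (B -ℤ g 1#)) *ℤ (+ r *ℤ f 1#) ≡⟨ final (+ r) A B (f 1#) (g 1#) ⟩
    + r *ℤ ((B -ℤ g 1#) *ℤ A +ℤ (+ q *ℤ g 1# -ℤ B) *ℤ f 1#) ∎
    where
    open ≡-Reasoning
    β = π g ω
    γ = + r *ℤ g 1# -ℤ β
    exch : ∀ f β k γ → f *ℤ (β +ℤ k *ℤ γ) ≡ β *ℤ f +ℤ γ *ℤ (k *ℤ f)
    exch = solve-∀
    final : ∀ r A B f g → (B -ℤ g) *ℤ (r *ℤ A) +ℤ (r *ℤ g -ℤ (B -ℤ g)) *ℤ (r *ℤ f) ≡ r *ℤ ((B -ℤ g) *ℤ A +ℤ ((+ 1 +ℤ r) *ℤ g -ℤ B) *ℤ f)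
    final = solve-∀

  -- Cyclotomic classes in terms of the discrete logarithm

  open Cyclotomy F ω public

  -- Multiplication by ω^s, with recursion arranged so that `act (suc s) x` reduces to
  -- `act s (ω * x)`. The rotation of signed classes in `Γ-ω` holds by this reduction.
  act : ℕ → Carrier → Carrier
  act zero    x = x
  act (suc s) x = act s (ω * x)

  act≡ : ∀ s x → act s x ≡ pow ω s * x
  act≡ zero    x = sym (*-identityˡ x)
  act≡ (suc s) x = trans (act≡ s (ω * x)) (trans (sym (*-assoc _ ω x)) (cong (_* x) (*-comm _ ω)))

  act-0 : ∀ s → act s 0# ≡ 0#
  act-0 s = trans (act≡ s 0#) (zeroʳ _)

  act-pow : ∀ s j → act s (pow ω j) ≡ pow ω (s ℕ.+ j)
  act-pow s j = trans (act≡ s _) (sym (pow-+ ω s j))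

  pred-order : ℕ.pred order ≡ M
  pred-order = cong ℕ.pred order≡

  Cyc-0 : ∀ n .{{_ : NonZero n}} i → Cyc n i 0# ≡ false
  Cyc-0 n i = any-false _ (upTo (ℕ.pred order)) (λ j _ → cong (_∧ _) (dec-false (pow ω j ≟ 0#) (pow-nonzero j ω≢0)))

  Cyc-pow : ∀ n .{{_ : NonZero n}} → n ∣ M → ∀ i j → Cyc n i (pow ω j) ≡ ((j % n) ≡ᵇ (i % n))
  Cyc-pow n n∣M i j = go ((j % n) ≡ᵇ (i % n)) refl
    where
    P : ℕ → Bool
    P j′ = does (pow ω j′ ≟ pow ω j) ∧ ((j′ % n) ≡ᵇ (i % n))
    j% : (j % M) % n ≡ j % n
    j% = m∣n⇒o%n%m≡o%m n M j n∣M
    go : ∀ b → ((j % n) ≡ᵇ (i % n)) ≡ b → any P (upTo (ℕ.pred order)) ≡ b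
    go true  e = any-true P {j % M} (∈-upTo⁺ (subst (j % M ℕ.<_) (sym pred-order) (m%n<n j M)))
      (trans (cong (_∧ (((j % M) % n) ≡ᵇ (i % n))) (dec-true (pow ω (j % M) ≟ pow ω j) (sym (pow-% j)))) (trans (cong (_≡ᵇ (i % n)) j%) e))
    go false e = any-false P _ none
      where
      none : ∀ j′ → j′ ∈ upTo (ℕ.pred order) → P j′ ≡ false
      none j′ j′∈ = equal (pow ω j′ ≟ pow ω j)
        where
        j′≡ : pow ω j′ ≡ pow ω j → j′ ≡ j % M
        j′≡ e′ = trans (sym (m<n⇒m%n≡m (subst (j′ ℕ.<_) pred-order (∈-upTo⁻ j′∈)))) (pow-inj-% j′ j e′)
        equal : (d : Dec (pow ω j′ ≡ pow ω j)) → (does d ∧ ((j′ % n) ≡ᵇ (i % n))) ≡ false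
        equal (no _)   = refl
        equal (yes e′) = trans (cong (_≡ᵇ (i % n)) (trans (cong (_% n) (j′≡ e′)) j%)) e

  -- These are (q + 1) / 4, the number of lines in a quartic class; (q - 1) / 2, which is odd; and
  -- (q² - 1) / 8, the size of an octic class.
  n h o : ℕ
  n = 2 ℕ.* m ℕ.+ 1
  h = 4 ℕ.* m ℕ.+ 1
  o = h ℕ.* n

  M≡o*8 : M ≡ o ℕ.* 8
  M≡o*8 rewrite r≡ = arith m
    where
    arith : ∀ m → (8 ℕ.* m ℕ.+ 2) ℕ.+ (8 ℕ.* m ℕ.+ 2) ℕ.* suc (8 ℕ.* m ℕ.+ 2) ≡ (4 ℕ.* m ℕ.+ 1) ℕ.* (2 ℕ.* m ℕ.+ 1) ℕ.* 8
    arith = ℕR.solve-∀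

  q+1≡ : suc q ≡ 4 ℕ.+ m ℕ.* 8
  q+1≡ rewrite r≡ = arith m
    where
    arith : ∀ m → suc (suc (8 ℕ.* m ℕ.+ 2)) ≡ 4 ℕ.+ m ℕ.* 8
    arith = ℕR.solve-∀

  [q+1]≡4n : suc q ≡ 4 ℕ.* n
  [q+1]≡4n = trans q+1≡ (arith m)
    where
    arith : ∀ m → 4 ℕ.+ m ℕ.* 8 ≡ 4 ℕ.* (2 ℕ.* m ℕ.+ 1)
    arith = ℕR.solve-∀

  r≡2h : r ≡ h ℕ.+ h
  r≡2h rewrite r≡ = arith m
    where
    arith : ∀ m → 8 ℕ.* m ℕ.+ 2 ≡ (4 ℕ.* m ℕ.+ 1) ℕ.+ (4 ℕ.* m ℕ.+ 1)
    arith = ℕR.solve-∀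

  half : ℕ
  half = h ℕ.* suc q

  M≡half+half : M ≡ half ℕ.+ half
  M≡half+half = trans M≡r*[q+1] (trans (cong (ℕ._* suc q) r≡2h) (ℕP.*-distribʳ-+ (suc q) h h))

  -- The residue 4 makes -1 act on octic classes exactly as N does.
  half≡ : ∃ λ t → half ≡ 4 ℕ.+ t ℕ.* 8
  half≡ = 4 ℕ.* m ℕ.* m ℕ.+ 3 ℕ.* m , trans (cong (h ℕ.*_) q+1≡) (arith m)
    where
    arith : ∀ m → (4 ℕ.* m ℕ.+ 1) ℕ.* (4 ℕ.+ m ℕ.* 8) ≡ 4 ℕ.+ (4 ℕ.* m ℕ.* m ℕ.+ 3 ℕ.* m) ℕ.* 8
    arith = ℕR.solve-∀

  pow-half : pow ω half ≡ - 1#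
  pow-half = neg-unique 1# (pow ω half) (*-cancelˡ (pow ω half - 1#) (λ z → half≢0 (sub≡0⇒≡ _ _ z)) (trans factored (sym (zeroʳ _))))
    where
    open ≡-Reasoning
    half>0 : 0 ℕ.< half
    half>0 = subst (0 ℕ.<_) (sym (proj₂ half≡)) (s≤s z≤n)
    half≢0 : pow ω half ≢ 1#
    half≢0 e = ℕP.<⇒≱ (subst (half ℕ.<_) (sym M≡half+half) (ℕP.m<m+n half half>0)) (period≥ half half>0 e)
    square : pow ω half * pow ω half ≡ 1#
    square = trans (sym (pow-+ ω half half)) (trans (cong (pow ω) (sym M≡half+half)) pow-M)
    factored : (pow ω half - 1#) * (1# + pow ω half) ≡ 0#
    factored = begin
      (z - 1#) * (1# + z) ≡⟨ distribʳ (1# + z) z (- 1#) ⟩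
      z * (1# + z) + - 1# * (1# + z) ≡⟨ cong₂ _+_ (trans (distribˡ z 1# z) (cong₂ _+_ (*-identityʳ z) square)) (trans (sym (-‿distribˡ-* 1# _)) (cong -_ (*-identityˡ _))) ⟩
      (z + 1#) - (1# + z) ≡⟨ cong (λ w → w - (1# + z)) (+-comm z 1#) ⟩
      (1# + z) - (1# + z) ≡⟨ -‿inverseʳ _ ⟩
      0#  ∎
      where z = pow ω half

  neg≡ : ∀ x → - x ≡ pow ω half * x
  neg≡ x = trans (cong -_ (sym (*-identityˡ x))) (trans (-‿distribˡ-* 1# x) (cong (_* x) (sym pow-half)))

  Even-neg : ∀ {f} → Even f → ∀ x → f (- x) ≡ f x
  Even-neg {f} ev x = trans (cong f (trans (neg≡ x) (cong (_* x) (pow-N h)))) (Even-pow {f} ev h x)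

  -- Functions of the discrete logarithm modulo 8

  record HasTable (f : Carrier → ℤ) (v : ℕ → ℤ) : Set where
    constructor table
    field
      at-0   : f 0# ≡ + 0
      at-pow : ∀ i t → f (pow ω (i ℕ.+ t ℕ.* 8)) ≡ v i
  open HasTable public

  Agree8 : (ℕ → ℤ) → (ℕ → ℤ) → Set
  Agree8 v w = v 0 ≡ w 0 × v 1 ≡ w 1 × v 2 ≡ w 2 × v 3 ≡ w 3 × v 4 ≡ w 4 × v 5 ≡ w 5 × v 6 ≡ w 6 × v 7 ≡ w 7

  residue : ∀ x → x ≢ 0# → ∃ λ i → ∃ λ t → i ℕ.< 8 × x ≡ pow ω (i ℕ.+ t ℕ.* 8)
  residue x nz with log x nz
  ... | j , _ , e = j % 8 , j / 8 , m%n<n j 8 , trans (sym e) (cong (pow ω) (m≡m%n+[m/n]*n j 8))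

  residue-induction : (P : Carrier → Set) → P 0# → (∀ i t → i ℕ.< 8 → P (pow ω (i ℕ.+ t ℕ.* 8))) → ∀ x → P x
  residue-induction P p0 pi x = go (x ≟ 0#)
    where
    go : Dec (x ≡ 0#) → P x
    go (yes z) = subst P (sym z) p0
    go (no nz) = go′ (residue x nz)
      where
      go′ : (∃ λ i → ∃ λ t → i ℕ.< 8 × x ≡ pow ω (i ℕ.+ t ℕ.* 8)) → P x
      go′ (i , t , i<8 , e) = subst P (sym e) (pi i t i<8)

  table-≗ : ∀ {f g v w} → HasTable f v → HasTable g w → Agree8 v w → ∀ x → f x ≡ g x
  table-≗ {v = v} {w} (table f0 fp) (table g0 gp) ag = residue-induction _ (trans f0 (sym g0))
    (λ i t i<8 → trans (fp i t) (trans (below8 (λ i → v i ≡ w i) ag i i<8) (sym (gp i t))))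

  table-cong : ∀ {f g v} → (∀ x → f x ≡ g x) → HasTable f v → HasTable g v
  table-cong e (table f0 fp) = table (trans (sym (e _)) f0) (λ i t → trans (sym (e _)) (fp i t))

  table-+ : ∀ {f g v w} → HasTable f v → HasTable g w → HasTable (λ x → f x +ℤ g x) (λ i → v i +ℤ w i)
  table-+ (table f0 fp) (table g0 gp) = table (cong₂ _+ℤ_ f0 g0) (λ i t → cong₂ _+ℤ_ (fp i t) (gp i t))

  table-- : ∀ {f g v w} → HasTable f v → HasTable g w → HasTable (λ x → f x -ℤ g x) (λ i → v i -ℤ w i)
  table-- (table f0 fp) (table g0 gp) = table (cong₂ _-ℤ_ f0 g0) (λ i t → cong₂ _-ℤ_ (fp i t) (gp i t))

  table-* : ∀ {f g v w} → HasTable f v → HasTable g w → HasTable (λ x → f x *ℤ g x) (λ i → v i *ℤ w i)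
  table-* (table f0 fp) (table g0 gp) = table (cong₂ _*ℤ_ f0 g0) (λ i t → cong₂ _*ℤ_ (fp i t) (gp i t))

  table-*ˡ : ∀ s {f v} → HasTable f v → HasTable (λ x → s *ℤ f x) (λ i → s *ℤ v i)
  table-*ˡ s (table f0 fp) = table (trans (cong (s *ℤ_) f0) (ℤP.*-zeroʳ s)) (λ i t → cong (s *ℤ_) (fp i t))

  table-act : ∀ s {f v} → HasTable f v → HasTable (f ∘ act s) (λ i → v (s ℕ.+ i))
  table-act s {f} (table f0 fp) = table (trans (cong f (act-0 s)) f0)
    (λ i t → trans (cong f (trans (act-pow s _) (cong (pow ω) (sym (ℕP.+-assoc s i (t ℕ.* 8)))))) (fp (s ℕ.+ i) t))

  mul-table : ∀ {f v} → HasTable f v → ∀ s t → HasTable (λ x → f (pow ω (s ℕ.+ t ℕ.* 8) * x)) (λ i → v (s ℕ.+ i))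
  mul-table {f} (table f0 fp) s t = table (trans (cong f (zeroʳ _)) f0)
    (λ i t′ → trans (cong f (trans (sym (pow-+ ω (s ℕ.+ t ℕ.* 8) (i ℕ.+ t′ ℕ.* 8))) (cong (pow ω) (arith s t i t′)))) (fp (s ℕ.+ i) (t ℕ.+ t′)))
    where
    arith : ∀ s t i t′ → (s ℕ.+ t ℕ.* 8) ℕ.+ (i ℕ.+ t′ ℕ.* 8) ≡ (s ℕ.+ i) ℕ.+ (t ℕ.+ t′) ℕ.* 8
    arith = ℕR.solve-∀

  pow-table : ∀ {f v} → HasTable f v → ∀ c d → 0 ℕ.< c → HasTable (λ x → f (pow x (c ℕ.+ d ℕ.* 8))) (λ i → v (c ℕ.* i))
  pow-table {f} (table f0 fp) c d 0<c = table (trans (cong f (pow-0# _ (ℕP.≤-trans 0<c (ℕP.m≤m+n c _)))) f0)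
    (λ i t → trans (cong f (trans (sym (pow-* ω (c ℕ.+ d ℕ.* 8) (i ℕ.+ t ℕ.* 8))) (cong (pow ω) (arith c d i t)))) (fp (c ℕ.* i) (c ℕ.* t ℕ.+ d ℕ.* (i ℕ.+ t ℕ.* 8))))
    where
    arith : ∀ c d i t → (c ℕ.+ d ℕ.* 8) ℕ.* (i ℕ.+ t ℕ.* 8) ≡ c ℕ.* i ℕ.+ (c ℕ.* t ℕ.+ d ℕ.* (i ℕ.+ t ℕ.* 8)) ℕ.* 8
    arith = ℕR.solve-∀

  N-table : ∀ {f v} → HasTable f v → HasTable (λ x → f (N * x)) (λ i → v (4 ℕ.+ i))
  N-table {f} {v} tf = subst (λ j → HasTable (λ x → f (pow ω j * x)) (λ i → v (4 ℕ.+ i))) (sym q+1≡) (mul-table tf 4 m)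

  neg-table : ∀ {f v} → HasTable f v → HasTable (λ x → f (- x)) (λ i → v (4 ℕ.+ i))
  neg-table {f} {v} tf = table-cong (λ x → cong f (sym (neg≡ x)))
    (subst (λ j → HasTable (λ x → f (pow ω j * x)) (λ i → v (4 ℕ.+ i))) (sym (proj₂ half≡)) (mul-table tf 4 (proj₁ half≡)))

  table-Σ : ∀ {f v} → HasTable f v → ΣF f ≡ + o *ℤ ∑< 8 v
  table-Σ {f} {v} (table f0 fp) = trans (Σ-pow f) (trans (cong₂ _+ℤ_ f0 (trans (cong (λ M → ∑< M (f ∘ pow ω)) M≡o*8)
    (trans (∑<-periodic 8 o (f ∘ pow ω) (λ i t → trans (fp i t) (sym (at i))))
      (cong (+ o *ℤ_) (∑<-cong 8 at))))) (ℤP.+-identityˡ _))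
    where
    at : ∀ i → f (pow ω i) ≡ v i
    at i = trans (cong (f ∘ pow ω) (sym (ℕP.+-identityʳ i))) (fp i 0)

  8∣M : 8 ∣ M
  8∣M = divides o M≡o*8

  4∣M : 4 ∣ M
  4∣M = divides (o ℕ.* 2) (trans M≡o*8 (sym (ℕP.*-assoc o 2 4)))

  cyc8-table : ∀ i → HasTable (𝟙 ∘ Cyc 8 i) (λ j → 𝟙 ((j % 8) ≡ᵇ (i % 8)))
  cyc8-table i = table (cong 𝟙 (Cyc-0 8 i)) (λ j t → cong 𝟙 (trans (Cyc-pow 8 8∣M i (j ℕ.+ t ℕ.* 8)) (cong (_≡ᵇ (i % 8)) ([m+kn]%n≡m%n j t 8))))

  cyc4-table : ∀ i → HasTable (𝟙 ∘ Cyc 4 i) (λ j → 𝟙 ((j % 4) ≡ᵇ (i % 4)))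
  cyc4-table i = table (cong 𝟙 (Cyc-0 4 i)) (λ j t → cong 𝟙 (trans (Cyc-pow 4 4∣M i (j ℕ.+ t ℕ.* 8))
    (cong (_≡ᵇ (i % 4)) (trans (cong (λ z → (j ℕ.+ z) % 4) (sym (ℕP.*-assoc t 2 4))) ([m+kn]%n≡m%n j (t ℕ.* 2) 4)))))

  v-η : ℕ → ℤ
  v-η j = 𝟙 ((j % 8) ≡ᵇ 0) -ℤ 𝟙 ((j % 8) ≡ᵇ 4)

  η : Carrier → ℤ
  η x = 𝟙 (Cyc 8 0 x) -ℤ 𝟙 (Cyc 8 4 x)

  η-table : HasTable η v-η
  η-table = table-- (cyc8-table 0) (cyc8-table 4)

  neg-val : ∀ {f v} → HasTable f v → HasTable (λ x → -ℤ f x) (λ i → -ℤ v i)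
  neg-val (table f0 fp) = table (cong -ℤ_ f0) (λ i t → cong -ℤ_ (fp i t))

  table-Odd : ∀ {f v} → HasTable f v → Agree8 (λ i → v (4 ℕ.+ i)) (λ i → -ℤ v i) → Odd f
  table-Odd tf = table-≗ (N-table tf) (neg-val tf)

  table-Even : ∀ {f v} → HasTable f v → Agree8 (λ i → v (4 ℕ.+ i)) v → Even f
  table-Even tf = table-≗ (N-table tf) tf

  η-odd : Odd η
  η-odd = table-Odd η-table all≡

  open OddFunctions η η-odd (at-0 η-table) (at-pow η-table 0 0) public

  -- The invariants u and v of the signed octic classes

  e-cong : ∀ {f g} → (∀ x → f x ≡ g x) → e f ≡ e g
  e-cong eq = π-cong eq ω

  κ-φ : ∀ x → κ (φ x) ≡ -ℤ κ x
  κ-φ x = trans (cong η (δ-φ x)) (table-≗ (neg-table η-table) (neg-val η-table) all≡ (δ x))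

  q≡ : q ≡ 3 ℕ.+ m ℕ.* 8
  q≡ = ℕP.suc-injective q+1≡

  φ-table : ∀ {f v} → HasTable f v → HasTable (f ∘ φ) (λ i → v (3 ℕ.* i))
  φ-table {f} {v} tf = subst (λ j → HasTable (λ x → f (pow x j)) (λ i → v (3 ℕ.* i))) (sym q≡) (pow-table tf 3 m (s≤s z≤n))

  -- φ maps ω + K to φ ω + K, whose coordinate along ω is -1, and η takes the value -1 there because
  -- -1 is a nonsquare of K.
  e-φ : ∀ {f} → Odd f → e (f ∘ φ) ≡ -ℤ e f
  e-φ {f} od = trans (ΣK-cong (λ c c∈K → cong f (trans (φ-+ ω c) (cong (_+_ (φ ω)) c∈K))))
    (trans (π≡κe od (φ ω)) (trans (cong (_*ℤ e f) (trans (κ-φ ω) (cong -ℤ_ (trans (cong η δ-ω) (at-pow η-table 0 0))))) (ℤP.-1*i≡-i (e f))))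

  -- Indices are negated: ηs s is the class of index −s minus the class of index 4 − s.
  ηs : ℕ → Carrier → ℤ
  ηs s = η ∘ act s

  ηs-table : ∀ s → HasTable (ηs s) (λ i → v-η (s ℕ.+ i))
  ηs-table s = table-act s η-table

  N-comm-act : ∀ s x → N * act s x ≡ act s (N * x)
  N-comm-act s x = trans (cong (N *_) (act≡ s x)) (trans (trans (sym (*-assoc N _ x)) (trans (cong (_* x) (*-comm N _)) (*-assoc _ N x))) (sym (act≡ s (N * x))))

  act-Odd : ∀ s {f} → Odd f → Odd (f ∘ act s)
  act-Odd s {f} od x = trans (cong f (sym (N-comm-act s x))) (od (act s x))

  mul-Odd : ∀ u {f} → Odd f → Odd (f ∘ (u *_))
  mul-Odd u {f} od x = trans (cong f (trans (sym (*-assoc u N x)) (trans (cong (_* x) (*-comm u N)) (*-assoc N u x)))) (od (u * x))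

  mul-Even : ∀ u {f} → Even f → Even (f ∘ (u *_))
  mul-Even u {f} od x = trans (cong f (trans (sym (*-assoc u N x)) (trans (cong (_* x) (*-comm u N)) (*-assoc N u x)))) (od (u * x))

  ηs-odd : ∀ s → Odd (ηs s)
  ηs-odd s = act-Odd s η-odd

  E : ℕ → ℤ
  E s = e (ηs s)

  -- Since q ≡ 3 modulo 8, composition with φ triples the index of a table. It fixes `ηs 0` and
  -- turns `ηs 1` into `ηs 3`; compared with `e-φ`, this leaves only `E 1` and `E 2` free.
  E0≡0 : E 0 ≡ + 0
  E0≡0 = i≡-i⇒i≡0 _ (trans (e-cong (table-≗ η-table (φ-table η-table) all≡)) (e-φ η-odd))

  E3≡-E1 : E 3 ≡ -ℤ E 1
  E3≡-E1 = trans (e-cong (table-≗ (ηs-table 3) (φ-table (ηs-table 1)) all≡)) (e-φ (ηs-odd 1))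

  e-+ : ∀ f g → e (λ x → f x +ℤ g x) ≡ e f +ℤ e g
  e-+ f g = π-+ f g ω

  e-neg : ∀ f → e (λ x → -ℤ f x) ≡ -ℤ e f
  e-neg f = π-neg f ω

  E5 : E 5 ≡ -ℤ E 1
  E5 = trans (e-cong (table-≗ (ηs-table 5) (neg-val (ηs-table 1)) all≡)) (e-neg (ηs 1))
  E6 : E 6 ≡ -ℤ E 2
  E6 = trans (e-cong (table-≗ (ηs-table 6) (neg-val (ηs-table 2)) all≡)) (e-neg (ηs 2))
  E7 : E 7 ≡ E 1
  E7 = trans (e-cong (table-≗ (ηs-table 7) (neg-val (ηs-table 3)) all≡))
         (trans (e-neg (ηs 3)) (trans (cong -ℤ_ E3≡-E1) (ℤP.neg-involutive (E 1))))

  -- Up to a unit, u − v √-2 is the Eisenstein sum over K of a character of order 8.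
  u v : ℤ
  u = -ℤ E 2
  v = E 1

  table-odd : ∀ {f w} → HasTable f w → Odd f → ∀ i → w (4 ℕ.+ i) ≡ -ℤ w i
  table-odd {f} tf od i = trans (sym (at-pow (N-table tf) i 0)) (trans (od _) (cong -ℤ_ (at-pow tf i 0)))

  ev : (ℕ → ℤ) → ℤ
  ev w = (w 1 -ℤ w 3) *ℤ v +ℤ w 2 *ℤ u

  e-table : ∀ {f w} → HasTable f w → Odd f → e f ≡ ev w
  e-table {f} {w} tf od = begin
    -- The functions `ηs 0`, `ηs 7`, `ηs 6`, `ηs 5` are the signed classes of index 0, 1, 2, 3, and
    -- an odd table is determined by its entries at these indices.
    e f ≡⟨ e-cong (table-≗ tf expansion (agree od′)) ⟩
    e (λ x → S₂ x +ℤ s 3 5 x) ≡⟨ trans (e-+ S₂ (s 3 5)) (cong₂ _+ℤ_ (trans (e-+ S₁ (s 2 6)) (cong₂ _+ℤ_ (trans (e-+ (s 0 0) (s 1 7))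
        (cong₂ _+ℤ_ (lin 0 0) (lin 1 7))) (lin 2 6))) (lin 3 5)) ⟩
    w 0 *ℤ E 0 +ℤ w 1 *ℤ E 7 +ℤ w 2 *ℤ E 6 +ℤ w 3 *ℤ E 5
      ≡⟨ cong₂ _+ℤ_ (cong₂ _+ℤ_ (cong₂ _+ℤ_ (cong (w 0 *ℤ_) E0≡0) (cong (w 1 *ℤ_) E7)) (cong (w 2 *ℤ_) E6)) (cong (w 3 *ℤ_) E5) ⟩
    w 0 *ℤ + 0 +ℤ w 1 *ℤ v +ℤ w 2 *ℤ u +ℤ w 3 *ℤ -ℤ v ≡⟨ collect (w 0) (w 1) (w 2) (w 3) v u ⟩
    ev w  ∎
    where
    open ≡-Reasoning
    s : ℕ → ℕ → Carrier → ℤ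
    s i j x = w i *ℤ ηs j x
    S₁ S₂ : Carrier → ℤ
    S₁ x = s 0 0 x +ℤ s 1 7 x
    S₂ x = S₁ x +ℤ s 2 6 x
    lin : ∀ i j → e (s i j) ≡ w i *ℤ E j
    lin i j = π-*ˡ (w i) (ηs j) ω
    od′ : ∀ i → w (4 ℕ.+ i) ≡ -ℤ w i
    od′ = table-odd tf od
    collect : ∀ a b c d v u → a *ℤ + 0 +ℤ b *ℤ v +ℤ c *ℤ u +ℤ d *ℤ -ℤ v ≡ (b -ℤ d) *ℤ v +ℤ c *ℤ u
    collect = solve-∀
    vals : ℕ → ℤ
    vals i = w 0 *ℤ v-η (0 ℕ.+ i) +ℤ w 1 *ℤ v-η (7 ℕ.+ i) +ℤ w 2 *ℤ v-η (6 ℕ.+ i) +ℤ w 3 *ℤ v-η (5 ℕ.+ i)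
    expansion : HasTable (λ x → S₂ x +ℤ s 3 5 x) vals
    expansion = table-+ (table-+ (table-+ (table-*ˡ (w 0) (ηs-table 0)) (table-*ˡ (w 1) (ηs-table 7))) (table-*ˡ (w 2) (ηs-table 6))) (table-*ˡ (w 3) (ηs-table 5))
    p0 : ∀ a b c d → a ≡ a *ℤ + 1 +ℤ b *ℤ + 0 +ℤ c *ℤ + 0 +ℤ d *ℤ + 0
    p0 = solve-∀
    p1 : ∀ a b c d → b ≡ a *ℤ + 0 +ℤ b *ℤ + 1 +ℤ c *ℤ + 0 +ℤ d *ℤ + 0
    p1 = solve-∀
    p2 : ∀ a b c d → c ≡ a *ℤ + 0 +ℤ b *ℤ + 0 +ℤ c *ℤ + 1 +ℤ d *ℤ + 0
    p2 = solve-∀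
    p3 : ∀ a b c d → d ≡ a *ℤ + 0 +ℤ b *ℤ + 0 +ℤ c *ℤ + 0 +ℤ d *ℤ + 1
    p3 = solve-∀
    p4 : ∀ a b c d → -ℤ a ≡ a *ℤ -ℤ (+ 1) +ℤ b *ℤ + 0 +ℤ c *ℤ + 0 +ℤ d *ℤ + 0
    p4 = solve-∀
    p5 : ∀ a b c d → -ℤ b ≡ a *ℤ + 0 +ℤ b *ℤ -ℤ (+ 1) +ℤ c *ℤ + 0 +ℤ d *ℤ + 0
    p5 = solve-∀
    p6 : ∀ a b c d → -ℤ c ≡ a *ℤ + 0 +ℤ b *ℤ + 0 +ℤ c *ℤ -ℤ (+ 1) +ℤ d *ℤ + 0
    p6 = solve-∀
    p7 : ∀ a b c d → -ℤ d ≡ a *ℤ + 0 +ℤ b *ℤ + 0 +ℤ c *ℤ + 0 +ℤ d *ℤ -ℤ (+ 1)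
    p7 = solve-∀
    agree : (∀ i → w (4 ℕ.+ i) ≡ -ℤ w i) → Agree8 w vals
    agree o = p0 (w 0) (w 1) (w 2) (w 3) , p1 (w 0) (w 1) (w 2) (w 3) , p2 (w 0) (w 1) (w 2) (w 3) , p3 (w 0) (w 1) (w 2) (w 3) ,
      trans (o 0) (p4 (w 0) (w 1) (w 2) (w 3)) , trans (o 1) (p5 (w 0) (w 1) (w 2) (w 3)) ,
      trans (o 2) (p6 (w 0) (w 1) (w 2) (w 3)) , trans (o 3) (p7 (w 0) (w 1) (w 2) (w 3))

  Corr-at : ∀ {x} → x ≢ 0# → ∀ f g → Corr f g x ≡ Corr (f ∘ (x *_)) (g ∘ (x *_)) 1#
  Corr-at {x} x≢0 f g = trans (cong (Corr f g) (sym (*-identityʳ x))) (Corr-scale x≢0 f g 1#)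

  o≡ : + o ≡ + h *ℤ + n
  o≡ = ℤP.pos-* h n

  r≡h+h : + r ≡ + h +ℤ + h
  r≡h+h = cong +_ r≡2h

  Σ-odd-product : ∀ {f g w w′} → HasTable f w → HasTable g w′ → Odd f → Odd g →
                  ΣF (λ x → f x *ℤ g x) ≡ + r *ℤ (+ n *ℤ dot w w′)
  Σ-odd-product {f} {g} {w} {w′} tf tg of og = begin
    ΣF (λ x → f x *ℤ g x) ≡⟨ table-Σ (table-* tf tg) ⟩
    + o *ℤ ∑< 8 (λ i → w i *ℤ w′ i) ≡⟨ cong₂ _*ℤ_ o≡ (cong₂ _+ℤ_ (cong₂ _+ℤ_ (cong₂ _+ℤ_ (cong (pre +ℤ_) (opp 0)) (opp 1)) (opp 2)) (opp 3)) ⟩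
    (+ h *ℤ + n) *ℤ (+ 0 +ℤ a 0 +ℤ a 1 +ℤ a 2 +ℤ a 3 +ℤ a 0 +ℤ a 1 +ℤ a 2 +ℤ a 3) ≡⟨ collect (+ h) (+ n) (a 0) (a 1) (a 2) (a 3) ⟩
    (+ h +ℤ + h) *ℤ (+ n *ℤ dot w w′) ≡⟨ cong (_*ℤ (+ n *ℤ dot w w′)) (sym r≡h+h) ⟩
    + r *ℤ (+ n *ℤ dot w w′)  ∎
    where
    open ≡-Reasoning
    a : ℕ → ℤ
    a i = w i *ℤ w′ i
    pre : ℤ
    pre = + 0 +ℤ a 0 +ℤ a 1 +ℤ a 2 +ℤ a 3
    opp : ∀ i → w (4 ℕ.+ i) *ℤ w′ (4 ℕ.+ i) ≡ a i
    opp i = trans (cong₂ _*ℤ_ (table-odd tf of i) (table-odd tg og i)) (-i*-j≡i*j (w i) (w′ i))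
    collect : ∀ h n a b c d → (h *ℤ n) *ℤ (+ 0 +ℤ a +ℤ b +ℤ c +ℤ d +ℤ a +ℤ b +ℤ c +ℤ d) ≡ (h +ℤ h) *ℤ (n *ℤ (a +ℤ b +ℤ c +ℤ d))
    collect = solve-∀

  Corr-odd-table : ∀ {f g w w′} → HasTable f w → HasTable g w′ → Odd f → Odd g →
                   Corr f g 1# ≡ ev w *ℤ ev w′ -ℤ + n *ℤ dot w w′
  Corr-odd-table {f} {g} {w} {w′} tf tg of og = ℤP.*-cancelˡ-≡ (+ r) _ _ (begin
    + r *ℤ C ≡⟨ f1 (+ r *ℤ C) S ⟩
    (S +ℤ + r *ℤ C) -ℤ S ≡⟨ cong₂ _-ℤ_ (trans (Corr-odd-1 of og) (cong₂ (λ a b → + r *ℤ (a *ℤ b)) (e-table tf of) (e-table tg og))) (Σ-odd-product tf tg of og) ⟩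
    + r *ℤ (ev w *ℤ ev w′) -ℤ + r *ℤ (+ n *ℤ dot w w′) ≡⟨ f2 (+ r) _ _ ⟩
    + r *ℤ (ev w *ℤ ev w′ -ℤ + n *ℤ dot w w′) ∎)
    where
    open ≡-Reasoning
    C = Corr f g 1#
    S = ΣF (λ x → f x *ℤ g x)
    f1 : ∀ x s → x ≡ (s +ℤ x) -ℤ s
    f1 = solve-∀
    f2 : ∀ r a b → r *ℤ a -ℤ r *ℤ b ≡ r *ℤ (a -ℤ b)
    f2 = solve-∀

  Corr-odd-table-at : ∀ {f g w w′} → HasTable f w → HasTable g w′ → Odd f → Odd g → ∀ s t →
                   Corr f g (pow ω (s ℕ.+ t ℕ.* 8)) ≡ ev (λ i → w (s ℕ.+ i)) *ℤ ev (λ i → w′ (s ℕ.+ i)) -ℤ + n *ℤ dot (λ i → w (s ℕ.+ i)) (λ i → w′ (s ℕ.+ i))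
  Corr-odd-table-at {f} {g} tf tg of og s t = trans (Corr-at (pow-nonzero (s ℕ.+ t ℕ.* 8) ω≢0) f g)
    (Corr-odd-table (mul-table tf s t) (mul-table tg s t) (mul-Odd x of) (mul-Odd x og))
    where x = pow ω (s ℕ.+ t ℕ.* 8)

  Corr-even-at : ∀ {f g} → Even f → Even g → f 0# ≡ + 0 → g 0# ≡ + 0 →
    ∀ A B → ΣF f ≡ + r *ℤ A → ΣF g ≡ + r *ℤ B → ∀ {x} → x ≢ 0# →
    ΣF (λ h → f h *ℤ g h) +ℤ + r *ℤ Corr f g x ≡ + r *ℤ ((B -ℤ g x) *ℤ A +ℤ (+ q *ℤ g x -ℤ B) *ℤ f x)
  Corr-even-at {f} {g} ef eg f0 g0 A B eA eB {x} x≢0 = trans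
    (cong₂ (λ a b → a +ℤ + r *ℤ b) (sym (Σ-scale x≢0 (λ h → f h *ℤ g h))) (Corr-at x≢0 f g))
    (trans (Corr-even-1 (mul-Even x ef) (mul-Even x eg) (trans (cong f (zeroʳ x)) f0) (trans (cong g (zeroʳ x)) g0)
        A B (trans (Σ-scale x≢0 f) eA) (trans (Σ-scale x≢0 g) eB))
      (cong₂ (λ a b → + r *ℤ ((B -ℤ b) *ℤ A +ℤ (+ q *ℤ b -ℤ B) *ℤ a)) (cong f (*-identityʳ x)) (cong g (*-identityʳ x))))

  ΣF-Corr : ∀ f g → ΣF (Corr f g) ≡ ΣF f *ℤ ΣF g
  ΣF-Corr f g = begin
    ΣF (λ x → ΣF (λ h → f h *ℤ g (h - x))) ≡⟨ ∑-swap elems elems _ ⟩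
    ΣF (λ h → ΣF (λ x → f h *ℤ g (h - x))) ≡⟨ ∑-cong elems (λ h → trans (∑-*ˡ elems (f h) _) (trans (cong (f h *ℤ_) (total h)) (ℤP.*-comm (f h) (ΣF g)))) ⟩
    ΣF (λ h → ΣF g *ℤ f h) ≡⟨ ∑-*ˡ elems (ΣF g) f ⟩
    ΣF g *ℤ ΣF f ≡⟨ ℤP.*-comm (ΣF g) (ΣF f) ⟩
    ΣF f *ℤ ΣF g  ∎
    where
    open ≡-Reasoning
    total : ∀ h → ΣF (λ x → g (h - x)) ≡ ΣF g
    total h = trans (Σ-negate (λ x → g (h + x))) (trans (∑-cong elems (λ x → cong g (+-comm h x))) (Σ-translate h g))

  -- The norm equation

  Γ : Carrier → ℤ
  Γ x = Corr (ηs 0) (ηs 0) x +ℤ Corr (ηs 1) (ηs 1) x +ℤ Corr (ηs 2) (ηs 2) x +ℤ Corr (ηs 3) (ηs 3) x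

  -- Multiplication by ω permutes the four signed classes cyclically up to a sign, and an
  -- autocorrelation does not see the sign.
  Γ-ω : ∀ x → Γ (ω * x) ≡ Γ x
  Γ-ω x = trans (cong₂ _+ℤ_ (cong₂ _+ℤ_ (cong₂ _+ℤ_ (next 0) (next 1)) (next 2)) (trans (next 3) wrap)) (rot (c 1) (c 2) (c 3) (c 0))
    where
    c : ℕ → ℤ
    c s = Corr (ηs s) (ηs s) x
    next : ∀ s → Corr (ηs s) (ηs s) (ω * x) ≡ c (suc s)
    next s = Corr-scale ω≢0 (ηs s) (ηs s) x
    flip : ∀ y → ηs 4 y ≡ -ℤ ηs 0 y
    flip = table-≗ (ηs-table 4) (neg-val (ηs-table 0)) all≡
    wrap : c 4 ≡ c 0
    wrap = trans (Corr-cong flip flip x) (∑-cong elems (λ h → -i*-j≡i*j (ηs 0 h) (ηs 0 (h - x))))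
    rot : ∀ a b c d → a +ℤ b +ℤ c +ℤ d ≡ d +ℤ a +ℤ b +ℤ c
    rot = solve-∀

  Γ-pow : ∀ j → Γ (pow ω j) ≡ Γ 1#
  Γ-pow zero    = refl
  Γ-pow (suc j) = trans (Γ-ω (pow ω j)) (Γ-pow j)

  Σηs : ∀ s → s ℕ.< 4 → ΣF (ηs s) ≡ + 0
  Σηs s s<4 = trans (table-Σ (ηs-table s)) (trans (cong (+ o *ℤ_) (zeros s s<4)) (ℤP.*-zeroʳ (+ o)))
    where
    zeros : ∀ s → s ℕ.< 4 → ∑< 8 (λ i → v-η (s ℕ.+ i)) ≡ + 0
    zeros 0 _ = refl
    zeros 1 _ = refl
    zeros 2 _ = refl
    zeros 3 _ = refl
    zeros (suc (suc (suc (suc _)))) (s≤s (s≤s (s≤s (s≤s ()))))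

  -- Each signed class has sum 0, so Γ has sum 0. Its value at 0 is M, since the four supports
  -- partition the nonzero elements, and its M other values are equal.
  Γ-1 : Γ 1# ≡ -ℤ + 1
  Γ-1 = ℤP.*-cancelˡ-≡ (+ M) _ _ (begin
    + M *ℤ Γ 1# ≡⟨ i≡[j+i]-j (Γ 0#) (+ M *ℤ Γ 1#) ⟩
    (Γ 0# +ℤ + M *ℤ Γ 1#) -ℤ Γ 0# ≡⟨ cong₂ _-ℤ_ (trans (sym total) total-0) Γ-0 ⟩
    + 0 -ℤ + M ≡⟨ f2 (+ M) ⟩
    + M *ℤ -ℤ + 1  ∎)
    where
    open ≡-Reasoning
    f2 : ∀ a → + 0 -ℤ a ≡ a *ℤ -ℤ + 1
    f2 = solve-∀
    const-sum : ∀ k → ∑< k (λ _ → Γ 1#) ≡ + k *ℤ Γ 1#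
    const-sum zero    = refl
    const-sum (suc k) = trans (cong (_+ℤ Γ 1#) (const-sum k)) (f3 (+ k) (Γ 1#))
      where
      f3 : ∀ k g → k *ℤ g +ℤ g ≡ (+ 1 +ℤ k) *ℤ g
      f3 = solve-∀
    total : ΣF Γ ≡ Γ 0# +ℤ + M *ℤ Γ 1#
    total = trans (Σ-pow Γ) (cong (Γ 0# +ℤ_) (trans (∑<-cong M Γ-pow) (const-sum M)))
    c : ℕ → Carrier → ℤ
    c s = Corr (ηs s) (ηs s)
    zero-sum : ∀ s → s ℕ.< 4 → ΣF (c s) ≡ + 0
    zero-sum s s<4 = trans (ΣF-Corr (ηs s) (ηs s)) (cong (_*ℤ ΣF (ηs s)) (Σηs s s<4))
    total-0 : ΣF Γ ≡ + 0
    total-0 = trans (∑-+ elems (λ x → c 0 x +ℤ c 1 x +ℤ c 2 x) (c 3)) (cong₂ _+ℤ_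
      (trans (∑-+ elems (λ x → c 0 x +ℤ c 1 x) (c 2)) (cong₂ _+ℤ_ (trans (∑-+ elems (c 0) (c 1))
        (cong₂ _+ℤ_ (zero-sum 0 (s≤s z≤n)) (zero-sum 1 (s≤s (s≤s z≤n))))) (zero-sum 2 (s≤s (s≤s (s≤s z≤n)))))) (zero-sum 3 (s≤s (s≤s (s≤s (s≤s z≤n))))))
    square : ∀ s → c s 0# ≡ + r *ℤ (+ n *ℤ dot (λ i → v-η (s ℕ.+ i)) (λ i → v-η (s ℕ.+ i)))
    square s = trans (Corr-0 (ηs s) (ηs s)) (Σ-odd-product (ηs-table s) (ηs-table s) (ηs-odd s) (ηs-odd s))
    4n : + 4 *ℤ + n ≡ + suc q
    4n = trans (sym (ℤP.pos-* 4 n)) (cong +_ (sym [q+1]≡4n))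
    Γ-0 : Γ 0# ≡ + M
    Γ-0 = trans (cong₂ _+ℤ_ (cong₂ _+ℤ_ (cong₂ _+ℤ_ (square 0) (square 1)) (square 2)) (square 3))
      (trans (f3 (+ r) (+ n)) (trans (cong (+ r *ℤ_) 4n) (trans (sym (ℤP.pos-* r (suc q))) (cong +_ (sym M≡r*[q+1])))))
      where
      f3 : ∀ r n → r *ℤ (n *ℤ + 1) +ℤ r *ℤ (n *ℤ + 1) +ℤ r *ℤ (n *ℤ + 1) +ℤ r *ℤ (n *ℤ + 1) ≡ r *ℤ (+ 4 *ℤ n)
      f3 = solve-∀

  q+1≡4n : + q +ℤ + 1 ≡ + 4 *ℤ + n
  q+1≡4n = trans (ℤP.+-comm (+ q) (+ 1)) (trans (cong +_ [q+1]≡4n) (ℤP.pos-* 4 n))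

  -- The formula for odd correlations gives `Γ 1#` a second time, as the sum of the four squares 0,
  -- v², u², v² minus 4 n = q + 1.
  norm : + q ≡ u *ℤ u +ℤ + 2 *ℤ (v *ℤ v)
  norm = begin
    + q ≡⟨ f1 (+ q) ⟩
    -ℤ + 1 +ℤ (+ q +ℤ + 1) ≡⟨ cong₂ _+ℤ_ (trans (sym Γ-1) (cong₂ _+ℤ_ (cong₂ _+ℤ_ (cong₂ _+ℤ_ (auto 0) (auto 1)) (auto 2)) (auto 3))) q+1≡4n ⟩
    _ ≡⟨ f2 u v (+ n) ⟩
    u *ℤ u +ℤ + 2 *ℤ (v *ℤ v)  ∎
    where
    open ≡-Reasoning
    w : ℕ → ℕ → ℤ
    w s i = v-η (s ℕ.+ i)
    auto : ∀ s → Corr (ηs s) (ηs s) 1# ≡ ev (w s) *ℤ ev (w s) -ℤ + n *ℤ dot (w s) (w s)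
    auto s = Corr-odd-table (ηs-table s) (ηs-table s) (ηs-odd s) (ηs-odd s)
    f1 : ∀ q → q ≡ -ℤ + 1 +ℤ (q +ℤ + 1)
    f1 = solve-∀
    -- The numerals are the entries of the shifted tables `w s` at 1, 3 and 2 and their `dot` value,
    -- for s = 0, 1, 2, 3.
    f2 : ∀ u v n →
      (((((+ 0 -ℤ + 0) *ℤ v +ℤ + 0 *ℤ u) *ℤ ((+ 0 -ℤ + 0) *ℤ v +ℤ + 0 *ℤ u) -ℤ n *ℤ + 1)
       +ℤ (((+ 0 -ℤ -ℤ + 1) *ℤ v +ℤ + 0 *ℤ u) *ℤ ((+ 0 -ℤ -ℤ + 1) *ℤ v +ℤ + 0 *ℤ u) -ℤ n *ℤ + 1))
       +ℤ (((+ 0 -ℤ + 0) *ℤ v +ℤ -ℤ + 1 *ℤ u) *ℤ ((+ 0 -ℤ + 0) *ℤ v +ℤ -ℤ + 1 *ℤ u) -ℤ n *ℤ + 1))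
       +ℤ (((-ℤ + 1 -ℤ + 0) *ℤ v +ℤ + 0 *ℤ u) *ℤ ((-ℤ + 1 -ℤ + 0) *ℤ v +ℤ + 0 *ℤ u) -ℤ n *ℤ + 1)
       +ℤ + 4 *ℤ n ≡ u *ℤ u +ℤ + 2 *ℤ (v *ℤ v)
    f2 = solve-∀

  -- The cyclotomic number that fixes the sign of b

  inv : Carrier → Carrier
  inv x = pow x (ℕ.pred M)

  M-pred : M ≡ suc (ℕ.pred M)
  M-pred = sym (ℕP.suc-pred M)

  inv-0 : inv 0# ≡ 0#
  inv-0 = pow-0# (ℕ.pred M) (ℕ.s≤s⁻¹ (subst (2 ℕ.≤_) M-pred (ℕP.≤-trans r≥2 (ℕP.<⇒≤ r<M))))

  inv-* : ∀ {x} → x ≢ 0# → x * inv x ≡ 1#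
  inv-* {x} x≢0 = trans (cong (pow x) (sym M-pred)) (pow-M≡1 x≢0)

  inv-inv : ∀ x → inv (inv x) ≡ x
  inv-inv x = go (x ≟ 0#)
    where
    go : Dec (x ≡ 0#) → inv (inv x) ≡ x
    go (yes z) = trans (cong (inv ∘ inv) z) (trans (cong inv inv-0) (trans inv-0 (sym z)))
    go (no nz) = *-cancelˡ (inv x) inv≢0 (trans (inv-* inv≢0) (trans (sym (inv-* nz)) (*-comm x (inv x))))
      where
      inv≢0 : inv x ≢ 0#
      inv≢0 = pow-nonzero (ℕ.pred M) nz

  inv-table : ∀ {f w} → HasTable f w → HasTable (f ∘ inv) (λ i → w (7 ℕ.* i))
  inv-table {f} {w} tf = subst (λ j → HasTable (λ x → f (pow x j)) (λ i → w (7 ℕ.* i))) (sym pred≡) (pow-table tf 7 (ℕ.pred o) (s≤s z≤n))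
    where
    instance
      o-nonZero : NonZero o
      o-nonZero = ℕP.m*n≢0⇒m≢0 o {8} {{subst NonZero M≡o*8 M-nonZero}}
    pred≡ : ℕ.pred M ≡ 7 ℕ.+ ℕ.pred o ℕ.* 8
    pred≡ = cong ℕ.pred (trans M≡o*8 (cong (ℕ._* 8) (sym (ℕP.suc-pred o))))

  -- Averaging over the scalings of z by d ∈ K, the sum of c z * f (d z + 1) becomes a coset sum, since d z + 1 = z (1/z + d).
  Corr-odd-cyc4 : ∀ {f w} → HasTable f w → Odd f → f 1# ≡ + 0 → ∀ b b′ →
    (∀ i → i ℕ.< 8 → 𝟙 ((i % 4) ≡ᵇ (b % 4)) *ℤ e (f ∘ act i) ≡ v-η (b′ ℕ.+ i) *ℤ e (f ∘ act b)) →
    Agree8 (λ i → v-η (b′ ℕ.+ 7 ℕ.* i)) (λ i → v-η (b ℕ.+ i)) →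
    Corr f (𝟙 ∘ Cyc 4 b) 1# ≡ e (f ∘ act b) *ℤ E b
  Corr-odd-cyc4 {f} {w} tf of f1 b b′ match ag = ℤP.*-cancelˡ-≡ (+ r) _ _ (begin
    + r *ℤ Corr f c 1# ≡⟨ cong (+ r *ℤ_) (sym H-1) ⟩
    + r *ℤ H 1# ≡⟨ trans (sym (ℤP.+-identityˡ _)) (cong (_+ℤ (+ r *ℤ H 1#)) (sym H-0)) ⟩
    H 0# +ℤ + r *ℤ H 1# ≡⟨ sym (ΣK-even H H-even) ⟩
    ΣK H ≡⟨ trans (∑-cong elems (λ d → sym (∑-*ˡ elems (K d) _))) (∑-swap elems elems _) ⟩
    ΣF (λ z → ΣF (λ d → K d *ℤ (c z *ℤ f (d * z + 1#)))) ≡⟨ ∑-cong elems inner ⟩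
    ΣF (λ z → e (f ∘ act b) *ℤ (ηs b′ z *ℤ κ (inv z))) ≡⟨ ∑-*ˡ elems (e (f ∘ act b)) (λ z → ηs b′ z *ℤ κ (inv z)) ⟩
    e (f ∘ act b) *ℤ ΣF (λ z → ηs b′ z *ℤ κ (inv z)) ≡⟨ cong (e (f ∘ act b) *ℤ_) (trans (sym (Σ-bij inv inv inv-inv inv-inv (λ z → ηs b′ z *ℤ κ (inv z))))
                                                          (∑-cong elems (λ z → cong₂ _*ℤ_ (flip z) (cong κ (inv-inv z))))) ⟩
    e (f ∘ act b) *ℤ ΣF (λ z → ηs b z *ℤ κ z) ≡⟨ cong (e (f ∘ act b) *ℤ_) (Σ-κ (ηs-odd b)) ⟩
    e (f ∘ act b) *ℤ (+ r *ℤ E b) ≡⟨ i*jk≡j*ik (e (f ∘ act b)) (+ r) (E b) ⟩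
    + r *ℤ (e (f ∘ act b) *ℤ E b)  ∎)
    where
    open ≡-Reasoning
    c : Carrier → ℤ
    c = 𝟙 ∘ Cyc 4 b
    c-table = cyc4-table b
    c-even : Even c
    c-even = table-Even c-table all≡
    H : Carrier → ℤ
    H d = ΣF (λ z → c z *ℤ f (d * z + 1#))
    exch′ : ∀ a b c → a *ℤ (b *ℤ c) ≡ (a *ℤ c) *ℤ b
    exch′ = solve-∀
    exch″ : ∀ a b c → (a *ℤ b) *ℤ c ≡ b *ℤ (a *ℤ c)
    exch″ = solve-∀
    H-1 : H 1# ≡ Corr f c 1#
    H-1 = trans (∑-cong elems (λ z → trans (ℤP.*-comm (c z) _) (cong₂ _*ℤ_ (cong (λ y → f (y + 1#)) (*-identityˡ z)) (cong c (sym (+-cancelʳ-inv z 1#))))))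
            (Σ-translate 1# (λ w → f w *ℤ c (w - 1#)))
    H-0 : H 0# ≡ + 0
    H-0 = trans (∑-cong elems (λ z → trans (cong (c z *ℤ_) (trans (cong f (trans (cong (_+ 1#) (zeroˡ z)) (+-identityˡ 1#))) f1)) (ℤP.*-zeroʳ (c z)))) (∑-zero elems)
    H-even : Even H
    H-even d = trans (∑-cong elems (λ z → cong₂ _*ℤ_ (sym (c-even z)) (cong (λ y → f (y + 1#)) (trans (cong (_* z) (*-comm N d)) (*-assoc d N z)))))
                 (Σ-scale N≢0 (λ z → c z *ℤ f (d * z + 1#)))
    -- Inversion negates logarithms, and in both applications b + b′ = 8.
    flip : ∀ z → ηs b′ (inv z) ≡ ηs b z
    flip = table-≗ (inv-table (ηs-table b′)) (ηs-table b) ag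
    coset : ∀ z → z ≢ 0# → ΣF (λ d → K d *ℤ f (d * z + 1#)) ≡ κ (inv z) *ℤ e (f ∘ (z *_))
    coset z z≢0 = trans (∑-cong elems (λ d → cong (λ y → K d *ℤ f y) (factor d))) (π≡κe (mul-Odd z of) (inv z))
      where
      factor : ∀ d → d * z + 1# ≡ z * (inv z + d)
      factor d = trans (+-comm _ _) (trans (cong₂ _+_ (sym (inv-* z≢0)) (*-comm d z)) (sym (distribˡ z (inv z) d)))
    inner : ∀ z → ΣF (λ d → K d *ℤ (c z *ℤ f (d * z + 1#))) ≡ e (f ∘ act b) *ℤ (ηs b′ z *ℤ κ (inv z))
    inner z = trans (∑-cong elems (λ d → i*jk≡j*ik (K d) (c z) (f (d * z + 1#)))) (trans (∑-*ˡ elems (c z) _) (go (z ≟ 0#)))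
      where
      go : Dec (z ≡ 0#) → c z *ℤ ΣF (λ d → K d *ℤ f (d * z + 1#)) ≡ e (f ∘ act b) *ℤ (ηs b′ z *ℤ κ (inv z))
      go (yes refl) = trans (cong (_*ℤ ΣF (λ d → K d *ℤ f (d * 0# + 1#))) (at-0 c-table))
        (sym (trans (cong (λ y → e (f ∘ act b) *ℤ (y *ℤ κ (inv 0#))) (at-0 (ηs-table b′))) (ℤP.*-zeroʳ (e (f ∘ act b)))))
      go (no nz) = trans (cong (c z *ℤ_) (coset z nz)) (trans (exch′ (c z) (κ (inv z)) _)
        (trans (cong (_*ℤ κ (inv z)) (weight z nz)) (exch″ (ηs b′ z) (e (f ∘ act b)) (κ (inv z)))))
        where
        -- Quartic class b consists of two octic classes, whose logarithms differ by 4. Passing from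
        -- one to the other changes the sign of the odd function f, and `ηs b′`, the signed class of
        -- index b, records that sign.
        weight : ∀ z → z ≢ 0# → c z *ℤ e (f ∘ (z *_)) ≡ ηs b′ z *ℤ e (f ∘ act b)
        weight z nz = at (residue z nz)
          where
          at : (∃ λ i → ∃ λ t → i ℕ.< 8 × z ≡ pow ω (i ℕ.+ t ℕ.* 8)) → c z *ℤ e (f ∘ (z *_)) ≡ ηs b′ z *ℤ e (f ∘ act b)
          at (i , t , i<8 , refl) = trans
            (cong₂ _*ℤ_ (at-pow c-table i t) (e-cong (table-≗ (mul-table tf i t) (table-act i tf) all≡)))
            (trans (match i i<8) (cong (_*ℤ e (f ∘ act b)) (sym (at-pow (ηs-table b′) i t))))

  ηs-1 : ∀ s → ηs s 1# ≡ v-η s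
  ηs-1 s = trans (at-pow (ηs-table s) 0 0) (cong v-η (ℕP.+-identityʳ s))

  open GroupRing F using (countF)

  1≢0 : 1# ≢ 0#
  1≢0 e = 0≢1 (sym e)

  Corr-+ˡ : ∀ f f′ g x → Corr (λ y → f y +ℤ f′ y) g x ≡ Corr f g x +ℤ Corr f′ g x
  Corr-+ˡ f f′ g x = trans (∑-cong elems (λ h → ℤP.*-distribʳ-+ (g (h - x)) (f h) (f′ h))) (∑-+ elems _ _)

  Corr-+ʳ : ∀ f g g′ x → Corr f (λ y → g y +ℤ g′ y) x ≡ Corr f g x +ℤ Corr f g′ x
  Corr-+ʳ f g g′ x = trans (∑-cong elems (λ h → ℤP.*-distribˡ-+ (f h) (g (h - x)) (g′ (h - x)))) (∑-+ elems _ _)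

  Corr-swap : ∀ f g x → Corr f g x ≡ Corr g f (- x)
  Corr-swap f g x = trans (sym (Σ-translate x (λ h → f h *ℤ g (h - x))))
    (∑-cong elems (λ h → trans (ℤP.*-comm (f (h + x)) _) (cong₂ _*ℤ_ (cong g (+-cancelʳ-inv h x)) (cong (λ z → f (h + z)) (sym (neg-neg x))))))

  Corr-reflect : ∀ f g x → Corr f g (- x) ≡ Corr (f ∘ -_) (g ∘ -_) x
  Corr-reflect f g x = trans (sym (Σ-negate (λ h → f h *ℤ g (h - (- x)))))
    (∑-cong elems (λ h → cong (λ z → f (- h) *ℤ g z) (neg-+ h (- x))))

  c4 : ℕ → Carrier → ℤ
  c4 i = 𝟙 ∘ Cyc 4 i

  double-cyc8 : ∀ i s → Agree8 (λ j → + 2 *ℤ 𝟙 ((j % 8) ≡ᵇ (i % 8))) (λ j → 𝟙 ((j % 4) ≡ᵇ (i % 4)) +ℤ v-η (s ℕ.+ j)) →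
                ∀ x → + 2 *ℤ 𝟙 (Cyc 8 i x) ≡ c4 i x +ℤ ηs s x
  double-cyc8 i s = table-≗ (table-*ˡ (+ 2) (cyc8-table i)) (table-+ (cyc4-table i) (ηs-table s))

  cyc4-sum : ∀ i → ∑< 8 (λ j → 𝟙 ((j % 4) ≡ᵇ (i % 4))) ≡ + 2 → ΣF (c4 i) ≡ + r *ℤ + n
  cyc4-sum i e = trans (table-Σ (cyc4-table i)) (trans (cong₂ _*ℤ_ o≡ e) (trans (f (+ h) (+ n)) (cong (_*ℤ + n) (sym r≡h+h))))
    where
    f : ∀ h n → (h *ℤ n) *ℤ + 2 ≡ (h +ℤ h) *ℤ n
    f = solve-∀

  c4-even : ∀ i → i ℕ.< 4 → Even (c4 i)
  c4-even 0 _ = table-Even (cyc4-table 0) all≡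
  c4-even 1 _ = table-Even (cyc4-table 1) all≡
  c4-even 2 _ = table-Even (cyc4-table 2) all≡
  c4-even 3 _ = table-Even (cyc4-table 3) all≡
  c4-even (suc (suc (suc (suc _)))) (s≤s (s≤s (s≤s (s≤s ()))))

  -- The two classes are disjoint and neither contains 1, so of the even formula only the product of
  -- the two numbers of lines remains.
  Corr-c₂-c₁ : Corr (c4 2) (c4 1) 1# ≡ + n *ℤ + n
  Corr-c₂-c₁ = ℤP.*-cancelˡ-≡ (+ r) _ _ (begin
    + r *ℤ C ≡⟨ sym (ℤP.+-identityˡ _) ⟩
    + 0 +ℤ + r *ℤ C ≡⟨ cong (_+ℤ (+ r *ℤ C)) (sym disjoint) ⟩
    ΣF (λ h → c4 2 h *ℤ c4 1 h) +ℤ + r *ℤ C ≡⟨ Corr-even-at (c4-even 2 (s≤s (s≤s (s≤s z≤n)))) (c4-even 1 (s≤s (s≤s z≤n))) (at-0 (cyc4-table 2)) (at-0 (cyc4-table 1))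
                                         (+ n) (+ n) (cyc4-sum 2 refl) (cyc4-sum 1 refl) 1≢0 ⟩
    + r *ℤ ((+ n -ℤ c4 1 1#) *ℤ + n +ℤ (+ q *ℤ c4 1 1# -ℤ + n) *ℤ c4 2 1#)
        ≡⟨ cong₂ (λ a b → + r *ℤ ((+ n -ℤ a) *ℤ + n +ℤ (+ q *ℤ a -ℤ + n) *ℤ b)) (at-pow (cyc4-table 1) 0 0) (at-pow (cyc4-table 2) 0 0) ⟩
    + r *ℤ ((+ n -ℤ + 0) *ℤ + n +ℤ (+ q *ℤ + 0 -ℤ + n) *ℤ + 0) ≡⟨ f (+ r) (+ n) (+ q) ⟩
    + r *ℤ (+ n *ℤ + n)  ∎)
    where
    open ≡-Reasoning
    C = Corr (c4 2) (c4 1) 1#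
    f : ∀ r n q → r *ℤ ((n -ℤ + 0) *ℤ n +ℤ (q *ℤ + 0 -ℤ n) *ℤ + 0) ≡ r *ℤ (n *ℤ n)
    f = solve-∀
    disjoint : ΣF (λ h → c4 2 h *ℤ c4 1 h) ≡ + 0
    disjoint = trans (table-Σ (table-* (cyc4-table 2) (cyc4-table 1))) (ℤP.*-zeroʳ (+ o))

  Corr-η₂-η₁ : Corr (ηs 6) (ηs 7) 1# ≡ u *ℤ v
  Corr-η₂-η₁ = trans (Corr-odd-table (ηs-table 6) (ηs-table 7) (ηs-odd 6) (ηs-odd 7)) (f u v (+ n))
    where
    f : ∀ u v n → ((+ 0 -ℤ + 0) *ℤ v +ℤ + 1 *ℤ u) *ℤ ((+ 1 -ℤ + 0) *ℤ v +ℤ + 0 *ℤ u) -ℤ n *ℤ + 0 ≡ u *ℤ v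
    f = solve-∀

  e-act : ∀ s i → e (ηs s ∘ act i) ≡ ev (λ j → v-η (s ℕ.+ (i ℕ.+ j)))
  e-act s i = e-table (table-act i (ηs-table s)) (act-Odd i (ηs-odd s))

  e-act-4 : ∀ s i → e (ηs s ∘ act (4 ℕ.+ i)) ≡ -ℤ e (ηs s ∘ act i)
  e-act-4 s i = trans (e-cong (λ x → opposite (act i x) x refl)) (e-neg (ηs s ∘ act i))
    where
    opposite : ∀ y x → act i x ≡ y → ηs s (act (4 ℕ.+ i) x) ≡ -ℤ ηs s y
    opposite y x refl = trans (cong (ηs s) (four x)) (flip (act s (act i x)))
      where
      four : ∀ x → act (4 ℕ.+ i) x ≡ act 4 (act i x)
      four x = trans (act≡ (4 ℕ.+ i) x) (trans (cong (_* x) (pow-+ ω 4 i)) (trans (*-assoc _ _ x) (trans (cong (pow ω 4 *_) (sym (act≡ i x))) (sym (act≡ 4 (act i x))))))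
      act-comm : ∀ y → act s (act 4 y) ≡ act 4 (act s y)
      act-comm y = trans (act≡ s _) (trans (cong (pow ω s *_) (act≡ 4 y)) (trans (sym (*-assoc _ _ y)) (trans (cong (_* y) (*-comm _ _))
        (trans (*-assoc _ _ y) (trans (cong (pow ω 4 *_) (sym (act≡ s y))) (sym (act≡ 4 (act s y))))))))
      flip : ∀ y → ηs s (act 4 (act i x)) ≡ -ℤ ηs s (act i x)
      flip _ = trans (cong η (act-comm (act i x))) (table-≗ (ηs-table 4) (neg-val η-table) all≡ (act s (act i x)))

  Corr-η₂-c₁ : Corr (ηs 6) (c4 1) 1# ≡ v *ℤ v
  Corr-η₂-c₁ = trans (Corr-odd-cyc4 (ηs-table 6) (ηs-odd 6) (ηs-1 6) 1 7 match all≡)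
         (cong (_*ℤ v) (trans (e-act 6 1) (f u v)))
    where
    f : ∀ u v → (+ 1 -ℤ + 0) *ℤ v +ℤ + 0 *ℤ u ≡ v
    f = solve-∀
    g : ∀ x → + 1 *ℤ -ℤ x ≡ -ℤ + 1 *ℤ x
    g = solve-∀
    match : ∀ i → i ℕ.< 8 → 𝟙 ((i % 4) ≡ᵇ 1) *ℤ e (ηs 6 ∘ act i) ≡ v-η (7 ℕ.+ i) *ℤ e (ηs 6 ∘ act 1)
    match = below8 _ (refl , refl , refl , refl , refl , trans (cong (+ 1 *ℤ_) (e-act-4 6 1)) (g (e (ηs 6 ∘ act 1))) , refl , refl)

  Corr-η₁-c₂ : Corr (ηs 7) (c4 2) 1# ≡ v *ℤ E 2
  Corr-η₁-c₂ = trans (Corr-odd-cyc4 (ηs-table 7) (ηs-odd 7) (ηs-1 7) 2 6 match all≡)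
         (cong (_*ℤ E 2) (trans (e-act 7 2) (f u v)))
    where
    f : ∀ u v → (+ 0 -ℤ -ℤ + 1) *ℤ v +ℤ + 0 *ℤ u ≡ v
    f = solve-∀
    g : ∀ x → + 1 *ℤ -ℤ x ≡ -ℤ + 1 *ℤ x
    g = solve-∀
    match : ∀ i → i ℕ.< 8 → 𝟙 ((i % 4) ≡ᵇ 2) *ℤ e (ηs 7 ∘ act i) ≡ v-η (6 ℕ.+ i) *ℤ e (ηs 7 ∘ act 2)
    match = below8 _ (refl , refl , refl , refl , refl , refl , trans (cong (+ 1 *ℤ_) (e-act-4 7 2)) (g (e (ηs 7 ∘ act 2))) , refl)

  -- Swapping the factors moves the shift from 1 to -1. Reflecting both functions moves it back, at
  -- the cost of a sign from the odd factor.
  Corr-c₂-η₁ : Corr (c4 2) (ηs 7) 1# ≡ u *ℤ v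
  Corr-c₂-η₁ = trans (Corr-swap (c4 2) (ηs 7) 1#) (trans (Corr-reflect (ηs 7) (c4 2) 1#)
    (trans (Corr-cong (table-≗ (neg-table (ηs-table 7)) (neg-val (ηs-table 7)) all≡)
                      (table-≗ (neg-table (cyc4-table 2)) (cyc4-table 2) all≡) 1#)
      (trans (∑-cong elems (λ h → g (ηs 7 h) (c4 2 (h - 1#)))) (trans (∑-*ˡ elems (-ℤ + 1) _) (trans (cong (-ℤ + 1 *ℤ_) Corr-η₁-c₂) (f v (E 2)))))))
    where
    g : ∀ a b → -ℤ a *ℤ b ≡ -ℤ + 1 *ℤ (a *ℤ b)
    g = solve-∀
    f : ∀ v e → -ℤ + 1 *ℤ (v *ℤ e) ≡ -ℤ e *ℤ v
    f = solve-∀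

  N₁₂ : ℕ
  N₁₂ = countF (λ z → Cyc 8 1 z ∧ Cyc 8 2 (z + 1#))

  -- Doubling each indicator splits it into an even quartic part and an odd signed part. The four
  -- resulting correlations are n², u v, v² and u v.
  4N₁₂ : + 4 *ℤ + N₁₂ ≡ + n *ℤ + n +ℤ u *ℤ v +ℤ (v *ℤ v +ℤ u *ℤ v)
  4N₁₂ = begin
    + 4 *ℤ + N₁₂ ≡⟨ cong (+ 4 *ℤ_) (length-filterᵇ _ elems) ⟩
    + 4 *ℤ ΣF (λ z → 𝟙 (Cyc 8 1 z ∧ Cyc 8 2 (z + 1#))) ≡⟨ sym (∑-*ˡ elems (+ 4) _) ⟩
    ΣF (λ z → + 4 *ℤ 𝟙 (Cyc 8 1 z ∧ Cyc 8 2 (z + 1#))) ≡⟨ ∑-cong elems pointwise ⟩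
    ΣF (λ z → a (z + 1#) *ℤ b ((z + 1#) - 1#)) ≡⟨ Σ-translate 1# (λ w → a w *ℤ b (w - 1#)) ⟩
    Corr a b 1# ≡⟨ Corr-+ˡ (c4 2) (ηs 6) b 1# ⟩
    Corr (c4 2) b 1# +ℤ Corr (ηs 6) b 1# ≡⟨ cong₂ _+ℤ_ (trans (Corr-+ʳ (c4 2) (c4 1) (ηs 7) 1#) (cong₂ _+ℤ_ Corr-c₂-c₁ Corr-c₂-η₁)) (trans
        (Corr-+ʳ (ηs 6) (c4 1) (ηs 7) 1#) (cong₂ _+ℤ_ Corr-η₂-c₁ Corr-η₂-η₁)) ⟩
    + n *ℤ + n +ℤ u *ℤ v +ℤ (v *ℤ v +ℤ u *ℤ v)  ∎
    where
    open ≡-Reasoning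
    a b : Carrier → ℤ
    a x = c4 2 x +ℤ ηs 6 x
    b x = c4 1 x +ℤ ηs 7 x
    rearr : ∀ x y → + 4 *ℤ (x *ℤ y) ≡ (+ 2 *ℤ y) *ℤ (+ 2 *ℤ x)
    rearr = solve-∀
    pointwise : ∀ z → + 4 *ℤ 𝟙 (Cyc 8 1 z ∧ Cyc 8 2 (z + 1#)) ≡ a (z + 1#) *ℤ b ((z + 1#) - 1#)
    pointwise z = trans (cong (+ 4 *ℤ_) (𝟙-∧ (Cyc 8 1 z) _)) (trans (rearr (𝟙 (Cyc 8 1 z)) (𝟙 (Cyc 8 2 (z + 1#))))
      (cong₂ _*ℤ_ (double-cyc8 2 6 all≡ (z + 1#))
        (trans (double-cyc8 1 7 all≡ z) (cong b (sym (+-cancelʳ-inv z 1#))))))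

  -- The hypothesis evaluates 16 times `4N₁₂`. Since 4 n = q + 1, the term 16 n² cancels q² + 2 q +
  -- 1, and 4 q of the 6 q remain.
  link : ∀ a b → + (64 ℕ.* N₁₂) ≡ + (q ℕ.* q) +ℤ + 1 +ℤ + (6 ℕ.* q) +ℤ + 4 *ℤ a +ℤ + 16 *ℤ b →
         a +ℤ + 4 *ℤ b ≡ + 4 *ℤ (v *ℤ v) +ℤ + 8 *ℤ (u *ℤ v) -ℤ + q
  link a b hyp = ℤP.*-cancelˡ-≡ (+ 4) _ _ (begin
    + 4 *ℤ (a +ℤ + 4 *ℤ b) ≡⟨ f1 a b (+ q) ⟩
    (+ q *ℤ + q +ℤ + 1 +ℤ + 6 *ℤ + q +ℤ + 4 *ℤ a +ℤ + 16 *ℤ b) -ℤ (+ q +ℤ + 1) *ℤ (+ q +ℤ + 1) -ℤ + 4 *ℤ + q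
      ≡⟨ cong₂ (λ x y → x -ℤ y *ℤ y -ℤ + 4 *ℤ + q) lhs q+1≡4n ⟩
    + 16 *ℤ (+ n *ℤ + n +ℤ u *ℤ v +ℤ (v *ℤ v +ℤ u *ℤ v)) -ℤ (+ 4 *ℤ + n) *ℤ (+ 4 *ℤ + n) -ℤ + 4 *ℤ + q ≡⟨ f2 (+ n) u v (+ q) ⟩
    + 4 *ℤ (+ 4 *ℤ (v *ℤ v) +ℤ + 8 *ℤ (u *ℤ v) -ℤ + q)  ∎)
    where
    open ≡-Reasoning
    f1 : ∀ a b q → + 4 *ℤ (a +ℤ + 4 *ℤ b) ≡ (q *ℤ q +ℤ + 1 +ℤ + 6 *ℤ q +ℤ + 4 *ℤ a +ℤ + 16 *ℤ b) -ℤ (q +ℤ + 1) *ℤ (q +ℤ + 1) -ℤ + 4 *ℤ q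
    f1 = solve-∀
    f2 : ∀ n u v q → + 16 *ℤ (n *ℤ n +ℤ u *ℤ v +ℤ (v *ℤ v +ℤ u *ℤ v)) -ℤ (+ 4 *ℤ n) *ℤ (+ 4 *ℤ n) -ℤ + 4 *ℤ q ≡ + 4 *ℤ (+ 4 *ℤ (v *ℤ v) +ℤ + 8 *ℤ (u *ℤ v) -ℤ q)
    f2 = solve-∀
    f3 : ∀ x → + 64 *ℤ x ≡ + 16 *ℤ (+ 4 *ℤ x)
    f3 = solve-∀
    lhs : + q *ℤ + q +ℤ + 1 +ℤ + 6 *ℤ + q +ℤ + 4 *ℤ a +ℤ + 16 *ℤ b ≡ + 16 *ℤ (+ n *ℤ + n +ℤ u *ℤ v +ℤ (v *ℤ v +ℤ u *ℤ v))
    lhs = trans (cong₂ (λ x y → x +ℤ + 1 +ℤ y +ℤ + 4 *ℤ a +ℤ + 16 *ℤ b) (sym (ℤP.pos-* q q)) (sym (ℤP.pos-* 6 q)))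
      (trans (sym hyp) (trans (ℤP.pos-* 64 N₁₂) (trans (f3 (+ N₁₂)) (cong (+ 16 *ℤ_) 4N₁₂))))

  -- Unions of lines

  4∣q+1 : 4 ∣ suc q
  4∣q+1 = divides n (trans [q+1]≡4n (ℕP.*-comm 4 n))

  q+1∣M : suc q ∣ M
  q+1∣M = divides r M≡r*[q+1]

  -- The indicator of m of the 2 m + 1 lines in quartic class c; nothing else about the choice of
  -- lines enters later.
  record LinePart (c : ℕ) (β : Carrier → ℤ) : Set where
    field
      β-0       : β 0# ≡ + 0
      β-even    : Even β
      β-idem    : ∀ x → β x *ℤ β x ≡ β x
      β-support : ∀ x → β x *ℤ c4 c x ≡ β x
      β-sum     : ΣF β ≡ + r *ℤ + m

  LU : List ℕ → Carrier → ℤ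
  LU js = 𝟙 ∘ CycUnion (suc q) js

  module _ (c : ℕ) (js : List ℕ) (in-class : ∀ j → j ∈ js → j % 4 ≡ c % 4)
           (uniq : Unique (map (_% suc q) js)) (len : length js ≡ m) where
    private
      D : ℕ
      D = suc q

      ds : List ℕ
      ds = map (_% D) js

      at : ∀ j → LU js (pow ω j) ≡ 𝟙 (any ((j % D) ≡ᵇ_) ds)
      at j = cong 𝟙 (trans (any-cong (λ i → Cyc-pow D q+1∣M i j) js) (any-map ((j % D) ≡ᵇ_) (_% D) js))

      at-zero : LU js 0# ≡ + 0
      at-zero = cong 𝟙 (any-false _ js (λ i _ → Cyc-0 D i))

      on-log : (P : Carrier → Set) → P 0# → (∀ j → P (pow ω j)) → ∀ x → P x
      on-log P p0 pj x = go (x ≟ 0#)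
        where
        go : Dec (x ≡ 0#) → P x
        go (yes z) = subst P (sym z) p0
        go (no nz) = subst P (proj₂ (proj₂ (log x nz))) (pj (proj₁ (log x nz)))

      ds-class : ∀ d → d ∈ ds → d % 4 ≡ c % 4
      ds-class d d∈ = go (∈-map⁻ (_% D) d∈)
        where
        go : (∃ λ i → i ∈ js × d ≡ i % D) → d % 4 ≡ c % 4
        go (i , i∈ , e) = trans (cong (_% 4) e) (trans (m∣n⇒o%n%m≡o%m 4 D i 4∣q+1) (in-class i i∈))

      ds-< : All (ℕ._< D) ds
      ds-< = All.tabulate (λ {d} d∈ → below d d∈)
        where
        below : ∀ d → d ∈ ds → d ℕ.< D
        below d d∈ = go (∈-map⁻ (_% D) d∈)
          where
          go : (∃ λ i → i ∈ js × d ≡ i % D) → d ℕ.< D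
          go (i , _ , e) = subst (ℕ._< D) (sym e) (m%n<n i D)

    linePart : LinePart c (LU js)
    linePart = record
      { β-0       = at-zero
      ; β-even    = on-log (λ x → LU js (N * x) ≡ LU js x) (cong (LU js) (zeroʳ N))
                      (λ j → trans (cong (LU js) (sym (pow-+ ω D j))) (trans (at (D ℕ.+ j)) (trans (cong (λ z → 𝟙 (any (z ≡ᵇ_) ds)) (shift j)) (sym (at j)))))
      ; β-idem    = λ x → 𝟙-idem (CycUnion D js x)
      ; β-support = on-log (λ x → LU js x *ℤ c4 c x ≡ LU js x) (trans (cong (_*ℤ c4 c 0#) at-zero) (sym at-zero))
                      (λ j → support j)
      ; β-sum     = trans (Σ-pow (LU js)) (trans (cong₂ _+ℤ_ at-zero
                      (trans (∑<-cong M at) (trans (cong (λ M → ∑< M f) M≡r*[q+1]) (trans (∑<-periodic D r f (λ i t → cong (λ z → 𝟙 (any (z ≡ᵇ_) ds)) ([m+kn]%n≡m%n i t D)))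
                        (cong (+ r *ℤ_) (trans (∑<-cong-< D (λ i i<D → cong (λ z → 𝟙 (any (z ≡ᵇ_) ds)) (m<n⇒m%n≡m i<D)))
                          (trans (∑<-members D ds uniq ds-<) (cong +_ (trans (length-map (_% D) js) len)))))))))
                      (ℤP.+-identityˡ _))
      }
      where
      f : ℕ → ℤ
      f j = 𝟙 (any ((j % D) ≡ᵇ_) ds)
      shift : ∀ j → (D ℕ.+ j) % D ≡ j % D
      shift j = trans (cong (_% D) (trans (ℕP.+-comm D j) (cong (j ℕ.+_) (sym (ℕP.*-identityˡ D))))) ([m+kn]%n≡m%n j 1 D)
      support : ∀ j → LU js (pow ω j) *ℤ c4 c (pow ω j) ≡ LU js (pow ω j)
      support j = trans (cong₂ _*ℤ_ (at j) (cong 𝟙 (Cyc-pow 4 4∣M c j))) (trans (go ((j % 4) ≡ᵇ (c % 4)) refl) (sym (at j)))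
        where
        go : ∀ b → ((j % 4) ≡ᵇ (c % 4)) ≡ b → f j *ℤ 𝟙 b ≡ f j
        go true  _  = ℤP.*-identityʳ (f j)
        go false e′ = trans (ℤP.*-zeroʳ (f j)) (sym (cong 𝟙 (any-false _ ds (λ d d∈ → ≢⇒≡ᵇ-false (off d d∈)))))
          where
          off : ∀ d → d ∈ ds → j % D ≢ d
          off d d∈ eq = true≢false (trans (sym e′) (trans (cong (_≡ᵇ (c % 4)) (trans (sym (m∣n⇒o%n%m≡o%m 4 D j 4∣q+1)) (trans (cong
              (_% 4) eq) (ds-class d d∈)))) (≡ᵇ-refl (c % 4))))
            where
            true≢false : false ≡ true → ⊥
            true≢false ()

  -- Agreement with a progression modulo q + 1 suffices. This covers the reduced lists of E_0 and
  -- E_1 as well as those of E_2 and E_3, where 1 is added after the reduction.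
  progressionPart : ∀ c c₀ (g : ℕ → ℕ) → (∀ i → g i % suc q ≡ (c₀ ℕ.+ 4 ℕ.* i) % suc q) → c₀ % 4 ≡ c % 4 →
                    LinePart c (LU (map g (upTo m)))
  progressionPart c c₀ g g≡ c≡ = linePart c (map g (upTo m)) in-class uniq (trans (length-map g (upTo m)) (length-upTo m))
    where
    m<n : m ℕ.< n
    m<n = subst (m ℕ.<_) (ℕP.+-comm 1 (2 ℕ.* m)) (s≤s (ℕP.m≤m+n m (m ℕ.+ 0)))
    in-class : ∀ j → j ∈ map g (upTo m) → j % 4 ≡ c % 4
    in-class j j∈ = go (∈-map⁻ g j∈)
      where
      go : (∃ λ i → i ∈ upTo m × j ≡ g i) → j % 4 ≡ c % 4
      go (i , _ , e) = trans (cong (_% 4) e) (trans (sym (m∣n⇒o%n%m≡o%m 4 (suc q) (g i) 4∣q+1)) (trans (cong (_% 4) (g≡ i))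
          (trans (m∣n⇒o%n%m≡o%m 4 (suc q) (c₀ ℕ.+ 4 ℕ.* i) 4∣q+1) (trans (trans (cong (λ z → (c₀ ℕ.+ z) % 4) (ℕP.*-comm 4 i)) ([m+kn]%n≡m%n c₀ i 4)) c≡))))
    uniq : Unique (map (_% suc q) (map g (upTo m)))
    uniq = subst Unique (trans (sym (map-upTo ((_% suc q) ∘ g) m)) (map-∘ (upTo m)))
      (UP.applyUpTo⁺₁ ((_% suc q) ∘ g) m (λ {i} {j} i<j j<m e → progression-injective (suc q) n [q+1]≡4n c₀ i<j (ℕP.<-trans j<m m<n)
        (trans (sym (g≡ i)) (trans e (g≡ j)))))

  -- Even and odd parts of a single block

  nz : Carrier → ℤ
  nz x = 𝟙 (not (does (x ≟ 0#)))

  nz-table : HasTable nz (λ _ → + 1)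
  nz-table = table (cong (𝟙 ∘ not) (dec-true (0# ≟ 0#) refl))
    (λ i t → cong (𝟙 ∘ not) (dec-false (pow ω (i ℕ.+ t ℕ.* 8) ≟ 0#) (pow-nonzero (i ℕ.+ t ℕ.* 8) ω≢0)))

  nz-absorb : ∀ (f : Carrier → ℤ) → f 0# ≡ + 0 → ∀ x → nz x *ℤ f x ≡ f x
  nz-absorb f f0 x = go (x ≟ 0#)
    where
    go : (d : Dec (x ≡ 0#)) → 𝟙 (not (does d)) *ℤ f x ≡ f x
    go (yes refl) = sym f0
    go (no _)     = ℤP.*-identityˡ (f x)

  nz≡1 : ∀ {x} → x ≢ 0# → nz x ≡ + 1
  nz≡1 {x} x≢0 = cong (𝟙 ∘ not) (dec-false (x ≟ 0#) x≢0)

  Σ-nz : ΣF nz ≡ + r *ℤ (+ 4 *ℤ + n)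
  Σ-nz = trans (table-Σ nz-table) (trans (cong (_*ℤ + 8) o≡) (trans (f (+ h) (+ n)) (cong (_*ℤ (+ 4 *ℤ + n)) (sym r≡h+h))))
    where
    f : ∀ h n → (h *ℤ n) *ℤ + 8 ≡ (h +ℤ h) *ℤ (+ 4 *ℤ n)
    f = solve-∀

  n≡2m+1 : + n ≡ + 2 *ℤ + m +ℤ + 1
  n≡2m+1 = trans (ℤP.pos-+ (2 ℕ.* m) 1) (cong (_+ℤ + 1) (ℤP.pos-* 2 m))

  q≡4n-1 : + q ≡ + 4 *ℤ + n -ℤ + 1
  q≡4n-1 = trans (f (+ q)) (cong (_-ℤ + 1) q+1≡4n)
    where
    f : ∀ q → q ≡ (q +ℤ + 1) -ℤ + 1
    f = solve-∀

  q≡3n+2m : + q ≡ + 3 *ℤ + n +ℤ + 2 *ℤ + m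
  q≡3n+2m = trans q≡4n-1 (trans (f1 (+ n)) (trans (cong (λ z → + 3 *ℤ + n +ℤ (z -ℤ + 1)) n≡2m+1) (f2 (+ n) (+ m))))
    where
    f1 : ∀ n → + 4 *ℤ n -ℤ + 1 ≡ + 3 *ℤ n +ℤ (n -ℤ + 1)
    f1 = solve-∀
    f2 : ∀ n m → + 3 *ℤ n +ℤ (+ 2 *ℤ m +ℤ + 1 -ℤ + 1) ≡ + 3 *ℤ n +ℤ + 2 *ℤ m
    f2 = solve-∀

  -- α is the octic part and β the line part of a block. By `α-sym`, α and its reflection cover all
  -- quartic classes but c exactly once, and the lines lie in class c. At nonzero points P is
  -- therefore 1 off class c and 0 or 2 on it.
  record Splits (f : Carrier → ℤ) (c : ℕ) (a : ℕ → ℤ) : Set where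
    field
      α β     : Carrier → ℤ
      split   : ∀ x → f x ≡ α x +ℤ β x
      α-table : HasTable α a
      line    : LinePart c β
      α-sym   : Agree8 (λ j → a j +ℤ a (4 ℕ.+ j)) (λ j → + 1 -ℤ 𝟙 ((j % 4) ≡ᵇ (c % 4)))
      c<4     : c ℕ.< 4
      sum-c   : ∑< 8 (λ j → 𝟙 ((j % 4) ≡ᵇ (c % 4))) ≡ + 2
    open LinePart line public

    P H : Carrier → ℤ
    P x = f x +ℤ f (- x)
    H x = f x -ℤ f (- x)

    P-form : ∀ x → P x ≡ nz x -ℤ c4 c x +ℤ + 2 *ℤ β x
    P-form x = trans (cong₂ _+ℤ_ (split x) (trans (split (- x)) (cong (α (- x) +ℤ_) (Even-neg {β} β-even x))))
      (trans (shuffle (α x) (α (- x)) (β x)) (cong (_+ℤ (+ 2 *ℤ β x)) (table-≗ (table-+ α-table (neg-table α-table)) (table-- nz-table (cyc4-table c)) α-sym x)))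
      where
      shuffle : ∀ a a′ b → (a +ℤ b) +ℤ (a′ +ℤ b) ≡ (a +ℤ a′) +ℤ + 2 *ℤ b
      shuffle = solve-∀

    nz-even : Even nz
    nz-even = table-Even nz-table all≡

    P-even : Even P
    P-even x = trans (P-form (N * x)) (trans (cong₂ _+ℤ_ (cong₂ _-ℤ_ (nz-even x) (c4-even c c<4 x)) (cong (+ 2 *ℤ_) (β-even x))) (sym (P-form x)))

    P-0 : P 0# ≡ + 0
    P-0 = trans (P-form 0#) (cong₂ _+ℤ_ (cong₂ _-ℤ_ (at-0 nz-table) (at-0 (cyc4-table c))) (cong (+ 2 *ℤ_) β-0))

    Σ-P : ΣF P ≡ + r *ℤ + q
    Σ-P = begin
      ΣF P ≡⟨ ∑-cong elems (λ x → trans (P-form x) (rearr (nz x) (c4 c x) (β x))) ⟩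
      ΣF (λ x → nz x +ℤ (-ℤ + 1 *ℤ c4 c x +ℤ + 2 *ℤ β x)) ≡⟨ trans (∑-+ elems nz (λ x → -ℤ + 1 *ℤ c4 c x +ℤ + 2 *ℤ β x)) (cong (ΣF nz +ℤ_)
          (trans (∑-+ elems (λ x → -ℤ + 1 *ℤ c4 c x) (λ x → + 2 *ℤ β x)) (cong₂ _+ℤ_ (∑-*ˡ elems (-ℤ + 1) (c4 c)) (∑-*ˡ elems (+ 2) β)))) ⟩
      ΣF nz +ℤ (-ℤ + 1 *ℤ ΣF (c4 c) +ℤ + 2 *ℤ ΣF β) ≡⟨ cong₂ _+ℤ_ Σ-nz (cong₂ (λ a b → -ℤ + 1 *ℤ a +ℤ + 2 *ℤ b) (cyc4-sum c sum-c) β-sum) ⟩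
      + r *ℤ (+ 4 *ℤ + n) +ℤ (-ℤ + 1 *ℤ (+ r *ℤ + n) +ℤ + 2 *ℤ (+ r *ℤ + m)) ≡⟨ collect (+ r) (+ n) (+ m) ⟩
      + r *ℤ (+ 3 *ℤ + n +ℤ + 2 *ℤ + m) ≡⟨ cong (+ r *ℤ_) (sym q≡3n+2m) ⟩
      + r *ℤ + q  ∎
      where
      open ≡-Reasoning
      rearr : ∀ z t b → z -ℤ t +ℤ + 2 *ℤ b ≡ z +ℤ (-ℤ + 1 *ℤ t +ℤ + 2 *ℤ b)
      rearr = solve-∀
      collect : ∀ r n m → r *ℤ (+ 4 *ℤ n) +ℤ (-ℤ + 1 *ℤ (r *ℤ n) +ℤ + 2 *ℤ (r *ℤ m)) ≡ r *ℤ (+ 3 *ℤ n +ℤ + 2 *ℤ m)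
      collect = solve-∀

    P² : ∀ x → P x *ℤ P x ≡ P x +ℤ + 2 *ℤ β x
    P² x = begin
      P x *ℤ P x ≡⟨ cong (λ w → w *ℤ w) (P-form x) ⟩
      (z -ℤ t +ℤ + 2 *ℤ b) *ℤ (z -ℤ t +ℤ + 2 *ℤ b) ≡⟨ expand z t b ⟩
      z *ℤ z +ℤ t *ℤ t +ℤ + 4 *ℤ (b *ℤ b) -ℤ + 2 *ℤ (z *ℤ t) +ℤ + 4 *ℤ (z *ℤ b) -ℤ + 4 *ℤ (b *ℤ t)
        ≡⟨ cong₂ _-ℤ_ (cong₂ _+ℤ_ (cong₂ _-ℤ_ (cong₂ _+ℤ_ (cong₂ _+ℤ_ (𝟙-idem (not (does (x ≟ 0#)))) (𝟙-idem (Cyc 4 c x))) (cong (+ 4 *ℤ_) (β-idem x)))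
             (cong (+ 2 *ℤ_) (nz-absorb (c4 c) (at-0 (cyc4-table c)) x))) (cong (+ 4 *ℤ_) (nz-absorb β β-0 x))) (cong (+ 4 *ℤ_) (β-support x)) ⟩
      z +ℤ t +ℤ + 4 *ℤ b -ℤ + 2 *ℤ t +ℤ + 4 *ℤ b -ℤ + 4 *ℤ b ≡⟨ simp z t b ⟩
      (z -ℤ t +ℤ + 2 *ℤ b) +ℤ + 2 *ℤ b ≡⟨ cong (_+ℤ (+ 2 *ℤ b)) (sym (P-form x)) ⟩
      P x +ℤ + 2 *ℤ β x ∎
      where
      open ≡-Reasoning
      z = nz x
      t = c4 c x
      b = β x
      expand : ∀ z t b → (z -ℤ t +ℤ + 2 *ℤ b) *ℤ (z -ℤ t +ℤ + 2 *ℤ b) ≡ z *ℤ z +ℤ t *ℤ t +ℤ + 4 *ℤ (b *ℤ b) -ℤ + 2 *ℤ (z *ℤ t) +ℤ + 4 *ℤ (z *ℤ b) -ℤ + 4 *ℤ (b *ℤ t)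
      expand = solve-∀
      simp : ∀ z t b → z +ℤ t +ℤ + 4 *ℤ b -ℤ + 2 *ℤ t +ℤ + 4 *ℤ b -ℤ + 4 *ℤ b ≡ (z -ℤ t +ℤ + 2 *ℤ b) +ℤ + 2 *ℤ b
      simp = solve-∀

    Σ-P² : ΣF (λ x → P x *ℤ P x) ≡ + r *ℤ (+ q +ℤ + 2 *ℤ + m)
    Σ-P² = trans (∑-cong elems P²) (trans (∑-+ elems P (λ x → + 2 *ℤ β x)) (trans (cong₂ _+ℤ_ Σ-P (trans (∑-*ˡ elems (+ 2) β) (cong
        (+ 2 *ℤ_) β-sum))) (collect (+ r) (+ q) (+ m))))
      where
      collect : ∀ r q m → r *ℤ q +ℤ + 2 *ℤ (r *ℤ m) ≡ r *ℤ (q +ℤ + 2 *ℤ m)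
      collect = solve-∀

    -- In the even formula P x occurs only through P² - 2 P = (P - 1)² - 1, and for x ≠ 0 the square
    -- (P - 1)² is the indicator of class c.
    Corr-PP : ∀ x → x ≢ 0# → Corr P P x ≡ + q *ℤ + q -ℤ + 2 *ℤ + q -ℤ + 2 *ℤ + m +ℤ + q *ℤ c4 c x
    Corr-PP x x≢0 = ℤP.*-cancelˡ-≡ (+ r) _ _ (begin
      + r *ℤ C ≡⟨ i≡[j+i]-j S (+ r *ℤ C) ⟩
      (S +ℤ + r *ℤ C) -ℤ S ≡⟨ cong₂ _-ℤ_ (Corr-even-at P-even P-even P-0 P-0 (+ q) (+ q) Σ-P Σ-P x≢0) Σ-P² ⟩
      + r *ℤ ((+ q -ℤ P x) *ℤ + q +ℤ (+ q *ℤ P x -ℤ + q) *ℤ P x) -ℤ + r *ℤ (+ q +ℤ + 2 *ℤ + m) ≡⟨ f2 (+ r) (+ q) (P x) (+ m) ⟩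
      + r *ℤ (+ q *ℤ + q -ℤ + q -ℤ + 2 *ℤ + m +ℤ + q *ℤ (P x *ℤ P x -ℤ + 2 *ℤ P x)) ≡⟨ cong (λ w → + r *ℤ (+ q *ℤ + q -ℤ + q -ℤ + 2 *ℤ + m +ℤ + q *ℤ w)) val ⟩
      + r *ℤ (+ q *ℤ + q -ℤ + q -ℤ + 2 *ℤ + m +ℤ + q *ℤ (c4 c x -ℤ + 1)) ≡⟨ f3 (+ r) (+ q) (c4 c x) (+ m) ⟩
      + r *ℤ (+ q *ℤ + q -ℤ + 2 *ℤ + q -ℤ + 2 *ℤ + m +ℤ + q *ℤ c4 c x) ∎)
      where
      open ≡-Reasoning
      C = Corr P P x
      S = ΣF (λ x → P x *ℤ P x)
      f2 : ∀ r q a m → r *ℤ ((q -ℤ a) *ℤ q +ℤ (q *ℤ a -ℤ q) *ℤ a) -ℤ r *ℤ (q +ℤ + 2 *ℤ m) ≡ r *ℤ (q *ℤ q -ℤ q -ℤ + 2 *ℤ m +ℤ q *ℤ (a *ℤ a -ℤ + 2 *ℤ a))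
      f2 = solve-∀
      f3 : ∀ r q t m → r *ℤ (q *ℤ q -ℤ q -ℤ + 2 *ℤ m +ℤ q *ℤ (t -ℤ + 1)) ≡ r *ℤ (q *ℤ q -ℤ + 2 *ℤ q -ℤ + 2 *ℤ m +ℤ q *ℤ t)
      f3 = solve-∀
      f4 : ∀ t b → ((+ 1 -ℤ t +ℤ + 2 *ℤ b) +ℤ + 2 *ℤ b) -ℤ + 2 *ℤ (+ 1 -ℤ t +ℤ + 2 *ℤ b) ≡ t -ℤ + 1
      f4 = solve-∀
      val : P x *ℤ P x -ℤ + 2 *ℤ P x ≡ c4 c x -ℤ + 1
      val = trans (cong (_-ℤ (+ 2 *ℤ P x)) (P² x)) (trans (cong (λ w → (w +ℤ + 2 *ℤ β x) -ℤ + 2 *ℤ w)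
        (trans (P-form x) (cong (λ z → z -ℤ c4 c x +ℤ + 2 *ℤ β x) (nz≡1 x≢0)))) (f4 (c4 c x) (β x)))

    H-table : HasTable H (odd-values a)
    H-table = table-cong (λ x → sym (trans (cong₂ _-ℤ_ (split x) (trans (split (- x)) (cong (α (- x) +ℤ_) (Even-neg {β} β-even x)))) (shuffle (α x) (α (- x)) (β x))))
                (table-- α-table (neg-table α-table))
      where
      shuffle : ∀ a a′ b → (a +ℤ b) -ℤ (a′ +ℤ b) ≡ a -ℤ a′
      shuffle = solve-∀

    -- N and −1 both have discrete logarithm 4 modulo 8.
    H-odd : Odd H
    H-odd x = trans (table-≗ (N-table H-table) (neg-table H-table) all≡ x) (trans (cong (λ y → f (- x) -ℤ f y) (neg-neg x)) (anti (f (- x)) (f x)))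
      where
      anti : ∀ a b → a -ℤ b ≡ -ℤ (b -ℤ a)
      anti = solve-∀

  open Splits using () renaming (P to Pₛ; H to Hₛ)

  -- Swapping the factors amounts to reflecting both functions. The symmetrised correlation is thus
  -- invariant under simultaneous reflection, and the mixed terms of even and odd parts cancel.
  polarise : ∀ f g x → + 2 *ℤ (Corr f g x +ℤ Corr g f x) ≡ Corr (λ y → f y +ℤ f (- y)) (λ y → g y +ℤ g (- y)) x +ℤ Corr (λ y → f y -ℤ f (- y)) (λ y → g y -ℤ g (- y)) x
  polarise f g x = begin
    + 2 *ℤ (Corr f g x +ℤ Corr g f x) ≡⟨ cong (λ z → + 2 *ℤ (Corr f g x +ℤ z)) (trans (Corr-swap g f x) (Corr-reflect f g x)) ⟩
    + 2 *ℤ (Corr f g x +ℤ Corr (f ∘ -_) (g ∘ -_) x) ≡⟨ cong (+ 2 *ℤ_) (sym (∑-+ elems _ _)) ⟩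
    + 2 *ℤ ΣF (λ h → f h *ℤ g (h - x) +ℤ f (- h) *ℤ g (- (h - x))) ≡⟨ sym (∑-*ˡ elems (+ 2) _) ⟩
    ΣF (λ h → + 2 *ℤ (f h *ℤ g (h - x) +ℤ f (- h) *ℤ g (- (h - x)))) ≡⟨ ∑-cong elems (λ h → pt (f h) (f (- h)) (g (h - x)) (g (- (h - x)))) ⟩
    ΣF (λ h → (f h +ℤ f (- h)) *ℤ (g (h - x) +ℤ g (- (h - x))) +ℤ (f h -ℤ f (- h)) *ℤ (g (h - x) -ℤ g (- (h - x)))) ≡⟨ ∑-+ elems _ _ ⟩
    _ ∎
    where
    open ≡-Reasoning
    pt : ∀ a b c d → + 2 *ℤ (a *ℤ c +ℤ b *ℤ d) ≡ (a +ℤ b) *ℤ (c +ℤ d) +ℤ (a -ℤ b) *ℤ (c -ℤ d)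
    pt = solve-∀

  module _ {f g c c′ a a′} (sf : Splits f c a) (sg : Splits g c′ a′) (disjoint : ∀ x → c4 c x *ℤ c4 c′ x ≡ + 0) where
    private
      module f = Splits sf
      module g = Splits sg

      -- At nonzero points P - 1 is supported on class c and P′ - 1 on class c′, so their product
      -- vanishes.
      PP′ : ∀ x → f.P x *ℤ g.P x ≡ f.P x +ℤ g.P x -ℤ nz x
      PP′ x = begin
        f.P x *ℤ g.P x ≡⟨ cong₂ _*ℤ_ (f.P-form x) (g.P-form x) ⟩
        (z -ℤ t +ℤ + 2 *ℤ b) *ℤ (z -ℤ t′ +ℤ + 2 *ℤ b′) ≡⟨ expand z t b t′ b′ ⟩
        z *ℤ z -ℤ z *ℤ t′ +ℤ + 2 *ℤ (z *ℤ b′) -ℤ z *ℤ t +ℤ + 2 *ℤ (z *ℤ b) +ℤ t *ℤ t′ -ℤ + 2 *ℤ (t *ℤ b′) -ℤ + 2 *ℤ (b *ℤ t′) +ℤ + 4 *ℤ (b *ℤ b′)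
          ≡⟨ cong₂ _+ℤ_ (cong₂ _-ℤ_ (cong₂ _-ℤ_ (cong₂ _+ℤ_ (cong₂ _+ℤ_ (cong₂ _-ℤ_ (cong₂ _+ℤ_ (cong₂ _-ℤ_ (𝟙-idem (not (does (x ≟ 0#))))
              (nz-absorb (c4 c′) (at-0 (cyc4-table c′)) x))
               (cong (+ 2 *ℤ_) (nz-absorb g.β g.β-0 x))) (nz-absorb (c4 c) (at-0 (cyc4-table c)) x)) (cong (+ 2 *ℤ_)
                   (nz-absorb f.β f.β-0 x))) (disjoint x)) (cong (+ 2 *ℤ_) tb′)) (cong (+ 2 *ℤ_) bt′)) (cong (+ 4 *ℤ_) bb′) ⟩
        z -ℤ t′ +ℤ + 2 *ℤ b′ -ℤ t +ℤ + 2 *ℤ b +ℤ + 0 -ℤ + 2 *ℤ + 0 -ℤ + 2 *ℤ + 0 +ℤ + 4 *ℤ + 0 ≡⟨ simp z t b t′ b′ ⟩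
        (z -ℤ t +ℤ + 2 *ℤ b) +ℤ (z -ℤ t′ +ℤ + 2 *ℤ b′) -ℤ z ≡⟨ cong₂ (λ x y → x +ℤ y -ℤ z) (sym (f.P-form x)) (sym (g.P-form x)) ⟩
        f.P x +ℤ g.P x -ℤ nz x  ∎
        where
        open ≡-Reasoning
        z = nz x
        t = c4 c x
        t′ = c4 c′ x
        b = f.β x
        b′ = g.β x
        expand : ∀ z t b t′ b′ → (z -ℤ t +ℤ + 2 *ℤ b) *ℤ (z -ℤ t′ +ℤ + 2 *ℤ b′) ≡
          z *ℤ z -ℤ z *ℤ t′ +ℤ + 2 *ℤ (z *ℤ b′) -ℤ z *ℤ t +ℤ + 2 *ℤ (z *ℤ b) +ℤ t *ℤ t′ -ℤ + 2 *ℤ (t *ℤ b′) -ℤ + 2 *ℤ (b *ℤ t′) +ℤ + 4 *ℤ (b *ℤ b′)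
        expand = solve-∀
        simp : ∀ z t b t′ b′ → z -ℤ t′ +ℤ + 2 *ℤ b′ -ℤ t +ℤ + 2 *ℤ b +ℤ + 0 -ℤ + 2 *ℤ + 0 -ℤ + 2 *ℤ + 0 +ℤ + 4 *ℤ + 0 ≡ (z -ℤ t +ℤ + 2 *ℤ b) +ℤ (z -ℤ t′ +ℤ + 2 *ℤ b′) -ℤ z
        simp = solve-∀
        tb′ : t *ℤ b′ ≡ + 0
        tb′ = trans (cong (t *ℤ_) (sym (g.β-support x))) (trans (i*jk≡j*ik t b′ t′) (trans (cong (b′ *ℤ_) (disjoint x)) (ℤP.*-zeroʳ b′)))
        bt′ : b *ℤ t′ ≡ + 0
        bt′ = trans (cong (_*ℤ t′) (sym (f.β-support x))) (trans (ℤP.*-assoc b t t′) (trans (cong (b *ℤ_) (disjoint x)) (ℤP.*-zeroʳ b)))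
        bb′ : b *ℤ b′ ≡ + 0
        bb′ = trans (cong (_*ℤ b′) (sym (f.β-support x))) (trans (ℤP.*-assoc b t b′) (trans (cong (b *ℤ_) tb′) (ℤP.*-zeroʳ b)))

      Σ-PP′ : ΣF (λ x → f.P x *ℤ g.P x) ≡ + r *ℤ + r
      Σ-PP′ = begin
        ΣF (λ x → f.P x *ℤ g.P x) ≡⟨ ∑-cong elems (λ x → trans (PP′ x) (rearr (f.P x) (g.P x) (nz x))) ⟩
        ΣF (λ x → f.P x +ℤ (g.P x +ℤ -ℤ + 1 *ℤ nz x)) ≡⟨ trans (∑-+ elems f.P (λ x → g.P x +ℤ -ℤ + 1 *ℤ nz x)) (cong (ΣF f.P +ℤ_) (trans
            (∑-+ elems g.P (λ x → -ℤ + 1 *ℤ nz x)) (cong (ΣF g.P +ℤ_) (∑-*ˡ elems (-ℤ + 1) nz)))) ⟩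
        ΣF f.P +ℤ (ΣF g.P +ℤ -ℤ + 1 *ℤ ΣF nz) ≡⟨ cong₂ _+ℤ_ f.Σ-P (cong₂ (λ a b → a +ℤ -ℤ + 1 *ℤ b) g.Σ-P (trans Σ-nz (cong (+ r *ℤ_) (sym q+1≡4n)))) ⟩
        + r *ℤ + q +ℤ (+ r *ℤ + q +ℤ -ℤ + 1 *ℤ (+ r *ℤ (+ q +ℤ + 1))) ≡⟨ collect (+ r) ⟩
        + r *ℤ + r  ∎
        where
        open ≡-Reasoning
        rearr : ∀ x y z → x +ℤ y -ℤ z ≡ x +ℤ (y +ℤ -ℤ + 1 *ℤ z)
        rearr = solve-∀
        collect : ∀ r → r *ℤ (+ 1 +ℤ r) +ℤ (r *ℤ (+ 1 +ℤ r) +ℤ -ℤ + 1 *ℤ (r *ℤ (+ 1 +ℤ r +ℤ + 1))) ≡ r *ℤ r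
        collect = solve-∀

    -- Once P x P′ x is replaced by P x + P′ x - 1, the values at x cancel and q² - q - r = r² is
    -- left. At 0 the same number is the sum of the products.
    Corr-PP′ : ∀ x → Corr f.P g.P x ≡ + r *ℤ + r
    Corr-PP′ x = go (x ≟ 0#)
      where
      open ≡-Reasoning
      f2 : ∀ r q x y z → r *ℤ ((q -ℤ y) *ℤ q +ℤ (q *ℤ y -ℤ q) *ℤ x) -ℤ r *ℤ z ≡ r *ℤ (q *ℤ q -ℤ q *ℤ x -ℤ q *ℤ y +ℤ q *ℤ (x *ℤ y) -ℤ z)
      f2 = solve-∀
      f3 : ∀ r x y → (+ 1 +ℤ r) *ℤ (+ 1 +ℤ r) -ℤ (+ 1 +ℤ r) *ℤ x -ℤ (+ 1 +ℤ r) *ℤ y +ℤ (+ 1 +ℤ r) *ℤ (x +ℤ y -ℤ + 1) -ℤ r ≡ r *ℤ r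
      f3 = solve-∀
      go : Dec (x ≡ 0#) → Corr f.P g.P x ≡ + r *ℤ + r
      go (yes z) = trans (cong (Corr f.P g.P) z) (trans (Corr-0 f.P g.P) Σ-PP′)
      go (no nz′) = ℤP.*-cancelˡ-≡ (+ r) _ _ (begin
        + r *ℤ C ≡⟨ i≡[j+i]-j S (+ r *ℤ C) ⟩
        (S +ℤ + r *ℤ C) -ℤ S ≡⟨ cong₂ _-ℤ_ (Corr-even-at f.P-even g.P-even f.P-0 g.P-0 (+ q) (+ q) f.Σ-P g.Σ-P nz′) Σ-PP′ ⟩
        + r *ℤ ((+ q -ℤ g.P x) *ℤ + q +ℤ (+ q *ℤ g.P x -ℤ + q) *ℤ f.P x) -ℤ + r *ℤ + r ≡⟨ f2 (+ r) (+ q) (f.P x) (g.P x) (+ r) ⟩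
        + r *ℤ (+ q *ℤ + q -ℤ + q *ℤ f.P x -ℤ + q *ℤ g.P x +ℤ + q *ℤ (f.P x *ℤ g.P x) -ℤ + r)
          ≡⟨ cong (λ w → + r *ℤ (+ q *ℤ + q -ℤ + q *ℤ f.P x -ℤ + q *ℤ g.P x +ℤ + q *ℤ w -ℤ + r)) (trans (PP′ x) (cong (λ w → f.P x +ℤ g.P x -ℤ w) (nz≡1 nz′))) ⟩
        + r *ℤ (+ q *ℤ + q -ℤ + q *ℤ f.P x -ℤ + q *ℤ g.P x +ℤ + q *ℤ (f.P x +ℤ g.P x -ℤ + 1) -ℤ + r) ≡⟨ cong (+ r *ℤ_) (f3 (+ r) (f.P x) (g.P x)) ⟩
        + r *ℤ (+ r *ℤ + r)  ∎)
        where
        C = Corr f.P g.P x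
        S = ΣF (λ x → f.P x *ℤ g.P x)

    pair-Corr : ∀ x → + 2 *ℤ (Corr f g x +ℤ Corr g f x) ≡ + r *ℤ + r +ℤ Corr f.H g.H x
    pair-Corr x = trans (polarise f g x) (cong (_+ℤ Corr f.H g.H x) (Corr-PP′ x))

  -- Correlations of the four blocks together

  value : Coefficients → ℤ
  value (a , b , c , d) = a *ℤ (u *ℤ u) +ℤ b *ℤ (u *ℤ v) +ℤ c *ℤ (v *ℤ v) -ℤ d *ℤ + n

  value-⊞ : ∀ x y → value x +ℤ value y ≡ value (x ⊞ y)
  value-⊞ (a , b , c , d) (a′ , b′ , c′ , d′) = collect a b c d a′ b′ c′ d′ (u *ℤ u) (u *ℤ v) (v *ℤ v) (+ n)
    where
    collect : ∀ a b c d a′ b′ c′ d′ x y z n →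
      (a *ℤ x +ℤ b *ℤ y +ℤ c *ℤ z -ℤ d *ℤ n) +ℤ (a′ *ℤ x +ℤ b′ *ℤ y +ℤ c′ *ℤ z -ℤ d′ *ℤ n)
      ≡ (a +ℤ a′) *ℤ x +ℤ (b +ℤ b′) *ℤ y +ℤ (c +ℤ c′) *ℤ z -ℤ (d +ℤ d′) *ℤ n
    collect = solve-∀

  Corr-value : ∀ {f g w w′} → HasTable f w → HasTable g w′ → Odd f → Odd g → ∀ s t →
    Corr f g (pow ω (s ℕ.+ t ℕ.* 8)) ≡ value (coefs (λ j → w (s ℕ.+ j)) (λ j → w′ (s ℕ.+ j)))
  Corr-value {w = w} {w′} tf tg of og s t = trans (Corr-odd-table-at tf tg of og s t)
    (expand (W 1 -ℤ W 3) (W 2) (W′ 1 -ℤ W′ 3) (W′ 2) u v (+ n) (dot W W′))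
    where
    W W′ : ℕ → ℤ
    W j = w (s ℕ.+ j)
    W′ j = w′ (s ℕ.+ j)
    expand : ∀ a b a′ b′ u v n d → (a *ℤ v +ℤ b *ℤ u) *ℤ (a′ *ℤ v +ℤ b′ *ℤ u) -ℤ n *ℤ d ≡
      (b *ℤ b′) *ℤ (u *ℤ u) +ℤ (a *ℤ b′ +ℤ b *ℤ a′) *ℤ (u *ℤ v) +ℤ (a *ℤ a′) *ℤ (v *ℤ v) -ℤ d *ℤ n
    expand = solve-∀

  d : Carrier → ℤ
  d x = 𝟙 (CycUnion 4 (0 ∷ 1 ∷ []) x) -ℤ 𝟙 (CycUnion 4 (2 ∷ 3 ∷ []) x)

  cycUnion4-table : ∀ is → HasTable (𝟙 ∘ CycUnion 4 is) (λ j → 𝟙 (any (λ i → (j % 4) ≡ᵇ (i % 4)) is))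
  cycUnion4-table is = table (cong 𝟙 (any-false _ is (λ i _ → Cyc-0 4 i)))
    (λ j t → cong 𝟙 (any-cong (λ i → trans (Cyc-pow 4 4∣M i (j ℕ.+ t ℕ.* 8)) (cong (_≡ᵇ (i % 4))
      (trans (cong (λ z → (j ℕ.+ z) % 4) (sym (ℕP.*-assoc t 2 4))) ([m+kn]%n≡m%n j (t ℕ.* 2) 4)))) is))

  d-table : HasTable d signD
  d-table = table-- (cycUnion4-table (0 ∷ 1 ∷ [])) (cycUnion4-table (2 ∷ 3 ∷ []))

  c4-disjoint : ∀ i j → Agree8 (λ l → 𝟙 ((l % 4) ≡ᵇ (i % 4)) *ℤ 𝟙 ((l % 4) ≡ᵇ (j % 4))) (λ _ → + 0) → ∀ x → c4 i x *ℤ c4 j x ≡ + 0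
  c4-disjoint i j ag = table-≗ (table-* (cyc4-table i) (cyc4-table j)) (table refl (λ _ _ → refl)) ag

  -- The missing quartic classes of the four blocks are 1, 3, 2, 0. They are distinct within each
  -- pair, as `pair-Corr` requires, and together cover everything but 0, as `auto-Corr` requires.
  module Family {f₀ f₁ f₂ f₃ a₀ a₁ a₂ a₃ σ} (s₀ : Splits f₀ 1 a₀) (s₁ : Splits f₁ 3 a₁) (s₂ : Splits f₂ 2 a₂) (s₃ : Splits f₃ 0 a₃)
                (pat : Pattern a₀ a₁ a₂ a₃ σ) (norm-4 : u *ℤ u +ℤ (-ℤ + 2 *ℤ σ) *ℤ (u *ℤ v) +ℤ v *ℤ v ≡ + 4) where
    private
      module A = Splits s₀
      module B = Splits s₁
      module C = Splits s₂
      module D = Splits s₃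
      open Pattern pat
      h₀ = shifted a₀
      h₁ = shifted a₁
      h₂ = shifted a₂
      h₃ = shifted a₃

      HH : Carrier → ℤ
      HH x = Corr A.H B.H x +ℤ Corr C.H D.H x

      -- On a nonzero element `cross` leaves the sign of its class times the quadratic form in
      -- `norm-4`. At 0 the correlations are multiples of the dot products, whose sum is 0 by the
      -- same field.
      HH≡4d : ∀ x → HH x ≡ + 4 *ℤ d x
      HH≡4d = residue-induction _ at-zero at
        where
        open ≡-Reasoning
        dots : ∀ x y → + r *ℤ (+ n *ℤ x) +ℤ + r *ℤ (+ n *ℤ y) ≡ + r *ℤ (+ n *ℤ (x +ℤ y))
        dots = dots′ (+ r) (+ n)
          where
          dots′ : ∀ r n x y → r *ℤ (n *ℤ x) +ℤ r *ℤ (n *ℤ y) ≡ r *ℤ (n *ℤ (x +ℤ y))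
          dots′ = solve-∀
        dot-0 : dot (odd-values a₀) (odd-values a₁) +ℤ dot (odd-values a₂) (odd-values a₃) ≡ + 0
        dot-0 = cong (proj₂ ∘ proj₂ ∘ proj₂) (cross 0 (s≤s z≤n))
        at-zero : HH 0# ≡ + 4 *ℤ d 0#
        at-zero = begin
          HH 0# ≡⟨ cong₂ _+ℤ_ (trans (Corr-0 A.H B.H) (Σ-odd-product A.H-table B.H-table A.H-odd B.H-odd))
                              (trans (Corr-0 C.H D.H) (Σ-odd-product C.H-table D.H-table C.H-odd D.H-odd)) ⟩
          + r *ℤ (+ n *ℤ dot (odd-values a₀) (odd-values a₁)) +ℤ + r *ℤ (+ n *ℤ dot (odd-values a₂) (odd-values a₃)) ≡⟨ dots _ _ ⟩
          + r *ℤ (+ n *ℤ (dot (odd-values a₀) (odd-values a₁) +ℤ dot (odd-values a₂) (odd-values a₃))) ≡⟨ cong (λ z → + r *ℤ (+ n *ℤ z)) dot-0 ⟩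
          + r *ℤ (+ n *ℤ + 0) ≡⟨ trans (cong (+ r *ℤ_) (ℤP.*-zeroʳ (+ n))) (ℤP.*-zeroʳ (+ r)) ⟩
          + 0 ≡⟨ cong (+ 4 *ℤ_) (sym (at-0 d-table)) ⟩
          + 4 *ℤ d 0# ∎
        factor : ∀ s σ x y z n → s *ℤ x +ℤ (s *ℤ σ) *ℤ y +ℤ s *ℤ z -ℤ + 0 *ℤ n ≡ (x +ℤ σ *ℤ y +ℤ z) *ℤ s
        factor = solve-∀
        at : ∀ i t → i ℕ.< 8 → HH (pow ω (i ℕ.+ t ℕ.* 8)) ≡ + 4 *ℤ d (pow ω (i ℕ.+ t ℕ.* 8))
        at i t i<8 = begin
          HH (pow ω (i ℕ.+ t ℕ.* 8)) ≡⟨ cong₂ _+ℤ_ (Corr-value A.H-table B.H-table A.H-odd B.H-odd i t) (Corr-value C.H-table D.H-table C.H-odd D.H-odd i t) ⟩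
          value (coefs (h₀ i) (h₁ i)) +ℤ value (coefs (h₂ i) (h₃ i)) ≡⟨ value-⊞ (coefs (h₀ i) (h₁ i)) (coefs (h₂ i) (h₃ i)) ⟩
          value (coefs (h₀ i) (h₁ i) ⊞ coefs (h₂ i) (h₃ i)) ≡⟨ cong value (cross i i<8) ⟩
          _ ≡⟨ factor (signD i) (-ℤ + 2 *ℤ σ) (u *ℤ u) (u *ℤ v) (v *ℤ v) (+ n) ⟩
          (u *ℤ u +ℤ (-ℤ + 2 *ℤ σ) *ℤ (u *ℤ v) +ℤ v *ℤ v) *ℤ signD i ≡⟨ cong₂ _*ℤ_ norm-4 (sym (at-pow d-table i t)) ⟩
          + 4 *ℤ d (pow ω (i ℕ.+ t ℕ.* 8)) ∎

    cross-Corr : ∀ x → Corr f₀ f₁ x +ℤ Corr f₁ f₀ x +ℤ Corr f₂ f₃ x +ℤ Corr f₃ f₂ x ≡ + r *ℤ + r +ℤ + 2 *ℤ d x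
    cross-Corr x = ℤP.*-cancelˡ-≡ (+ 2) _ _ (begin
      + 2 *ℤ (Corr f₀ f₁ x +ℤ Corr f₁ f₀ x +ℤ Corr f₂ f₃ x +ℤ Corr f₃ f₂ x) ≡⟨ g1 (Corr f₀ f₁ x) (Corr f₁ f₀ x) (Corr f₂ f₃ x) (Corr f₃ f₂ x) ⟩
      + 2 *ℤ (Corr f₀ f₁ x +ℤ Corr f₁ f₀ x) +ℤ + 2 *ℤ (Corr f₂ f₃ x +ℤ Corr f₃ f₂ x)
        ≡⟨ cong₂ _+ℤ_ (pair-Corr s₀ s₁ (c4-disjoint 1 3 all≡) x)
                      (pair-Corr s₂ s₃ (c4-disjoint 2 0 all≡) x) ⟩
      (+ r *ℤ + r +ℤ Corr A.H B.H x) +ℤ (+ r *ℤ + r +ℤ Corr C.H D.H x) ≡⟨ g2 (+ r *ℤ + r) (Corr A.H B.H x) (Corr C.H D.H x) ⟩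
      + 2 *ℤ (+ r *ℤ + r) +ℤ HH x ≡⟨ cong (+ 2 *ℤ (+ r *ℤ + r) +ℤ_) (HH≡4d x) ⟩
      + 2 *ℤ (+ r *ℤ + r) +ℤ + 4 *ℤ d x ≡⟨ g3 (+ r *ℤ + r) (d x) ⟩
      + 2 *ℤ (+ r *ℤ + r +ℤ + 2 *ℤ d x)  ∎)
      where
      open ≡-Reasoning
      g1 : ∀ a b c e → + 2 *ℤ (a +ℤ b +ℤ c +ℤ e) ≡ + 2 *ℤ (a +ℤ b) +ℤ + 2 *ℤ (c +ℤ e)
      g1 = solve-∀
      g2 : ∀ s a b → (s +ℤ a) +ℤ (s +ℤ b) ≡ + 2 *ℤ s +ℤ (a +ℤ b)
      g2 = solve-∀
      g3 : ∀ s a → + 2 *ℤ s +ℤ + 4 *ℤ a ≡ + 2 *ℤ (s +ℤ + 2 *ℤ a)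
      g3 = solve-∀

    -- Four times the sum is 4 (q² - 2 q - 2 m) + q from the even parts, where the four missing
    -- classes add up to 1, plus 3 q - 12 n from the odd parts by `norm`. The relation 3 n + 2 m = q
    -- finishes.
    auto-Corr : ∀ x → x ≢ 0# → Corr f₀ f₀ x +ℤ Corr f₁ f₁ x +ℤ Corr f₂ f₂ x +ℤ Corr f₃ f₃ x ≡ + q *ℤ + q -ℤ + 2 *ℤ + q
    auto-Corr x x≢0 = ℤP.*-cancelˡ-≡ (+ 4) _ _ (begin
      + 4 *ℤ (Corr f₀ f₀ x +ℤ Corr f₁ f₁ x +ℤ Corr f₂ f₂ x +ℤ Corr f₃ f₃ x) ≡⟨ g1 (Corr f₀ f₀ x) (Corr f₁ f₁ x) (Corr f₂ f₂ x) (Corr f₃ f₃ x) ⟩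
      + 2 *ℤ (Corr f₀ f₀ x +ℤ Corr f₀ f₀ x) +ℤ + 2 *ℤ (Corr f₁ f₁ x +ℤ Corr f₁ f₁ x) +ℤ + 2 *ℤ (Corr f₂ f₂ x +ℤ Corr f₂ f₂ x) +ℤ + 2 *ℤ (Corr f₃ f₃ x +ℤ Corr f₃ f₃ x)
        ≡⟨ cong₂ _+ℤ_ (cong₂ _+ℤ_ (cong₂ _+ℤ_ (term s₀) (term s₁)) (term s₂)) (term s₃) ⟩
      (τ +ℤ + q *ℤ c4 1 x +ℤ Corr A.H A.H x) +ℤ (τ +ℤ + q *ℤ c4 3 x +ℤ Corr B.H B.H x) +ℤ (τ +ℤ + q *ℤ c4 2 x +ℤ Corr C.H C.H x) +ℤ (τ +ℤ + q *ℤ c4 0 x +ℤ Corr D.H D.H x)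
        ≡⟨ g2 τ (+ q) (c4 0 x) (c4 1 x) (c4 2 x) (c4 3 x) (Corr A.H A.H x) (Corr B.H B.H x) (Corr C.H C.H x) (Corr D.H D.H x) ⟩
      + 4 *ℤ τ +ℤ + q *ℤ (c4 0 x +ℤ c4 1 x +ℤ c4 2 x +ℤ c4 3 x) +ℤ (Corr A.H A.H x +ℤ Corr B.H B.H x +ℤ Corr C.H C.H x +ℤ Corr D.H D.H x)
        ≡⟨ cong₂ (λ a b → + 4 *ℤ τ +ℤ + q *ℤ a +ℤ b) (trans (all-classes x) (nz≡1 x≢0)) (odd-part (residue x x≢0)) ⟩
      + 4 *ℤ τ +ℤ + q *ℤ + 1 +ℤ (+ 3 *ℤ (u *ℤ u) +ℤ + 0 *ℤ (u *ℤ v) +ℤ + 6 *ℤ (v *ℤ v) -ℤ + 12 *ℤ + n) ≡⟨ g3 (+ q) (+ m) u v (+ n) ⟩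
      + 4 *ℤ (+ q *ℤ + q) -ℤ + 7 *ℤ + q -ℤ + 8 *ℤ + m +ℤ + 3 *ℤ (u *ℤ u +ℤ + 2 *ℤ (v *ℤ v)) -ℤ + 12 *ℤ + n
          ≡⟨ cong (λ w → + 4 *ℤ (+ q *ℤ + q) -ℤ + 7 *ℤ + q -ℤ + 8 *ℤ + m +ℤ + 3 *ℤ w -ℤ + 12 *ℤ + n) (sym norm) ⟩
      + 4 *ℤ (+ q *ℤ + q) -ℤ + 7 *ℤ + q -ℤ + 8 *ℤ + m +ℤ + 3 *ℤ + q -ℤ + 12 *ℤ + n ≡⟨ g4 (+ q) (+ m) (+ n) ⟩
      + 4 *ℤ (+ q *ℤ + q) -ℤ + 4 *ℤ + q -ℤ + 4 *ℤ (+ 3 *ℤ + n +ℤ + 2 *ℤ + m) ≡⟨ cong (λ w → + 4 *ℤ (+ q *ℤ + q) -ℤ + 4 *ℤ + q -ℤ + 4 *ℤ w) (sym q≡3n+2m) ⟩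
      + 4 *ℤ (+ q *ℤ + q) -ℤ + 4 *ℤ + q -ℤ + 4 *ℤ + q ≡⟨ g5 (+ q) ⟩
      + 4 *ℤ (+ q *ℤ + q -ℤ + 2 *ℤ + q)  ∎)
      where
      open ≡-Reasoning
      τ = + q *ℤ + q -ℤ + 2 *ℤ + q -ℤ + 2 *ℤ + m
      g1 : ∀ a b c e → + 4 *ℤ (a +ℤ b +ℤ c +ℤ e) ≡ + 2 *ℤ (a +ℤ a) +ℤ + 2 *ℤ (b +ℤ b) +ℤ + 2 *ℤ (c +ℤ c) +ℤ + 2 *ℤ (e +ℤ e)
      g1 = solve-∀
      g2 : ∀ τ q t0 t1 t2 t3 a b c e → (τ +ℤ q *ℤ t1 +ℤ a) +ℤ (τ +ℤ q *ℤ t3 +ℤ b) +ℤ (τ +ℤ q *ℤ t2 +ℤ c) +ℤ (τ +ℤ q *ℤ t0 +ℤ e)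
         ≡ + 4 *ℤ τ +ℤ q *ℤ (t0 +ℤ t1 +ℤ t2 +ℤ t3) +ℤ (a +ℤ b +ℤ c +ℤ e)
      g2 = solve-∀
      g3 : ∀ q m u v n → + 4 *ℤ (q *ℤ q -ℤ + 2 *ℤ q -ℤ + 2 *ℤ m) +ℤ q *ℤ + 1 +ℤ (+ 3 *ℤ (u *ℤ u) +ℤ + 0 *ℤ (u *ℤ v) +ℤ + 6 *ℤ (v *ℤ v) -ℤ + 12 *ℤ n)
         ≡ + 4 *ℤ (q *ℤ q) -ℤ + 7 *ℤ q -ℤ + 8 *ℤ m +ℤ + 3 *ℤ (u *ℤ u +ℤ + 2 *ℤ (v *ℤ v)) -ℤ + 12 *ℤ n
      g3 = solve-∀
      g4 : ∀ q m n → + 4 *ℤ (q *ℤ q) -ℤ + 7 *ℤ q -ℤ + 8 *ℤ m +ℤ + 3 *ℤ q -ℤ + 12 *ℤ n ≡ + 4 *ℤ (q *ℤ q) -ℤ + 4 *ℤ q -ℤ + 4 *ℤ (+ 3 *ℤ n +ℤ + 2 *ℤ m)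
      g4 = solve-∀
      g5 : ∀ q → + 4 *ℤ (q *ℤ q) -ℤ + 4 *ℤ q -ℤ + 4 *ℤ q ≡ + 4 *ℤ (q *ℤ q -ℤ + 2 *ℤ q)
      g5 = solve-∀
      term : ∀ {f c a} (s : Splits f c a) → + 2 *ℤ (Corr f f x +ℤ Corr f f x) ≡ τ +ℤ + q *ℤ c4 c x +ℤ Corr (Splits.H s) (Splits.H s) x
      term {f} s = trans (polarise f f x) (cong (_+ℤ Corr (Splits.H s) (Splits.H s) x) (Splits.Corr-PP s x x≢0))
      all-classes : ∀ x → c4 0 x +ℤ c4 1 x +ℤ c4 2 x +ℤ c4 3 x ≡ nz x
      all-classes = table-≗ (table-+ (table-+ (table-+ (cyc4-table 0) (cyc4-table 1)) (cyc4-table 2)) (cyc4-table 3)) nz-table all≡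
      odd-part : (∃ λ i → ∃ λ t → i ℕ.< 8 × x ≡ pow ω (i ℕ.+ t ℕ.* 8)) →
        Corr A.H A.H x +ℤ Corr B.H B.H x +ℤ Corr C.H C.H x +ℤ Corr D.H D.H x ≡ + 3 *ℤ (u *ℤ u) +ℤ + 0 *ℤ (u *ℤ v) +ℤ + 6 *ℤ (v *ℤ v) -ℤ + 12 *ℤ + n
      odd-part (i , t , i<8 , x≡) = begin
        Corr A.H A.H x +ℤ Corr B.H B.H x +ℤ Corr C.H C.H x +ℤ Corr D.H D.H x
          ≡⟨ cong₂ _+ℤ_ (cong₂ _+ℤ_ (cong₂ _+ℤ_ (sq A.H-table A.H-odd) (sq B.H-table B.H-odd)) (sq C.H-table C.H-odd)) (sq D.H-table D.H-odd) ⟩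
        value (c h₀) +ℤ value (c h₁) +ℤ value (c h₂) +ℤ value (c h₃) ≡⟨ cong (λ x → x +ℤ value (c h₂) +ℤ value (c h₃)) (value-⊞ (c h₀) (c h₁)) ⟩
        value (c h₀ ⊞ c h₁) +ℤ value (c h₂) +ℤ value (c h₃) ≡⟨ cong (_+ℤ value (c h₃)) (value-⊞ (c h₀ ⊞ c h₁) (c h₂)) ⟩
        value (c h₀ ⊞ c h₁ ⊞ c h₂) +ℤ value (c h₃) ≡⟨ value-⊞ (c h₀ ⊞ c h₁ ⊞ c h₂) (c h₃) ⟩
        value (c h₀ ⊞ c h₁ ⊞ c h₂ ⊞ c h₃) ≡⟨ cong value (auto i i<8) ⟩
        _ ∎
        where
        c : (ℕ → ℕ → ℤ) → Coefficients
        c h = coefs (h i) (h i)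
        sq : ∀ {f w} → HasTable f w → Odd f → Corr f f x ≡ value (coefs (λ j → w (i ℕ.+ j)) (λ j → w (i ℕ.+ j)))
        sq {f} tf of = trans (cong (Corr f f) x≡) (Corr-value tf tf of of i t)

  -- The blocks of the theorem

  cycUnion8-table : ∀ is → HasTable (𝟙 ∘ CycUnion 8 is) (v-union is)
  cycUnion8-table is = table (cong 𝟙 (any-false _ is (λ i _ → Cyc-0 8 i)))
    (λ j t → cong 𝟙 (any-cong (λ i → trans (Cyc-pow 8 8∣M i (j ℕ.+ t ℕ.* 8)) (cong (_≡ᵇ (i % 8)) ([m+kn]%n≡m%n j t 8))) is))

  lines lines⁺ : ℕ → List ℕ
  lines c₀ = map (λ i → (c₀ ℕ.+ 4 ℕ.* i) % suc q) (upTo m)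
  lines⁺ c₀ = map (λ i → i ℕ.+ 1) (lines c₀)

  union : List ℕ → List ℕ → Carrier → Bool
  union is js x = CycUnion 8 is x ∨ CycUnion (suc q) js x

  -- The octic classes avoid quartic class c, where all the lines lie. The union is therefore
  -- disjoint and its indicator is a sum.
  unionSplits : ∀ is js c → LinePart c (LU js) →
    Agree8 (λ j → v-union is j +ℤ v-union is (4 ℕ.+ j)) (λ j → + 1 -ℤ 𝟙 ((j % 4) ≡ᵇ (c % 4))) → c ℕ.< 4 →
    ∑< 8 (λ j → 𝟙 ((j % 4) ≡ᵇ (c % 4))) ≡ + 2 →
    Agree8 (λ j → v-union is j *ℤ 𝟙 ((j % 4) ≡ᵇ (c % 4))) (λ _ → + 0) →
    Splits (𝟙 ∘ union is js) c (v-union is)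
  unionSplits is js c line α-sym c<4 sum-c disj = record
    { α = 𝟙 ∘ CycUnion 8 is ; β = LU js
    ; split = λ x → 𝟙-∨ (CycUnion 8 is x) (CycUnion (suc q) js x) (disjoint x)
    ; α-table = cycUnion8-table is ; line = line ; α-sym = α-sym ; c<4 = c<4 ; sum-c = sum-c }
    where
    𝟙-∨ : ∀ a b → 𝟙 a *ℤ 𝟙 b ≡ + 0 → 𝟙 (a ∨ b) ≡ 𝟙 a +ℤ 𝟙 b
    𝟙-∨ true  false _ = refl
    𝟙-∨ false b     _ = sym (ℤP.+-identityˡ (𝟙 b))
    disjoint : ∀ x → 𝟙 (CycUnion 8 is x) *ℤ LU js x ≡ + 0
    disjoint x = trans (cong (𝟙 (CycUnion 8 is x) *ℤ_) (sym (LinePart.β-support line x))) (trans (i*jk≡j*ik (𝟙 (CycUnion 8 is x)) (LU js x) (c4 c x))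
      (trans (cong (LU js x *ℤ_) (table-≗ (table-* (cycUnion8-table is) (cyc4-table c)) (table refl (λ _ _ → refl)) disj x)) (ℤP.*-zeroʳ (LU js x))))

  linesAt : ∀ c c₀ → c₀ % 4 ≡ c % 4 → LinePart c (LU (lines c₀))
  linesAt c c₀ c≡ = progressionPart c c₀ (λ i → (c₀ ℕ.+ 4 ℕ.* i) % suc q) (λ i → m%n%n≡m%n (c₀ ℕ.+ 4 ℕ.* i) (suc q)) c≡

  shiftedLinesAt : ∀ c c₀ → suc c₀ % 4 ≡ c % 4 → LinePart c (LU (lines⁺ c₀))
  shiftedLinesAt c c₀ c≡ = subst (λ js → LinePart c (LU js)) (map-∘ (upTo m))
    (progressionPart c (suc c₀) (λ i → (c₀ ℕ.+ 4 ℕ.* i) % suc q ℕ.+ 1) (λ i → trans (%-+1 (c₀ ℕ.+ 4 ℕ.* i) (suc q)) (cong (_% suc q) (ℕP.+-comm (c₀ ℕ.+ 4 ℕ.* i) 1))) c≡)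

  -- Complements, and the half sets D_0 and D_2

  ΣF-shift : ∀ g x → ΣF (λ h → g (h - x)) ≡ ΣF g
  ΣF-shift g x = Σ-translate (- x) g

  Σ-1- : ∀ f → ΣF (λ x → + 1 -ℤ f x) ≡ + q *ℤ + q -ℤ ΣF f
  Σ-1- f = trans (∑-+ elems (λ _ → + 1) (λ x → -ℤ f x)) (cong₂ _+ℤ_ (trans (Σ-const (+ 1)) (ℤP.*-identityʳ (+ q *ℤ + q)))
    (∑-neg elems f))

  Corr-1-ʳ : ∀ f g x → Corr f (λ y → + 1 -ℤ g y) x ≡ ΣF f -ℤ Corr f g x
  Corr-1-ʳ f g x = trans (∑-cong elems (λ h → pt (f h) (g (h - x)))) (trans (∑-+ elems f _) (cong (ΣF f +ℤ_) (∑-neg elems _)))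
    where
    pt : ∀ a b → a *ℤ (+ 1 -ℤ b) ≡ a -ℤ a *ℤ b
    pt = solve-∀

  Corr-1-ˡ : ∀ f g x → Corr (λ y → + 1 -ℤ f y) g x ≡ ΣF g -ℤ Corr f g x
  Corr-1-ˡ f g x = trans (∑-cong elems (λ h → pt (f h) (g (h - x)))) (trans (∑-+ elems (λ h → g (h - x)) _) (cong₂ _+ℤ_ (ΣF-shift g x) (∑-neg elems _)))
    where
    pt : ∀ a b → (+ 1 -ℤ a) *ℤ b ≡ b -ℤ a *ℤ b
    pt = solve-∀

  Corr-1-1- : ∀ f x → Corr (λ y → + 1 -ℤ f y) (λ y → + 1 -ℤ f y) x ≡ + q *ℤ + q -ℤ ΣF f -ℤ (ΣF f -ℤ Corr f f x)
  Corr-1-1- f x = trans (Corr-1-ʳ (λ y → + 1 -ℤ f y) f x) (cong₂ _-ℤ_ (Σ-1- f) (Corr-1-ˡ f f x))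

  -- Two quartic classes form a union of 2 n = (q + 1) / 2 lines, which is a partial difference set
  -- of Paley type; `Corr-χ` states this.
  module HalfSet (is : List ℕ) (even : Agree8 (λ j → 𝟙 (any (λ i → ((4 ℕ.+ j) % 4) ≡ᵇ (i % 4)) is)) (λ j → 𝟙 (any (λ i → (j % 4) ≡ᵇ (i % 4)) is)))
                 (four : ∑< 8 (λ j → 𝟙 (any (λ i → (j % 4) ≡ᵇ (i % 4)) is)) ≡ + 4) where
    χ : Carrier → ℤ
    χ = 𝟙 ∘ CycUnion 4 is

    χ-even : Even χ
    χ-even = table-Even (cycUnion4-table is) even

    Σ-χ : ΣF χ ≡ + r *ℤ (+ 2 *ℤ + n)
    Σ-χ = trans (table-Σ (cycUnion4-table is)) (trans (cong₂ _*ℤ_ o≡ four) (trans (f (+ h) (+ n)) (cong (_*ℤ (+ 2 *ℤ + n)) (sym r≡h+h))))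
      where
      f : ∀ h n → (h *ℤ n) *ℤ + 4 ≡ (h +ℤ h) *ℤ (+ 2 *ℤ n)
      f = solve-∀

    Σ-χ² : ΣF (λ x → χ x *ℤ χ x) ≡ + r *ℤ (+ 2 *ℤ + n)
    Σ-χ² = trans (∑-cong elems (λ x → 𝟙-idem (CycUnion 4 is x))) Σ-χ

    Corr-χ-0 : Corr χ χ 0# ≡ + r *ℤ (+ 2 *ℤ + n)
    Corr-χ-0 = trans (Corr-0 χ χ) Σ-χ²

    -- With A = 2 n one has q = 2 A - 1, so in the even formula the terms -2 A χ and q χ combine to
    -- -χ.
    Corr-χ : ∀ x → x ≢ 0# → Corr χ χ x ≡ (+ 2 *ℤ + n) *ℤ (+ 2 *ℤ + n) -ℤ + 2 *ℤ + n -ℤ χ x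
    Corr-χ x x≢0 = ℤP.*-cancelˡ-≡ (+ r) _ _ (begin
      + r *ℤ C ≡⟨ i≡[j+i]-j S (+ r *ℤ C) ⟩
      (S +ℤ + r *ℤ C) -ℤ S ≡⟨ cong₂ _-ℤ_ (Corr-even-at χ-even χ-even (at-0 (cycUnion4-table is)) (at-0 (cycUnion4-table is)) A A Σ-χ Σ-χ x≢0) Σ-χ² ⟩
      + r *ℤ ((A -ℤ χ x) *ℤ A +ℤ (+ q *ℤ χ x -ℤ A) *ℤ χ x) -ℤ + r *ℤ A ≡⟨ f2 (+ r) A (+ q) (χ x) ⟩
      + r *ℤ (A *ℤ A -ℤ A -ℤ + 2 *ℤ (A *ℤ χ x) +ℤ + q *ℤ (χ x *ℤ χ x))
          ≡⟨ cong₂ (λ y z → + r *ℤ (A *ℤ A -ℤ A -ℤ + 2 *ℤ (A *ℤ χ x) +ℤ y *ℤ z)) q≡4n-1 (𝟙-idem (CycUnion 4 is x)) ⟩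
      + r *ℤ (A *ℤ A -ℤ A -ℤ + 2 *ℤ (A *ℤ χ x) +ℤ (+ 4 *ℤ + n -ℤ + 1) *ℤ χ x) ≡⟨ cong (+ r *ℤ_) (f3 (+ n) (χ x)) ⟩
      + r *ℤ (A *ℤ A -ℤ A -ℤ χ x)  ∎)
      where
      open ≡-Reasoning
      C S A : ℤ
      C = Corr χ χ x
      S = ΣF (λ x → χ x *ℤ χ x)
      A = + 2 *ℤ + n
      f2 : ∀ r A q x → r *ℤ ((A -ℤ x) *ℤ A +ℤ (q *ℤ x -ℤ A) *ℤ x) -ℤ r *ℤ A ≡ r *ℤ (A *ℤ A -ℤ A -ℤ + 2 *ℤ (A *ℤ x) +ℤ q *ℤ (x *ℤ x))
      f2 = solve-∀
      f3 : ∀ n x → (+ 2 *ℤ n) *ℤ (+ 2 *ℤ n) -ℤ + 2 *ℤ n -ℤ + 2 *ℤ (+ 2 *ℤ n *ℤ x) +ℤ (+ 4 *ℤ n -ℤ + 1) *ℤ x ≡ (+ 2 *ℤ n) *ℤ (+ 2 *ℤ n) -ℤ + 2 *ℤ n -ℤ x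
      f3 = solve-∀

  D₀ D₂ : Carrier → Bool
  D₀ = CycUnion 4 (0 ∷ 1 ∷ [])
  D₂ = CycUnion 4 (2 ∷ 3 ∷ [])

  module X₀ = HalfSet (0 ∷ 1 ∷ []) all≡ refl
  module X₂ = HalfSet (2 ∷ 3 ∷ []) all≡ refl

  halves : ∀ x → X₀.χ x +ℤ X₂.χ x ≡ nz x
  halves = table-≗ (table-+ (cycUnion4-table (0 ∷ 1 ∷ [])) (cycUnion4-table (2 ∷ 3 ∷ []))) nz-table all≡

  -- Twice this difference, contributed by the third and fourth block of the family, compensates the
  -- term 2 D_0 - 2 D_2 left over by the sets E_i.
  Corr-difference : ∀ x → Corr X₂.χ X₂.χ x -ℤ Corr X₀.χ X₀.χ x ≡ d x
  Corr-difference x = go (x ≟ 0#)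
    where
    f : ∀ a x y → a -ℤ y -ℤ (a -ℤ x) ≡ x -ℤ y
    f = solve-∀
    go : Dec (x ≡ 0#) → Corr X₂.χ X₂.χ x -ℤ Corr X₀.χ X₀.χ x ≡ d x
    go (yes z) = trans (cong (λ x → Corr X₂.χ X₂.χ x -ℤ Corr X₀.χ X₀.χ x) z) (trans (cong₂ _-ℤ_ X₂.Corr-χ-0 X₀.Corr-χ-0)
      (trans (ℤP.+-inverseʳ (+ r *ℤ (+ 2 *ℤ + n))) (sym (trans (cong d z) (at-0 d-table)))))
    go (no nz) = trans (cong₂ _-ℤ_ (X₂.Corr-χ x nz) (X₀.Corr-χ x nz)) (f ((+ 2 *ℤ + n) *ℤ (+ 2 *ℤ + n) -ℤ + 2 *ℤ + n) (X₀.χ x) (X₂.χ x))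

  -- Difference counts in the product with the group of order 2

  open DiffFam F

  slices : (Carrier → Bool) → (Carrier → Bool) → G → Bool
  slices e e′ (false , x) = e x
  slices e e′ (true  , x) = e′ x

  ∑-elemsG : ∀ f → ∑ elemsG f ≡ ΣF (λ x → f (false , x)) +ℤ ΣF (λ x → f (true , x))
  ∑-elemsG f = trans (∑-++ (map (false ,_) elems) (map (true ,_) elems ++ []) f)
    (cong₂ _+ℤ_ (∑-map elems (false ,_) f) (trans (∑-++ (map (true ,_) elems) [] f) (trans (ℤP.+-identityʳ _) (∑-map elems (true ,_) f))))

  size≡ : ∀ e e′ → + size (slices e e′) ≡ ΣF (𝟙 ∘ e) +ℤ ΣF (𝟙 ∘ e′)
  size≡ e e′ = trans (length-filterᵇ (slices e e′) elemsG) (∑-elemsG (𝟙 ∘ slices e e′))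

  -- For given x and z only y = x - z contributes, so the double sum collapses to a correlation. The
  -- Boolean b is the condition on the components of order 2.
  fibre : ∀ (e e′ : Carrier → Bool) b z → ΣF (λ x → ΣF (λ y → 𝟙 (e x ∧ e′ y ∧ (b ∧ does ((x - y) ≟ z))))) ≡ 𝟙 b *ℤ Corr (𝟙 ∘ e) (𝟙 ∘ e′) z
  fibre e e′ b z = trans (∑-cong elems outer) (∑-*ˡ elems (𝟙 b) (λ x → 𝟙 (e x) *ℤ 𝟙 (e′ (x - z))))
    where
    rearr : ∀ a c b t → a *ℤ (c *ℤ (b *ℤ t)) ≡ (b *ℤ a) *ℤ (c *ℤ t)
    rearr = solve-∀
    swap-sub : ∀ {x y z} → x - y ≡ z → y ≡ x - z
    swap-sub {x} {y} {z} e = sym (trans (cong (λ w → x - w) (sym e)) (trans (cong (_+_ x) (neg-sub x y)) (trans (+-comm x (y - x)) (sub-add y x))))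
    outer : ∀ x → ΣF (λ y → 𝟙 (e x ∧ e′ y ∧ (b ∧ does ((x - y) ≟ z)))) ≡ 𝟙 b *ℤ (𝟙 (e x) *ℤ 𝟙 (e′ (x - z)))
    outer x = trans (∑-cong elems (λ y → trans (𝟙-∧ (e x) _) (trans (cong (𝟙 (e x) *ℤ_) (trans (𝟙-∧ (e′ y) _) (cong (𝟙 (e′ y) *ℤ_) (𝟙-∧ b _))))
        (trans (rearr (𝟙 (e x)) (𝟙 (e′ y)) (𝟙 b) _) (cong (λ t → (𝟙 b *ℤ 𝟙 (e x)) *ℤ (𝟙 (e′ y) *ℤ 𝟙 t)) (does-⇔ ((x - y) ≟ z) (y ≟
            (x - z)) swap-sub (λ e → sym (swap-sub (sym e)))))))))
      (trans (∑-*ˡ elems (𝟙 b *ℤ 𝟙 (e x)) (λ y → 𝟙 (e′ y) *ℤ 𝟙 (does (y ≟ (x - z)))))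
        (trans (cong ((𝟙 b *ℤ 𝟙 (e x)) *ℤ_) (∑-delta _≟_ elems-unique (elems-complete (x - z)) (𝟙 ∘ e′))) (ℤP.*-assoc (𝟙 b) (𝟙 (e x)) _)))

  diffCount≡ : ∀ e e′ c z → + diffCount (slices e e′) (c , z) ≡
    (𝟙 (does (Data.Bool._≟_ false c)) *ℤ Corr (𝟙 ∘ e) (𝟙 ∘ e) z +ℤ 𝟙 (does (Data.Bool._≟_ true c)) *ℤ Corr (𝟙 ∘ e) (𝟙 ∘ e′) z)
    +ℤ (𝟙 (does (Data.Bool._≟_ true c)) *ℤ Corr (𝟙 ∘ e′) (𝟙 ∘ e) z +ℤ 𝟙 (does (Data.Bool._≟_ false c)) *ℤ Corr (𝟙 ∘ e′) (𝟙 ∘ e′) z)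
  diffCount≡ e e′ c z = trans (length-filterᵇ P (cartesianProduct elemsG elemsG)) (trans (∑-× elemsG elemsG (𝟙 ∘ P))
    (trans (∑-elemsG (λ x → ∑ elemsG (λ y → 𝟙 (P (x , y)))))
      (cong₂ _+ℤ_ (slice false) (slice true))))
    where
    P : G × G → Bool
    P xy = slices e e′ (proj₁ xy) ∧ slices e e′ (proj₂ xy) ∧ ((proj₁ xy -G proj₂ xy) ≟G (c , z))
    sl : Bool → Carrier → Bool
    sl b x = slices e e′ (b , x)
    sl′ : Bool → Carrier → Bool
    sl′ false = e
    sl′ true  = e′
    slice : ∀ b → ΣF (λ x → ∑ elemsG (λ y → 𝟙 (P ((b , x) , y)))) ≡
      𝟙 (does (Data.Bool._≟_ (b xor false) c)) *ℤ Corr (𝟙 ∘ sl b) (𝟙 ∘ e) z +ℤ 𝟙 (does (Data.Bool._≟_ (b xor true) c)) *ℤ Corr (𝟙 ∘ sl b) (𝟙 ∘ e′) z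
    slice b = trans (∑-cong elems (λ x → ∑-elemsG (λ y → 𝟙 (P ((b , x) , y))))) (trans (∑-+ elems _ _)
      (cong₂ _+ℤ_ (fibre (sl b) e (does (Data.Bool._≟_ (b xor false) c)) z) (fibre (sl b) e′ (does (Data.Bool._≟_ (b xor true) c)) z)))

  diffCount-false : ∀ e e′ z → + diffCount (slices e e′) (false , z) ≡ Corr (𝟙 ∘ e) (𝟙 ∘ e) z +ℤ Corr (𝟙 ∘ e′) (𝟙 ∘ e′) z
  diffCount-false e e′ z = trans (diffCount≡ e e′ false z) (f (Corr (𝟙 ∘ e) (𝟙 ∘ e) z) (Corr (𝟙 ∘ e) (𝟙 ∘ e′) z) (Corr (𝟙 ∘ e′) (𝟙 ∘ e) z) (Corr (𝟙 ∘ e′) (𝟙 ∘ e′) z))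
    where
    f : ∀ a b c d → (+ 1 *ℤ a +ℤ + 0 *ℤ b) +ℤ (+ 0 *ℤ c +ℤ + 1 *ℤ d) ≡ a +ℤ d
    f = solve-∀

  diffCount-true : ∀ e e′ z → + diffCount (slices e e′) (true , z) ≡ Corr (𝟙 ∘ e) (𝟙 ∘ e′) z +ℤ Corr (𝟙 ∘ e′) (𝟙 ∘ e) z
  diffCount-true e e′ z = trans (diffCount≡ e e′ true z) (f (Corr (𝟙 ∘ e) (𝟙 ∘ e) z) (Corr (𝟙 ∘ e) (𝟙 ∘ e′) z) (Corr (𝟙 ∘ e′) (𝟙 ∘ e) z) (Corr (𝟙 ∘ e′) (𝟙 ∘ e′) z))
    where
    f : ∀ a b c d → (+ 0 *ℤ a +ℤ + 1 *ℤ b) +ℤ (+ 1 *ℤ c +ℤ + 0 *ℤ d) ≡ b +ℤ c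
    f = solve-∀

  open GroupRing F using (⟦_⟧; 𝔽; _·_; _⊕_; _⊝_; _⊙_; _⁽⁻¹⁾)

  ·-Corr : ∀ (e e′ : Carrier → Bool) g → (⟦ e ⟧ · ⟦ e′ ⟧ ⁽⁻¹⁾) g ≡ Corr (𝟙 ∘ e) (𝟙 ∘ e′) g
  ·-Corr e e′ g = trans (∑-foldr elems _) (∑-cong elems (λ h → cong (λ z → 𝟙 (e h) *ℤ 𝟙 (e′ z)) (neg-sub g h)))

  module _ {e₀ e₁ e₂ e₃ : Carrier → Bool} {a₀ a₁ a₂ a₃ : ℕ → ℤ} {σ : ℤ}
           (s₀ : Splits (𝟙 ∘ e₀) 1 a₀) (s₁ : Splits (𝟙 ∘ e₁) 3 a₁) (s₂ : Splits (𝟙 ∘ e₂) 2 a₂) (s₃ : Splits (𝟙 ∘ e₃) 0 a₃)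
           (pat : Pattern a₀ a₁ a₂ a₃ σ) (norm-4 : u *ℤ u +ℤ (-ℤ + 2 *ℤ σ) *ℤ (u *ℤ v) +ℤ v *ℤ v ≡ + 4) where
    private
      module Fam = Family s₀ s₁ s₂ s₃ pat norm-4

      f₀ f₁ f₂ f₃ : Carrier → ℤ
      f₀ = 𝟙 ∘ e₀
      f₁ = 𝟙 ∘ e₁
      f₂ = 𝟙 ∘ e₂
      f₃ = 𝟙 ∘ e₃

      double-size : ∀ {f c a} → Splits f c a → + 2 *ℤ ΣF f ≡ + r *ℤ + q
      double-size {f} s = trans (two (ΣF f)) (trans (cong (ΣF f +ℤ_) (sym (Σ-negate f))) (trans (sym (∑-+ elems f (λ x → f (- x)))) (Splits.Σ-P s)))
        where
        two : ∀ x → + 2 *ℤ x ≡ x +ℤ x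
        two = solve-∀

    identity : ∀ g → (⟦ e₀ ⟧ · ⟦ e₁ ⟧ ⁽⁻¹⁾ ⊕ ⟦ e₁ ⟧ · ⟦ e₀ ⟧ ⁽⁻¹⁾ ⊕ ⟦ e₂ ⟧ · ⟦ e₃ ⟧ ⁽⁻¹⁾ ⊕ ⟦ e₃ ⟧ · ⟦ e₂ ⟧ ⁽⁻¹⁾) g
                   ≡ ((+ (r ℕ.* r) ⊙ 𝔽) ⊕ (+ 2 ⊙ ⟦ D₀ ⟧) ⊝ (+ 2 ⊙ ⟦ D₂ ⟧)) g
    identity g = trans (cong₂ _+ℤ_ (cong₂ _+ℤ_ (cong₂ _+ℤ_ (·-Corr e₀ e₁ g) (·-Corr e₁ e₀ g)) (·-Corr e₂ e₃ g)) (·-Corr e₃ e₂ g))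
      (trans (Fam.cross-Corr g) (trans (fin (+ r *ℤ + r) (𝟙 (D₀ g)) (𝟙 (D₂ g))) (cong (λ w → (w *ℤ + 1 +ℤ + 2 *ℤ 𝟙 (D₀ g)) -ℤ + 2 *ℤ 𝟙 (D₂ g)) (sym (ℤP.pos-* r r)))))
      where
      fin : ∀ s x y → s +ℤ + 2 *ℤ (x -ℤ y) ≡ (s *ℤ + 1 +ℤ + 2 *ℤ x) -ℤ + 2 *ℤ y
      fin = solve-∀

    B₁ B₂ B₃ B₄ : G → Bool
    B₁ = slices e₀ (not ∘ e₁)
    B₂ = slices e₂ (not ∘ e₃)
    B₃ = slices (not ∘ D₀) D₀
    B₄ = slices D₂ D₂

    private
      q² : + (q ℕ.* q) ≡ + q *ℤ + q
      q² = ℤP.pos-* q q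

      Σ-not : ∀ (e : Carrier → Bool) → ΣF (𝟙 ∘ not ∘ e) ≡ + q *ℤ + q -ℤ ΣF (𝟙 ∘ e)
      Σ-not e = trans (∑-cong elems (𝟙-not ∘ e)) (Σ-1- (𝟙 ∘ e))

      Corr-not-not : ∀ (e : Carrier → Bool) x → Corr (𝟙 ∘ not ∘ e) (𝟙 ∘ not ∘ e) x ≡ + q *ℤ + q -ℤ ΣF (𝟙 ∘ e) -ℤ (ΣF (𝟙 ∘ e) -ℤ Corr (𝟙 ∘ e) (𝟙 ∘ e) x)
      Corr-not-not e x = trans (Corr-cong (𝟙-not ∘ e) (𝟙-not ∘ e) x) (Corr-1-1- (𝟙 ∘ e) x)

      Corr-notʳ : ∀ (e e′ : Carrier → Bool) x → Corr (𝟙 ∘ e) (𝟙 ∘ not ∘ e′) x ≡ ΣF (𝟙 ∘ e) -ℤ Corr (𝟙 ∘ e) (𝟙 ∘ e′) x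
      Corr-notʳ e e′ x = trans (Corr-cong {𝟙 ∘ e} (λ _ → refl) (𝟙-not ∘ e′) x) (Corr-1-ʳ (𝟙 ∘ e) (𝟙 ∘ e′) x)

      Corr-notˡ : ∀ (e e′ : Carrier → Bool) x → Corr (𝟙 ∘ not ∘ e) (𝟙 ∘ e′) x ≡ ΣF (𝟙 ∘ e′) -ℤ Corr (𝟙 ∘ e) (𝟙 ∘ e′) x
      Corr-notˡ e e′ x = trans (Corr-cong {g = 𝟙 ∘ e′} (𝟙-not ∘ e) (λ _ → refl) x) (Corr-1-ˡ (𝟙 ∘ e) (𝟙 ∘ e′) x)

      size-pair : ∀ {e e′ : Carrier → Bool} {c c′ a a′} → Splits (𝟙 ∘ e) c a → Splits (𝟙 ∘ e′) c′ a′ → size (slices e (not ∘ e′)) ≡ q ℕ.* q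
      size-pair {e} {e′} s s′ = ℤP.+-injective (trans (size≡ e (not ∘ e′)) (trans (cong (ΣF (𝟙 ∘ e) +ℤ_) (Σ-not e′))
        (trans (ℤP.*-cancelˡ-≡ (+ 2) _ _ (trans (f (ΣF (𝟙 ∘ e)) (ΣF (𝟙 ∘ e′)) (+ q *ℤ + q)) (trans (cong₂ (λ x y → x +ℤ + 2 *ℤ
            (+ q *ℤ + q) -ℤ y) (double-size s) (double-size s′)) (g (+ r *ℤ + q) (+ q *ℤ + q))))) (sym q²))))
        where
        f : ∀ x y q → + 2 *ℤ (x +ℤ (q -ℤ y)) ≡ + 2 *ℤ x +ℤ + 2 *ℤ q -ℤ + 2 *ℤ y
        f = solve-∀
        g : ∀ x q → x +ℤ + 2 *ℤ q -ℤ x ≡ + 2 *ℤ q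
        g = solve-∀

      size-B₃ : size B₃ ≡ q ℕ.* q
      size-B₃ = ℤP.+-injective (trans (size≡ (not ∘ D₀) D₀) (trans (cong (_+ℤ ΣF (𝟙 ∘ D₀)) (Σ-not D₀)) (trans (f (ΣF (𝟙 ∘ D₀)) (+ q *ℤ + q)) (sym q²))))
        where
        f : ∀ x q → (q -ℤ x) +ℤ x ≡ q
        f = solve-∀

      size-B₄ : size B₄ ≡ M
      size-B₄ = ℤP.+-injective (trans (size≡ D₂ D₂) (trans (cong₂ _+ℤ_ X₂.Σ-χ X₂.Σ-χ) (trans (f (+ r) (+ n)) (trans (cong (+ r *ℤ_) (sym q+1≡4n))
        (trans (cong (+ r *ℤ_) (ℤP.+-comm (+ q) (+ 1))) (trans (sym (ℤP.pos-* r (suc q))) (cong +_ (sym M≡r*[q+1]))))))))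
        where
        f : ∀ r n → r *ℤ (+ 2 *ℤ n) +ℤ r *ℤ (+ 2 *ℤ n) ≡ r *ℤ (+ 4 *ℤ n)
        f = solve-∀

      λ′ : 2 ℕ.* (q ℕ.* q) ℕ.∸ 2 ≡ 2 ℕ.* M
      λ′ = cong (ℕ._∸ 2) (ℕP.*-suc 2 M)

      2M : + (2 ℕ.* M) ≡ + 2 *ℤ (+ r *ℤ (+ q +ℤ + 1))
      2M = trans (ℤP.pos-* 2 M) (cong (+ 2 *ℤ_) (trans (cong +_ M≡r*[q+1]) (trans (ℤP.pos-* r (suc q)) (cong (+ r *ℤ_) (ℤP.+-comm (+ 1) (+ q))))))

      total : G → ℕ
      total g = diffCount B₁ g ℕ.+ (diffCount B₂ g ℕ.+ (diffCount B₃ g ℕ.+ (diffCount B₄ g ℕ.+ 0)))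

      total≡ : ∀ g {w x y z} → + diffCount B₁ g ≡ w → + diffCount B₂ g ≡ x → + diffCount B₃ g ≡ y → + diffCount B₄ g ≡ z → + total g ≡ w +ℤ (x +ℤ (y +ℤ (z +ℤ + 0)))
      total≡ g refl refl refl refl = refl

      A : ℤ
      A = + 2 *ℤ + n

      -- Complementing a slice changes its autocorrelation by a constant. What remains is
      -- `auto-Corr` and twice the autocorrelations of D_0 and D_2, whose sum is constant off 0 by
      -- `halves`.
      on-false : ∀ z → z ≢ 0# → + total (false , z) ≡ + 2 *ℤ (+ r *ℤ (+ q +ℤ + 1))
      on-false z z≢0 = begin
        + total (false , z) ≡⟨ total≡ (false , z) (diffCount-false e₀ (not ∘ e₁) z) (diffCount-false e₂ (not ∘ e₃) z) (diffCount-false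
            (not ∘ D₀) D₀ z) (diffCount-false D₂ D₂ z) ⟩
        _ ≡⟨ cong₂ _+ℤ_ (cong (Corr f₀ f₀ z +ℤ_) (Corr-not-not e₁ z)) (cong₂ _+ℤ_ (cong (Corr f₂ f₂ z +ℤ_) (Corr-not-not e₃ z))
               (cong₂ _+ℤ_ (cong (_+ℤ Corr X₀.χ X₀.χ z) (Corr-not-not D₀ z)) refl)) ⟩
        _ ≡⟨ f1 (Corr f₀ f₀ z) (Corr f₁ f₁ z) (Corr f₂ f₂ z) (Corr f₃ f₃ z) (ΣF f₁) (ΣF f₃) (+ q *ℤ + q) (ΣF X₀.χ) (Corr X₀.χ X₀.χ z) (Corr X₂.χ X₂.χ z) ⟩
        (Corr f₀ f₀ z +ℤ Corr f₁ f₁ z +ℤ Corr f₂ f₂ z +ℤ Corr f₃ f₃ z) -ℤ + 2 *ℤ ΣF f₁ -ℤ + 2 *ℤ ΣF f₃ +ℤ + 3 *ℤ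
            (+ q *ℤ + q) -ℤ + 2 *ℤ ΣF X₀.χ +ℤ + 2 *ℤ (Corr X₀.χ X₀.χ z +ℤ Corr X₂.χ X₂.χ z)
          ≡⟨ cong₂ _+ℤ_ (cong₂ (λ a b → a +ℤ + 3 *ℤ (+ q *ℤ + q) -ℤ + 2 *ℤ b) (cong₂ _-ℤ_ (cong₂ _-ℤ_ (Fam.auto-Corr z z≢0) (double-size s₁)) (double-size s₃)) X₀.Σ-χ)
               (cong (+ 2 *ℤ_) (trans (cong₂ _+ℤ_ (X₀.Corr-χ z z≢0) (X₂.Corr-χ z z≢0)) (trans (f2 (A *ℤ A -ℤ A) (X₀.χ z) (X₂.χ z)) (cong
                   (λ w → + 2 *ℤ (A *ℤ A -ℤ A) -ℤ w) (trans (halves z) (nz≡1 z≢0)))))) ⟩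
        (+ q *ℤ + q -ℤ + 2 *ℤ + q -ℤ + r *ℤ + q -ℤ + r *ℤ + q) +ℤ + 3 *ℤ (+ q *ℤ + q) -ℤ + 2 *ℤ (+ r *ℤ A) +ℤ + 2 *ℤ (+ 2 *ℤ (A *ℤ A -ℤ A) -ℤ + 1)
          -- n is collected into multiples of 4 n, so that it can be replaced by q + 1 and
          -- everything becomes a polynomial in r.
          ≡⟨ f3 (+ r) (+ q) (+ n) ⟩
        (+ q *ℤ + q -ℤ + 2 *ℤ + q -ℤ + r *ℤ + q -ℤ + r *ℤ + q) +ℤ + 3 *ℤ (+ q *ℤ + q) -ℤ + r *ℤ (+ 4 *ℤ + n) +ℤ ((+ 4 *ℤ + n) *ℤ (+ 4 *ℤ + n) -ℤ + 2 *ℤ (+ 4 *ℤ + n) -ℤ + 2)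
          ≡⟨ cong (λ w → (+ q *ℤ + q -ℤ + 2 *ℤ + q -ℤ + r *ℤ + q -ℤ + r *ℤ + q) +ℤ + 3 *ℤ (+ q *ℤ + q) -ℤ + r *ℤ w +ℤ (w *ℤ w -ℤ + 2 *ℤ w -ℤ + 2)) (sym q+1≡4n) ⟩
        _ ≡⟨ f4 (+ r) ⟩
        + 2 *ℤ (+ r *ℤ (+ q +ℤ + 1)) ∎
        where
        open ≡-Reasoning
        f1 : ∀ c₀ c₁ c₂ c₃ s₁ s₃ Q x c d → (c₀ +ℤ (Q -ℤ s₁ -ℤ (s₁ -ℤ c₁))) +ℤ ((c₂ +ℤ (Q -ℤ s₃ -ℤ (s₃ -ℤ c₃))) +ℤ (((Q -ℤ x -ℤ (x -ℤ c)) +ℤ c) +ℤ ((d +ℤ d) +ℤ + 0)))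
           ≡ (c₀ +ℤ c₁ +ℤ c₂ +ℤ c₃) -ℤ + 2 *ℤ s₁ -ℤ + 2 *ℤ s₃ +ℤ + 3 *ℤ Q -ℤ + 2 *ℤ x +ℤ + 2 *ℤ (c +ℤ d)
        f1 = solve-∀
        f2 : ∀ a x y → (a -ℤ x) +ℤ (a -ℤ y) ≡ + 2 *ℤ a -ℤ (x +ℤ y)
        f2 = solve-∀
        f3 : ∀ r q n → (q *ℤ q -ℤ + 2 *ℤ q -ℤ r *ℤ q -ℤ r *ℤ q) +ℤ + 3 *ℤ (q *ℤ q) -ℤ + 2 *ℤ (r *ℤ (+ 2 *ℤ n)) +ℤ + 2 *ℤ (+ 2 *ℤ ((+ 2 *ℤ n) *ℤ (+ 2 *ℤ n) -ℤ + 2 *ℤ n) -ℤ + 1)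
           ≡ (q *ℤ q -ℤ + 2 *ℤ q -ℤ r *ℤ q -ℤ r *ℤ q) +ℤ + 3 *ℤ (q *ℤ q) -ℤ r *ℤ (+ 4 *ℤ n) +ℤ ((+ 4 *ℤ n) *ℤ (+ 4 *ℤ n) -ℤ + 2 *ℤ (+ 4 *ℤ n) -ℤ + 2)
        f3 = solve-∀
        f4 : ∀ r → ((+ 1 +ℤ r) *ℤ (+ 1 +ℤ r) -ℤ + 2 *ℤ (+ 1 +ℤ r) -ℤ r *ℤ (+ 1 +ℤ r) -ℤ r *ℤ (+ 1 +ℤ r)) +ℤ + 3 *ℤ ((+ 1 +ℤ r) *ℤ (+ 1 +ℤ r)) -ℤ r *ℤ (+ 1 +ℤ r +ℤ + 1)
                   +ℤ ((+ 1 +ℤ r +ℤ + 1) *ℤ (+ 1 +ℤ r +ℤ + 1) -ℤ + 2 *ℤ (+ 1 +ℤ r +ℤ + 1) -ℤ + 2) ≡ + 2 *ℤ (r *ℤ (+ 1 +ℤ r +ℤ + 1))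
        f4 = solve-∀

      -- Complementing one of two slices reverses the sign of their cross correlations. The sets E_i
      -- thus contribute -2 (D_0 - D_2) besides constants, and `Corr-difference` restores it.
      on-true : ∀ z → + total (true , z) ≡ + 2 *ℤ (+ r *ℤ (+ q +ℤ + 1))
      on-true z = begin
        + total (true , z) ≡⟨ total≡ (true , z) (diffCount-true e₀ (not ∘ e₁) z) (diffCount-true e₂ (not ∘ e₃) z) (diffCount-true (not ∘ D₀) D₀ z) (diffCount-true D₂ D₂ z) ⟩
        _ ≡⟨ cong₂ _+ℤ_ (cong₂ _+ℤ_ (Corr-notʳ e₀ e₁ z) (Corr-notˡ e₁ e₀ z)) (cong₂ _+ℤ_ (cong₂ _+ℤ_ (Corr-notʳ e₂ e₃ z) (Corr-notˡ e₃ e₂ z))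
               (cong₂ _+ℤ_ (cong₂ _+ℤ_ (Corr-notˡ D₀ D₀ z) (Corr-notʳ D₀ D₀ z)) refl)) ⟩
        _ ≡⟨ f1 (ΣF f₀) (ΣF f₂) (Corr f₀ f₁ z) (Corr f₁ f₀ z) (Corr f₂ f₃ z) (Corr f₃ f₂ z) (ΣF X₀.χ) (Corr X₀.χ X₀.χ z) (Corr X₂.χ X₂.χ z) ⟩
        + 2 *ℤ ΣF f₀ +ℤ + 2 *ℤ ΣF f₂ -ℤ (Corr f₀ f₁ z +ℤ Corr f₁ f₀ z +ℤ Corr f₂ f₃ z +ℤ Corr f₃ f₂ z) +ℤ + 2 *ℤ ΣF X₀.χ +ℤ + 2 *ℤ (Corr X₂.χ X₂.χ z -ℤ Corr X₀.χ X₀.χ z)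
          ≡⟨ cong₂ _+ℤ_ (cong₂ (λ a b → a +ℤ + 2 *ℤ b) (cong₂ _-ℤ_ (cong₂ _+ℤ_ (double-size s₀) (double-size s₂))
              (Fam.cross-Corr z)) X₀.Σ-χ) (cong (+ 2 *ℤ_) (Corr-difference z)) ⟩
        (+ r *ℤ + q +ℤ + r *ℤ + q) -ℤ (+ r *ℤ + r +ℤ + 2 *ℤ d z) +ℤ + 2 *ℤ (+ r *ℤ A) +ℤ + 2 *ℤ d z ≡⟨ f2 (+ r) (+ q) (+ n) (d z) ⟩
        (+ r *ℤ + q +ℤ + r *ℤ + q) -ℤ + r *ℤ + r +ℤ + r *ℤ (+ 4 *ℤ + n) ≡⟨ cong (λ w → (+ r *ℤ + q +ℤ + r *ℤ + q) -ℤ + r *ℤ + r +ℤ + r *ℤ w) (sym q+1≡4n) ⟩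
        _ ≡⟨ f3 (+ r) ⟩
        + 2 *ℤ (+ r *ℤ (+ q +ℤ + 1)) ∎
        where
        open ≡-Reasoning
        f1 : ∀ s t a b c e x y z → ((s -ℤ a) +ℤ (s -ℤ b)) +ℤ (((t -ℤ c) +ℤ (t -ℤ e)) +ℤ (((x -ℤ y) +ℤ (x -ℤ y)) +ℤ ((z +ℤ z) +ℤ + 0)))
           ≡ + 2 *ℤ s +ℤ + 2 *ℤ t -ℤ (a +ℤ b +ℤ c +ℤ e) +ℤ + 2 *ℤ x +ℤ + 2 *ℤ (z -ℤ y)
        f1 = solve-∀
        f2 : ∀ r q n d → (r *ℤ q +ℤ r *ℤ q) -ℤ (r *ℤ r +ℤ + 2 *ℤ d) +ℤ + 2 *ℤ (r *ℤ (+ 2 *ℤ n)) +ℤ + 2 *ℤ d ≡ (r *ℤ q +ℤ r *ℤ q) -ℤ r *ℤ r +ℤ r *ℤ (+ 4 *ℤ n)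
        f2 = solve-∀
        f3 : ∀ r → (r *ℤ (+ 1 +ℤ r) +ℤ r *ℤ (+ 1 +ℤ r)) -ℤ r *ℤ r +ℤ r *ℤ (+ 1 +ℤ r +ℤ + 1) ≡ + 2 *ℤ (r *ℤ (+ 1 +ℤ r +ℤ + 1))
        f3 = solve-∀

      balanced : ∀ g → (g ≟G 0G) ≡ false → total g ≡ 2 ℕ.* (q ℕ.* q) ℕ.∸ 2
      balanced (true  , z) _  = trans (ℤP.+-injective (trans (on-true z) (sym 2M))) (sym λ′)
      balanced (false , z) ne = trans (ℤP.+-injective (trans (on-false z (λ e → true≢false (trans (sym (dec-true (z ≟ 0#) e)) ne))) (sym 2M))) (sym λ′)
        where
        true≢false : true ≡ false → ⊥
        true≢false ()

    differenceFamily : ∃ λ Bs → IsDifferenceFamily Bs (q ℕ.* q ∷ q ℕ.* q ∷ q ℕ.* q ∷ q ℕ.* q ℕ.∸ 1 ∷ []) (2 ℕ.* (q ℕ.* q) ℕ.∸ 2)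
    differenceFamily = (B₁ ∷ B₂ ∷ B₃ ∷ B₄ ∷ []) ,
      cong₂ _∷_ (size-pair s₀ s₁) (cong₂ _∷_ (size-pair s₂ s₃) (cong₂ _∷_ size-B₃ (cong₂ _∷_ size-B₄ refl))) , balanced

-- The two cases of the theorem

module Final
  (m r p k : ℕ) (1≤m : 1 ℕ.≤ m) (q≡8m+3 : suc r ≡ 8 ℕ.* m ℕ.+ 3) (pp : Prime p) (q≡p^k : suc r ≡ p ℕ.^ k)
  (F : FiniteField) (order≡ : FiniteField.order F ≡ suc r ℕ.* suc r)
  (ω : FiniteField.Carrier F) (prim : FiniteField.IsPrimitive F ω) where

  r≡ : r ≡ 8 ℕ.* m ℕ.+ 2
  r≡ = ℕP.suc-injective (trans q≡8m+3 (ℕP.+-suc (8 ℕ.* m) 2))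

  open Construction m r p k r≡ (subst (2 ℕ.≤_) (sym r≡) (ℕP.m≤n+m 2 (8 ℕ.* m))) pp q≡p^k F order≡ ω prim public

  expand-a : ∀ u v → u *ℤ u +ℤ (-ℤ + 2 *ℤ + 1) *ℤ (u *ℤ v) +ℤ v *ℤ v ≡ (u -ℤ v) *ℤ (u -ℤ v)
  expand-a = solve-∀

  expand-b : ∀ u v → u *ℤ u +ℤ (-ℤ + 2 *ℤ -ℤ + 1) *ℤ (u *ℤ v) +ℤ v *ℤ v ≡ (u +ℤ v) *ℤ (u +ℤ v)
  expand-b = solve-∀

  -- The odd one out in I is y = 3, so the progressions of line indices start at y + 2 = 5 and y =
  -- 3.
  module CaseA where
    e₀ = union (0 ∷ 2 ∷ 3 ∷ []) (lines 5)
    e₁ = union (2 ∷ 4 ∷ 5 ∷ []) (lines 3)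
    e₂ = union (1 ∷ 3 ∷ 4 ∷ []) (lines⁺ 5)
    e₃ = union (3 ∷ 5 ∷ 6 ∷ []) (lines⁺ 3)

    s₀ : Splits (𝟙 ∘ e₀) 1 (v-union (0 ∷ 2 ∷ 3 ∷ []))
    s₀ = unionSplits (0 ∷ 2 ∷ 3 ∷ []) (lines 5) 1 (linesAt 1 5 refl) all≡ (s≤s (s≤s z≤n)) refl all≡

    s₁ : Splits (𝟙 ∘ e₁) 3 (v-union (2 ∷ 4 ∷ 5 ∷ []))
    s₁ = unionSplits (2 ∷ 4 ∷ 5 ∷ []) (lines 3) 3 (linesAt 3 3 refl) all≡ (s≤s (s≤s (s≤s (s≤s z≤n)))) refl all≡

    s₂ : Splits (𝟙 ∘ e₂) 2 (v-union (1 ∷ 3 ∷ 4 ∷ []))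
    s₂ = unionSplits (1 ∷ 3 ∷ 4 ∷ []) (lines⁺ 5) 2 (shiftedLinesAt 2 5 refl) all≡ (s≤s (s≤s (s≤s z≤n))) refl all≡

    s₃ : Splits (𝟙 ∘ e₃) 0 (v-union (3 ∷ 5 ∷ 6 ∷ []))
    s₃ = unionSplits (3 ∷ 5 ∷ 6 ∷ []) (lines⁺ 3) 0 (shiftedLinesAt 0 3 refl) all≡ (s≤s z≤n) refl all≡

  -- Here y = 7, and the progressions start at 9 and 7. Shifted octic indices such as 9 and 10 are
  -- kept unreduced, in the form in which the statement produces them.
  module CaseB where
    e₀ = union (0 ∷ 2 ∷ 7 ∷ []) (lines 9)
    e₁ = union (2 ∷ 4 ∷ 9 ∷ []) (lines 7)
    e₂ = union (1 ∷ 3 ∷ 8 ∷ []) (lines⁺ 9)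
    e₃ = union (3 ∷ 5 ∷ 10 ∷ []) (lines⁺ 7)

    s₀ : Splits (𝟙 ∘ e₀) 1 (v-union (0 ∷ 2 ∷ 7 ∷ []))
    s₀ = unionSplits (0 ∷ 2 ∷ 7 ∷ []) (lines 9) 1 (linesAt 1 9 refl) all≡ (s≤s (s≤s z≤n)) refl all≡

    s₁ : Splits (𝟙 ∘ e₁) 3 (v-union (2 ∷ 4 ∷ 9 ∷ []))
    s₁ = unionSplits (2 ∷ 4 ∷ 9 ∷ []) (lines 7) 3 (linesAt 3 7 refl) all≡ (s≤s (s≤s (s≤s (s≤s z≤n)))) refl all≡

    s₂ : Splits (𝟙 ∘ e₂) 2 (v-union (1 ∷ 3 ∷ 8 ∷ []))
    s₂ = unionSplits (1 ∷ 3 ∷ 8 ∷ []) (lines⁺ 9) 2 (shiftedLinesAt 2 9 refl) all≡ (s≤s (s≤s (s≤s z≤n))) refl all≡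

    s₃ : Splits (𝟙 ∘ e₃) 0 (v-union (3 ∷ 5 ∷ 10 ∷ []))
    s₃ = unionSplits (3 ∷ 5 ∷ 10 ∷ []) (lines⁺ 7) 0 (shiftedLinesAt 0 7 refl) all≡ (s≤s z≤n) refl all≡

theorem3p5 :
  (m : ℕ) → m ≥ 1 →
  (q : ℕ) → q ≡ 8 ℕ.* m ℕ.+ 3 →
  (p k : ℕ) → Prime p → k ≥ 1 → q ≡ p ℕ.^ k →
  (F : FiniteField) → FiniteField.order F ≡ q ℕ.* q →
  (ω : FiniteField.Carrier F) → FiniteField.IsPrimitive F ω →
  (a b : ℤ) →
  + (q ℕ.* q) ≡ a ℤ.* a ℤ.+ + 2 ℤ.* (b ℤ.* b) →
  ¬ (p ∣ ℤ.∣ a ∣) →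
  (+ 4) ℤD.∣ (a ℤ.- + 1) →
  + (64 ℕ.* GroupRing.countF F
        (λ z → Cyclotomy.Cyc F ω 8 1 z ∧
               Cyclotomy.Cyc F ω 8 2 (FiniteField._+_ F z (FiniteField.1# F))))
    ≡ + (q ℕ.* q) ℤ.+ + 1 ℤ.+ + (6 ℕ.* q) ℤ.+ + 4 ℤ.* a ℤ.+ + 16 ℤ.* b →
  (I : List ℕ) →
  ((I ≡ 0 ∷ 2 ∷ 3 ∷ []) × (+ (3 ℕ.* q) ≡ a ℤ.+ + 4 ℤ.* b ℤ.+ + 16)) ⊎
  ((I ≡ 0 ∷ 2 ∷ 7 ∷ []) × (+ (3 ℕ.* q) ≡ a ℤ.- + 4 ℤ.* b ℤ.+ + 16)) →
  let open FiniteField F using (Carrier)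
      open GroupRing F
      open Cyclotomy F ω
      y  = parityOutlier I
      J₁ = map (λ i → (y ℕ.+ 2 ℕ.+ 4 ℕ.* i) % ℕ.suc q) (upTo m)
      J₂ = map (λ i → (y ℕ.+ 4 ℕ.* i) % ℕ.suc q) (upTo m)
      shift = λ (s : ℕ) (is : List ℕ) → map (λ i → i ℕ.+ s) is
      L  = λ (js : List ℕ) → CycUnion (ℕ.suc q) js
      E₀ = λ x → CycUnion 8 I x ∨ L J₁ x
      E₁ = λ x → CycUnion 8 (shift 2 I) x ∨ L J₂ x
      E₂ = λ x → CycUnion 8 (shift 1 I) x ∨ L (shift 1 J₁) x
      E₃ = λ x → CycUnion 8 (shift 3 I) x ∨ L (shift 1 J₂) x
      D₀ = CycUnion 4 (0 ∷ 1 ∷ [])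
      D₂ = CycUnion 4 (2 ∷ 3 ∷ [])
  in (∀ (g : Carrier) →
        (⟦ E₀ ⟧ · ⟦ E₁ ⟧ ⁽⁻¹⁾ ⊕ ⟦ E₁ ⟧ · ⟦ E₀ ⟧ ⁽⁻¹⁾
          ⊕ ⟦ E₂ ⟧ · ⟦ E₃ ⟧ ⁽⁻¹⁾ ⊕ ⟦ E₃ ⟧ · ⟦ E₂ ⟧ ⁽⁻¹⁾) g
        ≡ ((+ ((q ℕ.∸ 1) ℕ.* (q ℕ.∸ 1)) ⊙ 𝔽) ⊕ (+ 2 ⊙ ⟦ D₀ ⟧) ⊝ (+ 2 ⊙ ⟦ D₂ ⟧)) g)
     × (∃ λ (Bs : List (DiffFam.G F → Bool)) →
          DiffFam.IsDifferenceFamily F Bs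
            (q ℕ.* q ∷ q ℕ.* q ∷ q ℕ.* q ∷ q ℕ.* q ℕ.∸ 1 ∷ [])
            (2 ℕ.* (q ℕ.* q) ℕ.∸ 2))
theorem3p5 m 1≤m zero q≡8m+3 _ _ _ _ _ _ _ _ _ _ _ _ _ _ _ _ _ = ⊥-elim (ℕP.m+1+n≢0 (8 ℕ.* m) {2} (sym q≡8m+3))
theorem3p5 m 1≤m (suc r) q≡8m+3 p k pp _ q≡p^k F order≡ ω prim a b quad _ _ count _ (inj₁ (refl , eq)) =
  identity {e₀} {e₁} {e₂} {e₃} s₀ s₁ s₂ s₃ patternA norm-4 ,
  differenceFamily {e₀} {e₁} {e₂} {e₃} s₀ s₁ s₂ s₃ patternA norm-4
  where
  open Final m r p k 1≤m q≡8m+3 pp q≡p^k F order≡ ω prim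
  open CaseA
  norm-4 : u *ℤ u +ℤ (-ℤ + 2 *ℤ + 1) *ℤ (u *ℤ v) +ℤ v *ℤ v ≡ + 4
  norm-4 = trans (expand-a u v) (Arithmetic.case-a m q p k 1≤m q≡8m+3 pp q≡p^k u v a b norm (link a b count) eq)
theorem3p5 m 1≤m (suc r) q≡8m+3 p k pp _ q≡p^k F order≡ ω prim a b quad _ _ count _ (inj₂ (refl , eq)) =
  identity {e₀} {e₁} {e₂} {e₃} s₀ s₁ s₂ s₃ patternB norm-4 ,
  differenceFamily {e₀} {e₁} {e₂} {e₃} s₀ s₁ s₂ s₃ patternB norm-4
  where
  open Final m r p k 1≤m q≡8m+3 pp q≡p^k F order≡ ω prim
  open CaseB
  norm-4 : u *ℤ u +ℤ (-ℤ + 2 *ℤ -ℤ + 1) *ℤ (u *ℤ v) +ℤ v *ℤ v ≡ + 4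
  norm-4 = trans (expand-b u v) (Arithmetic.case-b m q p k 1≤m q≡8m+3 pp q≡p^k u v a b norm (link a b count) quad eq)
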